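{- Let $m$ be a string transduction. Then $m\in\mathrm{MSO}_e$ if and only if $m\in\bigcup_{k\ge1}\mathrm{NGSM}^k$ and $m$ is functional.
   Context: A relation $R$ is functional if $(w,z_1),(w,z_2)\in R$ imply $z_1=z_2$. Composition: $R_1;R_2=\{(w_1,w_3)\mid\exists w_2:(w_1,w_2)\in R_1,(w_2,w_3)\in R_2\}$; $\mathrm{NGSM}^k$ is the family of $k$-fold compositions of transductions in $\mathrm{NGSM}$. 2gsm: $M=(Q,\Sigma_1,\Sigma_2,\delta,q_{in},q_f)$ with finite $Q$ and instructions $(p,\sigma,q_1,\alpha_1,\epsilon_1,q_0,\alpha_0,\epsilon_0)$, $p\ne q_f$, $\sigma\in\Sigma_1\cup\{\vdash,\dashv\}$, $\alpha_i\in\Sigma_2^*$, $\epsilon_i\in\{ -1,0,+1\}$; on input $w$ the read-only tape holds $\vdash w\dashv$; in state $p$ scanning $\tau$ any instruction starting with $p$ may be executed: enter $q_1$, output $\alpha_1$, move by $\epsilon_1$ if $\tau=\sigma$, otherwise use $(q_0,\alpha_0,\epsilon_0)$; $(w,z)$ is realized iff some computation from $q_{in}$ at position $0$ reaches $q_f$ with output $z$. $\mathrm{NGSM}$: transductions realized by 2gsm's. Graphs $(V,E,\mathrm{lab})$, $E\subseteq V\times\Gamma\times V$ ($*$ = unlabelled), up to isomorphism; MSO logic with atomic formulas $\mathrm{lab}_\sigma(x)$, $\mathrm{edge}_\gamma(x,y)$, $x=y$, $x\in X$. An mso definable graph transduction: closed domain formula $\varphi_{dom}$, finite copy set $C$,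 node formulas $\varphi^c_\sigma(x)$ and edge formulas $\varphi^{c_1,c_2}_\gamma(x,y)$; on $g\models\varphi_{dom}$ the output has nodes $(u,c)$ with exactly one $\sigma$ such that $g\models\varphi^c_\sigma(u)$ (labelled $\sigma$) and edges $((u,c_1),\gamma,(v,c_2))$ iff $g\models\varphi^{c_1,c_2}_\gamma(u,v)$. For $w=a_1\cdots a_k$, $\mathrm{egr}(w)$ has unlabelled nodes $v_0,\dots,v_k$ and edges $(v_{i-1},a_i,v_i)$. $\mathrm{MSO}_e$: string transductions $m$ with $\{(\mathrm{egr}(w),\mathrm{egr}(z)):(w,z)\in m\}$ an mso definable graph transduction. -}

module Defs where

open import Data.Nat using (ℕ; zero; suc; _≡ᵇ_; _+_)
open import Data.Fin using (Fin; zero; suc; toℕ)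
open import Data.Fin.Properties using () renaming (_≟_ to _≟ᶠ_)
open import Data.Bool using (Bool; true; false; _∧_; _∨_; not; if_then_else_)
open import Data.List using (List; []; _∷_; _++_; allFin; map)
open import Data.Bool.ListAction using (any)
import Data.List
open import Data.List.Relation.Unary.All using (All)
open import Data.List.Membership.Propositional using (_∈_)
open import Data.Maybe using (Maybe; just; nothing)
open import Data.Product using (Σ; ∃; ∃-syntax; _×_; _,_; proj₁; proj₂)
open import Data.Sum using (_⊎_)
open import Relation.Nullary using (¬_; yes; no)
open import Relation.Nullary.Decidable using (⌊_⌋)
open import Relation.Binary.PropositionalEquality using (_≡_)
open import Function.Bundles using (_↔_; Inverse)
open import Function.Definitions using (Injective)
open import Data.Vec.Functional using () renaming (_∷_ to _∷ᶠ_)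

Str : ℕ → Set
Str n = List (Fin n)

Trans : ℕ → ℕ → Set₁
Trans n₁ n₂ = Str n₁ → Str n₂ → Set

_≐_ : ∀ {n₁ n₂} → Trans n₁ n₂ → Trans n₁ n₂ → Set
m ≐ m' = ∀ w z → (m w z → m' w z) × (m' w z → m w z)

Functional : ∀ {n₁ n₂} → Trans n₁ n₂ → Set
Functional m = ∀ w z₁ z₂ → m w z₁ → m w z₂ → z₁ ≡ z₂

_⨾_ : ∀ {n₁ n₂ n₃} → Trans n₁ n₂ → Trans n₂ n₃ → Trans n₁ n₃
(m₁ ⨾ m₂) w₁ w₃ = ∃[ w₂ ] (m₁ w₁ w₂ × m₂ w₂ w₃)

data TSym (n : ℕ) : Set where
  lend : TSym n
  rend : TSym n
  sym  : Fin n → TSym n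

data Move : Set where
  left stay right : Move

record Instr (nq n₁ n₂ : ℕ) : Set where
  field
    p  : Fin nq
    σ  : TSym n₁
    q₁ : Fin nq
    α₁ : Str n₂
    ε₁ : Move
    q₀ : Fin nq
    α₀ : Str n₂
    ε₀ : Move

record TwoGSM (n₁ n₂ : ℕ) : Set where
  field
    nq   : ℕ
    δ    : List (Instr nq n₁ n₂)
    qin  : Fin nq
    qf   : Fin nq
    p≢qf : All (λ ι → ¬ (Instr.p ι ≡ qf)) δ

tapeAt : ∀ {n} → Str n → ℕ → Maybe (TSym n)
tapeAt {n} w zero = just lend
tapeAt {n} w (suc i) = inner w i
  where
  inner : Str n → ℕ → Maybe (TSym n)
  inner [] zero = just rend
  inner [] (suc _) = nothing
  inner (a ∷ v) zero = just (sym a)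
  inner (a ∷ v) (suc j) = inner v j

move : Move → ℕ → Maybe ℕ
move left zero = nothing
move left (suc i) = just i
move stay i = just i
move right i = just (suc i)

module _ {n₁ n₂ : ℕ} (M : TwoGSM n₁ n₂) (w : Str n₁) where
  open TwoGSM M

  -- one step: (p , i) --α--> (q , j)
  -- an instruction (p,σ,q₁,α₁,ε₁,q₀,α₀,ε₀) with p the current state;
  -- if the scanned symbol τ equals σ use (q₁,α₁,ε₁), otherwise (q₀,α₀,ε₀);
  -- the head must stay on the tape ⊢ w ⊣.
  data Step : Fin nq → ℕ → Str n₂ → Fin nq → ℕ → Set where
    step-eq  : ∀ {i j τ'} (ι : Instr nq n₁ n₂) → ι ∈ δ →
               tapeAt w i ≡ just (Instr.σ ι) →
               move (Instr.ε₁ ι) i ≡ just j → tapeAt w j ≡ just τ' →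
               Step (Instr.p ι) i (Instr.α₁ ι) (Instr.q₁ ι) j
    step-neq : ∀ {i j τ τ'} (ι : Instr nq n₁ n₂) → ι ∈ δ →
               tapeAt w i ≡ just τ → ¬ (τ ≡ Instr.σ ι) →
               move (Instr.ε₀ ι) i ≡ just j → tapeAt w j ≡ just τ' →
               Step (Instr.p ι) i (Instr.α₀ ι) (Instr.q₀ ι) j

  data Run : Fin nq → ℕ → Str n₂ → Fin nq → ℕ → Set where
    done : ∀ {p i} → Run p i [] p i
    _▸_  : ∀ {p i α q j β r k} → Step p i α q j → Run q j β r k →
           Run p i (α ++ β) r k

Realizes : ∀ {n₁ n₂} → TwoGSM n₁ n₂ → Trans n₁ n₂
Realizes M w z = ∃[ k ] Run M w (TwoGSM.qin M) 0 z (TwoGSM.qf M) k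

InNGSM : ∀ {n₁ n₂} → Trans n₁ n₂ → Set
InNGSM {n₁} {n₂} m = Σ (TwoGSM n₁ n₂) λ M → m ≐ Realizes M

data Chain : ℕ → ℕ → ℕ → Set where
  one  : ∀ {n₁ n₂} → TwoGSM n₁ n₂ → Chain 1 n₁ n₂
  cons : ∀ {k n₁ n₂ n₃} → TwoGSM n₁ n₃ → Chain k n₃ n₂ → Chain (suc k) n₁ n₂

⟦_⟧ᶜ : ∀ {k n₁ n₂} → Chain k n₁ n₂ → Trans n₁ n₂
⟦ one M ⟧ᶜ = Realizes M
⟦ cons M c ⟧ᶜ = Realizes M ⨾ ⟦ c ⟧ᶜ

InNGSMPow : ∀ {n₁ n₂} → ℕ → Trans n₁ n₂ → Set
InNGSMPow {n₁} {n₂} k m = Σ (Chain k n₁ n₂) λ c → m ≐ ⟦ c ⟧ᶜ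

record Graph (ns ne : ℕ) : Set where
  field
    nv   : ℕ
    lab  : Fin nv → Fin ns
    edge : Fin nv → Fin ne → Fin nv → Bool

open Graph

_≅_ : ∀ {ns ne} → Graph ns ne → Graph ns ne → Set
g ≅ h = Σ (Fin (nv g) ↔ Fin (nv h)) λ f →
          (∀ u → lab h (Inverse.to f u) ≡ lab g u) ×
          (∀ u γ v → edge h (Inverse.to f u) γ (Inverse.to f v) ≡ edge g u γ v)

-- MSO logic: formulas with i free node variables and j free set variables

data Form (ns ne : ℕ) : ℕ → ℕ → Set where
  labF  : ∀ {i j} → Fin ns → Fin i → Form ns ne i j
  edgeF : ∀ {i j} → Fin ne → Fin i → Fin i → Form ns ne i j
  eqF   : ∀ {i j} → Fin i → Fin i → Form ns ne i j
  memF  : ∀ {i j} → Fin i → Fin j → Form ns ne i j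
  notF  : ∀ {i j} → Form ns ne i j → Form ns ne i j
  orF   : ∀ {i j} → Form ns ne i j → Form ns ne i j → Form ns ne i j
  andF  : ∀ {i j} → Form ns ne i j → Form ns ne i j → Form ns ne i j
  exF   : ∀ {i j} → Form ns ne (suc i) j → Form ns ne i j
  allF  : ∀ {i j} → Form ns ne (suc i) j → Form ns ne i j
  exSF  : ∀ {i j} → Form ns ne i (suc j) → Form ns ne i j
  allSF : ∀ {i j} → Form ns ne i (suc j) → Form ns ne i j

subsets : (n : ℕ) → List (Fin n → Bool)
subsets zero = (λ ()) ∷ []
subsets (suc n) = map (λ S → false ∷ᶠ S) (subsets n) ++ map (λ S → true ∷ᶠ S) (subsets n)

sat : ∀ {ns ne i j} (g : Graph ns ne) → Form ns ne i j →
      (Fin i → Fin (nv g)) → (Fin j → Fin (nv g) → Bool) → Bool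
sat g (labF σ x) ρ η = ⌊ lab g (ρ x) ≟ᶠ σ ⌋
sat g (edgeF γ x y) ρ η = edge g (ρ x) γ (ρ y)
sat g (eqF x y) ρ η = ⌊ ρ x ≟ᶠ ρ y ⌋
sat g (memF x X) ρ η = η X (ρ x)
sat g (notF φ) ρ η = not (sat g φ ρ η)
sat g (orF φ ψ) ρ η = sat g φ ρ η ∨ sat g ψ ρ η
sat g (andF φ ψ) ρ η = sat g φ ρ η ∧ sat g ψ ρ η
sat g (exF φ) ρ η = any (λ u → sat g φ (u ∷ᶠ ρ) η) (allFin (nv g))
sat g (allF φ) ρ η = not (any (λ u → not (sat g φ (u ∷ᶠ ρ) η)) (allFin (nv g)))
sat g (exSF φ) ρ η = any (λ S → sat g φ ρ (S ∷ᶠ η)) (subsets (nv g))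
sat g (allSF φ) ρ η = not (any (λ S → not (sat g φ ρ (S ∷ᶠ η))) (subsets (nv g)))

record MSOT (ns₁ ne₁ ns₂ ne₂ : ℕ) : Set where
  field
    φdom  : Form ns₁ ne₁ 0 0
    nc    : ℕ                                              -- copy set C = Fin nc
    φnode : Fin nc → Fin ns₂ → Form ns₁ ne₁ 1 0
    φedge : Fin nc → Fin nc → Fin ne₂ → Form ns₁ ne₁ 2 0

countTrue : (n : ℕ) → (Fin n → Bool) → ℕ
countTrue zero f = 0
countTrue (suc n) f = (if f zero then 1 else 0) + countTrue n (λ k → f (suc k))

module _ {ns₁ ne₁ ns₂ ne₂ : ℕ} (T : MSOT ns₁ ne₁ ns₂ ne₂) (g : Graph ns₁ ne₁) where
  open MSOT T

  sat1 : Form ns₁ ne₁ 1 0 → Fin (nv g) → Bool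
  sat1 φ u = sat g φ (u ∷ᶠ (λ ())) (λ ())

  sat2 : Form ns₁ ne₁ 2 0 → Fin (nv g) → Fin (nv g) → Bool
  sat2 φ u v = sat g φ (u ∷ᶠ (v ∷ᶠ (λ ()))) (λ ())

  isNode : Fin (nv g) × Fin nc → Bool
  isNode (u , c) = countTrue ns₂ (λ σ → sat1 (φnode c σ) u) ≡ᵇ 1

  -- h is (isomorphic to) the output of T on g:
  -- f identifies the nodes of h with the output nodes (u , c)
  Output : Graph ns₂ ne₂ → Set
  Output h =
    sat g φdom (λ ()) (λ ()) ≡ true ×
    Σ (Fin (nv h) → Fin (nv g) × Fin nc) λ f →
      Injective _≡_ _≡_ f ×
      (∀ v → isNode (f v) ≡ true) ×
      (∀ p → isNode p ≡ true → ∃[ v ] f v ≡ p) ×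
      (∀ v → sat1 (φnode (proj₂ (f v)) (lab h v)) (proj₁ (f v)) ≡ true) ×
      (∀ v γ v' → edge h v γ v' ≡ sat2 (φedge (proj₂ (f v)) (proj₂ (f v')) γ) (proj₁ (f v)) (proj₁ (f v')))

-- edge graphs of strings: unlabelled nodes (node alphabet {*} = Fin 1)

egr : ∀ {n} → Str n → Graph 1 n
egr {n} w = record { nv = suc (Data.List.length w) ; lab = λ _ → zero ; edge = e }
  where
  at : Str n → ℕ → Maybe (Fin n)
  at [] _ = nothing
  at (a ∷ v) zero = just a
  at (a ∷ v) (suc k) = at v k
  matches : Maybe (Fin n) → Fin n → Bool
  matches nothing _ = false
  matches (just b) a = ⌊ a ≟ᶠ b ⌋
  e : Fin (suc (Data.List.length w)) → Fin n → Fin (suc (Data.List.length w)) → Bool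
  e x a y = (toℕ y ≡ᵇ suc (toℕ x)) ∧ matches (at w (toℕ x)) a

InMSOe : ∀ {n₁ n₂} → Trans n₁ n₂ → Set
InMSOe {n₁} {n₂} m =
  Σ (MSOT 1 n₁ 1 n₂) λ T →
    ∀ (g : Graph 1 n₁) (h : Graph 1 n₂) →
      ((∃[ w ] ∃[ z ] (m w z × g ≅ egr w × h ≅ egr z)) → Output T g h) ×
      (Output T g h → ∃[ w ] ∃[ z ] (m w z × g ≅ egr w × h ≅ egr z))

-- Both directions go through walks in graphs that are MSO definable in the input word.
--
-- From machines to logic: the configuration graph of a 2gsm on w is an MSO image of egr w, and its accepting
-- walks are the accepting runs. Among the sets of configurations that contain an accepting walk, the
-- lexicographically least one is definable. By minimality it carries a single simple walk, in which y follows
-- x exactly if there is an edge from x to y and y cannot be reached without visiting x. Hence every 2gsm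
-- contains an MSO definable function with the same domain. For a composition M ⨾ m one first uniformizes m and
-- restricts the output of M to the domain of the resulting function by a product with a finite automaton
-- (Büchi); MSO transductions compose by backward translation. A functional relation equals its uniformization.
--
-- From logic to machines: one finite automaton decides the node and edge formulas on words with two marked
-- nodes. A first 2gsm annotates each node with the state reaching it and the set of states accepting from it
-- on; a second one uses these annotations to walk along the edges of the output graph.
{-# OPTIONS --safe #-}
module Submission where

open import Defs
open import Data.Bool using (Bool; true; false; _∧_; _∨_; not; T)
import Data.Bool.Properties as Bool
open import Data.Bool.ListAction using (any)
open import Data.Empty using (⊥; ⊥-elim)
open import Data.Fin using (Fin; zero; suc; toℕ; fromℕ; fromℕ<; combine; remQuot; _↑ˡ_; _↑ʳ_; inject₁)
import Data.Fin.Properties as Fin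
open import Data.List using (List; []; _∷_; _++_; allFin; map; length; foldl; lookup; concatMap; filter; cartesianProduct; drop)
import Data.List.Properties as List
open import Data.List.Membership.Propositional using (_∈_; lose; find)
import Data.List.Membership.Propositional.Properties as Mem
open import Data.List.Relation.Unary.All as All using (All)
open import Data.List.Relation.Unary.Any as Any using (Any; here; there)
import Data.List.Relation.Unary.Any.Properties as AnyP
open import Data.Maybe using (Maybe; just; nothing)
import Data.Maybe.Properties as Maybe
open import Data.Nat using (ℕ; zero; suc; _+_; _*_; _∸_; _^_; _≤_; _<_; z≤n; s≤s; _≡ᵇ_; _<?_)
import Data.Nat.Properties as ℕ
open import Data.Product using (Σ; ∃; ∃-syntax; _×_; _,_; proj₁; proj₂)
import Data.Product.Function.NonDependent.Propositional as ×
import Data.Product.Properties as Σ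
open import Data.Sum using (_⊎_; inj₁; inj₂; [_,_]′)
import Data.Sum.Function.Propositional as ⊎
open import Data.Unit using (⊤; tt)
open import Data.Vec using (Vec; tabulate) renaming ([] to []ᵛ; _∷_ to _∷ᵛ_; lookup to lookupᵛ)
import Data.Vec.Properties as Vec
open import Data.Vec.Functional using () renaming (_∷_ to _∷ᶠ_)
open import Function using (id; _∘_)
open import Function.Bundles using (_↔_; Inverse; mk↔ₛ′; _⇔_; mk⇔)
open import Function.Construct.Composition using (_↔-∘_)
open import Function.Construct.Identity using (↔-id)
open import Function.Construct.Symmetry using (↔-sym)
open import Relation.Binary.Construct.Closure.ReflexiveTransitive using (Star; ε; _◅_; _◅◅_; gmap)
open import Relation.Binary.Definitions using (tri<; tri≈; tri>)
open import Relation.Binary.PropositionalEquality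
  using (_≡_; _≢_; _≗_; refl; trans; cong; cong₂; subst) renaming (sym to ≡sym)
open import Relation.Nullary using (¬_; Dec; yes; no; contradiction)
open import Relation.Nullary.Decidable using (⌊_⌋; _×-dec_; _⊎-dec_; ¬?; map′)
open Graph

-- MSO logic quantifies over sets of configurations, not over runs, and a run may visit a
-- configuration repeatedly or loop without output. Minimality for inclusion still leaves several
-- candidates. A definable choice needs a definable linear order, and there is one because a
-- configuration is an input position together with an element of a finite set. Silent steps are
-- contracted beforehand, so that the vertices of the remaining walk are exactly the nodes of the
-- output graph. In the other direction the obstacle is locality: whether two output nodes are
-- joined depends on the whole input around two positions, while a 2gsm scans one symbol at a time.
-- The annotation makes this information local, at the price of a second machine. Functions are not
-- extensional here. Sets of nodes are therefore compared pointwise, formulas are shown to respect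
-- pointwise equality, and the state sets of automata are vectors.

nth : ∀ {A : Set} → List A → ℕ → Maybe A
nth [] _ = nothing
nth (a ∷ v) zero = just a
nth (a ∷ v) (suc k) = nth v k

tapeSym : ∀ {n} → Str n → ℕ → Maybe (TSym n)
tapeSym [] zero = just rend
tapeSym [] (suc _) = nothing
tapeSym (a ∷ v) zero = just (sym a)
tapeSym (a ∷ v) (suc j) = tapeSym v j

-- The tape and edge functions of the definitions recurse through local functions that cannot
-- be named here; unification supplies them in the signatures of the inductive lemmas below.
mutual
  tapeAt≡ : ∀ {n} (w : Str n) i → tapeAt w (suc i) ≡ tapeSym w i
  tapeAt≡ [] zero = refl
  tapeAt≡ [] (suc i) = refl
  tapeAt≡ (a ∷ v) zero = refl
  tapeAt≡ (a ∷ v) (suc i) with a ∷ v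
  ... | W = inner≡ W v i

  inner≡ : ∀ {n} (W v : Str n) i → _ ≡ tapeSym v i
  inner≡ W [] zero = refl
  inner≡ W [] (suc i) = refl
  inner≡ W (a ∷ v) zero = refl
  inner≡ W (a ∷ v) (suc i) = inner≡ W v i

hit : ∀ {n} → Maybe (Fin n) → Fin n → Bool
hit nothing _ = false
hit (just b) a = ⌊ a Fin.≟ b ⌋

mutual
  edge≡ : ∀ {n} (w : Str n) x a y →
          edge (egr w) x a y ≡ ((toℕ y ≡ᵇ suc (toℕ x)) ∧ hit (nth w (toℕ x)) a)
  edge≡ [] zero a y = refl
  edge≡ (b ∷ v) zero a y = refl
  edge≡ (b ∷ v) (suc x) a y with toℕ x | toℕ y | b ∷ v
  ... | k | l | W = cong ((l ≡ᵇ suc (suc k)) ∧_) (match≡ W v k a)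

  match≡ : ∀ {n} (W v : Str n) k a → _ ≡ hit (nth v k) a
  match≡ W [] k a = refl
  match≡ W (b ∷ v) zero a = refl
  match≡ W (b ∷ v) (suc k) a = match≡ W v k a

-- Boolean reflection and finite search

∧-true : ∀ {a b} → a ∧ b ≡ true → a ≡ true × b ≡ true
∧-true {true} {true} _ = refl , refl

∧-intro : ∀ {a b} → a ≡ true → b ≡ true → a ∧ b ≡ true
∧-intro refl refl = refl

∨-true : ∀ {a b} → a ∨ b ≡ true → a ≡ true ⊎ b ≡ true
∨-true {true} _ = inj₁ refl
∨-true {false} p = inj₂ p

∨-intro : ∀ {a b} → a ≡ true ⊎ b ≡ true → a ∨ b ≡ true
∨-intro (inj₁ refl) = refl
∨-intro {a} (inj₂ refl) = Bool.∨-zeroʳ a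

not-true : ∀ {a} → not a ≡ true → ¬ a ≡ true
not-true {false} _ ()

not-intro : ∀ {a} → ¬ a ≡ true → not a ≡ true
not-intro {false} _ = refl
not-intro {true} p = ⊥-elim (p refl)

⇔→≡ : ∀ {a b} → (a ≡ true → b ≡ true) → (b ≡ true → a ≡ true) → a ≡ b
⇔→≡ {true} f g = ≡sym (f refl)
⇔→≡ {false} {true} f g = g refl
⇔→≡ {false} {false} f g = refl

⌊⌋-true : ∀ {P : Set} (d : Dec P) → ⌊ d ⌋ ≡ true → P
⌊⌋-true (yes p) _ = p

⌊⌋-intro : ∀ {P : Set} (d : Dec P) → P → ⌊ d ⌋ ≡ true
⌊⌋-intro (yes _) _ = refl
⌊⌋-intro (no ¬p) p = ⊥-elim (¬p p)

≡ᵇ-true : ∀ {m n} → (m ≡ᵇ n) ≡ true → m ≡ n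
≡ᵇ-true {m} {n} p = ℕ.≡ᵇ⇒≡ m n (subst T (≡sym p) tt)

≡ᵇ-intro : ∀ {m n} → m ≡ n → (m ≡ᵇ n) ≡ true
≡ᵇ-intro {zero} refl = refl
≡ᵇ-intro {suc m} refl = ≡ᵇ-intro {m} refl

any-true : ∀ {A : Set} {p : A → Bool} xs → any p xs ≡ true → ∃[ x ] (x ∈ xs × p x ≡ true)
any-true (x ∷ xs) e with ∨-true e
... | inj₁ px = x , here refl , px
... | inj₂ e' = let y , y∈ , py = any-true xs e' in y , there y∈ , py

any-intro : ∀ {A : Set} {p : A → Bool} {x xs} → x ∈ xs → p x ≡ true → any p xs ≡ true
any-intro (here refl) e = ∨-intro (inj₁ e)
any-intro {p = p} {xs = y ∷ _} (there x∈) e = ∨-intro {p y} (inj₂ (any-intro x∈ e))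

anyF-intro : ∀ {n} {p : Fin n → Bool} x → p x ≡ true → any p (allFin n) ≡ true
anyF-intro x = any-intro (Mem.∈-allFin x)

-- Without function extensionality a subset need not occur in the list itself, only a pointwise
-- equal copy. This is why the meaning of formulas is compared in environments that agree up to `≗`.
∈subsets : ∀ n (S : Fin n → Bool) → ∃[ S' ] (S' ∈ subsets n × S' ≗ S)
∈subsets zero S = _ , here refl , λ ()
∈subsets (suc n) S with ∈subsets n (S ∘ suc) | S zero in eq
... | S' , S'∈ , e | false =
      _ , Mem.∈-++⁺ˡ (Mem.∈-map⁺ _ S'∈) , λ { zero → ≡sym eq ; (suc k) → e k }
... | S' , S'∈ , e | true =
      _ , Mem.∈-++⁺ʳ (map _ (subsets n)) (Mem.∈-map⁺ _ S'∈) , λ { zero → ≡sym eq ; (suc k) → e k }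

hit-true : ∀ {n} (m : Maybe (Fin n)) {a} → hit m a ≡ true → m ≡ just a
hit-true (just b) {a} e = cong just (≡sym (⌊⌋-true (a Fin.≟ b) e))

edge-egr : ∀ {n} (w : Str n) {x a y} → edge (egr w) x a y ≡ true →
           toℕ y ≡ suc (toℕ x) × nth w (toℕ x) ≡ just a
edge-egr w {x} {a} {y} e =
  let p , q = ∧-true (trans (≡sym (edge≡ w x a y)) e) in ≡ᵇ-true p , hit-true (nth w (toℕ x)) q

egr-edge : ∀ {n} (w : Str n) {x a y} → toℕ y ≡ suc (toℕ x) → nth w (toℕ x) ≡ just a →
           edge (egr w) x a y ≡ true
egr-edge w {x} {a} {y} p q =
  trans (edge≡ w x a y) (∧-intro (≡ᵇ-intro p) (trans (cong (λ m → hit m a) q) (⌊⌋-intro (a Fin.≟ a) refl)))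

-- Propositional semantics of MSO formulas

sem : ∀ {ns ne i j} (g : Graph ns ne) → Form ns ne i j →
      (Fin i → Fin (nv g)) → (Fin j → Fin (nv g) → Bool) → Set
sem g (labF σ x) ρ η = lab g (ρ x) ≡ σ
sem g (edgeF γ x y) ρ η = edge g (ρ x) γ (ρ y) ≡ true
sem g (eqF x y) ρ η = ρ x ≡ ρ y
sem g (memF x X) ρ η = η X (ρ x) ≡ true
sem g (notF φ) ρ η = ¬ sem g φ ρ η
sem g (orF φ ψ) ρ η = sem g φ ρ η ⊎ sem g ψ ρ η
sem g (andF φ ψ) ρ η = sem g φ ρ η × sem g ψ ρ η
sem g (exF φ) ρ η = ∃[ u ] sem g φ (u ∷ᶠ ρ) η
sem g (allF φ) ρ η = ∀ u → sem g φ (u ∷ᶠ ρ) η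
sem g (exSF φ) ρ η = ∃[ S ] sem g φ ρ (S ∷ᶠ η)
sem g (allSF φ) ρ η = ∀ S → sem g φ ρ (S ∷ᶠ η)

-- One induction yields the reflection of `sat` into `sem`, extensionality in the environment,
-- and invariance under isomorphism.
module _ {ns ne : ℕ} {g h : Graph ns ne} (I : g ≅ h) where
  private
    f : Fin (nv g) → Fin (nv h)
    f = Inverse.to (proj₁ I)
    f⁻ : Fin (nv h) → Fin (nv g)
    f⁻ = Inverse.from (proj₁ I)
    ff⁻ : ∀ v → f (f⁻ v) ≡ v
    ff⁻ = Inverse.strictlyInverseˡ (proj₁ I)
    f⁻f : ∀ v → f⁻ (f v) ≡ v
    f⁻f = Inverse.strictlyInverseʳ (proj₁ I)

  Rel₁ : ∀ {i} → (Fin i → Fin (nv g)) → (Fin i → Fin (nv h)) → Set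
  Rel₁ ρ ρ' = ∀ x → ρ' x ≡ f (ρ x)
  Rel₂ : ∀ {j} → (Fin j → Fin (nv g) → Bool) → (Fin j → Fin (nv h) → Bool) → Set
  Rel₂ η η' = ∀ X u → η' X (f u) ≡ η X u

  ext₁ : ∀ {i u u'} {ρ : Fin i → Fin (nv g)} {ρ'} → u' ≡ f u → Rel₁ ρ ρ' → Rel₁ (u ∷ᶠ ρ) (u' ∷ᶠ ρ')
  ext₁ p q zero = p
  ext₁ p q (suc x) = q x

  ext₂ : ∀ {j S S'} {η : Fin j → Fin (nv g) → Bool} {η'} → (∀ u → S' (f u) ≡ S u) →
         Rel₂ η η' → Rel₂ (S ∷ᶠ η) (S' ∷ᶠ η')
  ext₂ p q zero = p
  ext₂ p q (suc X) = q X

  mutual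
    sat→sem : ∀ {i j} (φ : Form ns ne i j) {ρ ρ' η η'} → Rel₁ ρ ρ' → Rel₂ η η' →
              sat g φ ρ η ≡ true → sem h φ ρ' η'
    sat→sem (labF σ x) p q e = trans (cong (lab h) (p x)) (trans (proj₁ (proj₂ I) _) (⌊⌋-true (lab g _ Fin.≟ σ) e))
    sat→sem (edgeF γ x y) p q e =
      trans (cong₂ (λ u v → edge h u γ v) (p x) (p y)) (trans (proj₂ (proj₂ I) _ γ _) e)
    sat→sem (eqF x y) p q e = trans (p x) (trans (cong f (⌊⌋-true (_ Fin.≟ _) e)) (≡sym (p y)))
    sat→sem (memF x X) {η' = η'} p q e = trans (cong (η' X) (p x)) (trans (q X _) e)
    sat→sem (notF φ) p q e s = not-true e (sem→sat φ p q s)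
    sat→sem (orF φ ψ) p q e with ∨-true e
    ... | inj₁ a = inj₁ (sat→sem φ p q a)
    ... | inj₂ a = inj₂ (sat→sem ψ p q a)
    sat→sem (andF φ ψ) p q e = let a , b = ∧-true e in sat→sem φ p q a , sat→sem ψ p q b
    sat→sem (exF φ) p q e = let u , _ , s = any-true (allFin (nv g)) e in f u , sat→sem φ (ext₁ refl p) q s
    sat→sem (allF φ) {ρ} {η = η} p q e v = sat→sem φ (ext₁ (≡sym (ff⁻ v)) p) q (sat-all (f⁻ v))
      where
      sat-all : ∀ u → sat g φ (u ∷ᶠ ρ) η ≡ true
      sat-all u with sat g φ (u ∷ᶠ ρ) η in eq
      ... | true = refl
      ... | false = ⊥-elim (not-true e (anyF-intro {p = λ u → not (sat g φ (u ∷ᶠ ρ) η)} u (cong not eq)))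
    sat→sem (exSF φ) p q e = let S , _ , s = any-true (subsets (nv g)) e in
      S ∘ f⁻ , sat→sem φ p (ext₂ (λ u → cong S (f⁻f u)) q) s
    sat→sem (allSF φ) {ρ} {η = η} p q e S' with ∈subsets (nv g) (S' ∘ f)
    ... | S , S∈ , S≗ = sat→sem φ p (ext₂ (λ u → ≡sym (S≗ u)) q) sat-S
      where
      sat-S : sat g φ ρ (S ∷ᶠ η) ≡ true
      sat-S with sat g φ ρ (S ∷ᶠ η) in eq
      ... | true = refl
      ... | false = ⊥-elim (not-true e (any-intro {p = λ S → not (sat g φ ρ (S ∷ᶠ η))} S∈ (cong not eq)))

    sem→sat : ∀ {i j} (φ : Form ns ne i j) {ρ ρ' η η'} → Rel₁ ρ ρ' → Rel₂ η η' →
              sem h φ ρ' η' → sat g φ ρ η ≡ true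
    sem→sat (labF σ x) p q s = ⌊⌋-intro (_ Fin.≟ _) (trans (≡sym (proj₁ (proj₂ I) _)) (trans (cong (lab h) (≡sym (p x))) s))
    sem→sat (edgeF γ x y) p q s =
      trans (≡sym (proj₂ (proj₂ I) _ γ _)) (trans (cong₂ (λ u v → edge h u γ v) (≡sym (p x)) (≡sym (p y))) s)
    sem→sat (eqF x y) {ρ} p q s =
      ⌊⌋-intro (_ Fin.≟ _) (trans (≡sym (f⁻f (ρ x))) (trans (cong f⁻ (trans (≡sym (p x)) (trans s (p y)))) (f⁻f (ρ y))))
    sem→sat (memF x X) {η' = η'} p q s = trans (≡sym (q X _)) (trans (cong (η' X) (≡sym (p x))) s)
    sem→sat (notF φ) p q s = not-intro (λ e → s (sat→sem φ p q e))
    sem→sat (orF φ ψ) p q (inj₁ s) = ∨-intro (inj₁ (sem→sat φ p q s))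
    sem→sat (orF φ ψ) {ρ} {η = η} p q (inj₂ s) = ∨-intro {sat g φ ρ η} (inj₂ (sem→sat ψ p q s))
    sem→sat (andF φ ψ) p q (s , t) = ∧-intro (sem→sat φ p q s) (sem→sat ψ p q t)
    sem→sat (exF φ) {ρ} {η = η} p q (v , s) = anyF-intro {p = λ u → sat g φ (u ∷ᶠ ρ) η} (f⁻ v)
        (sem→sat φ (ext₁ (≡sym (ff⁻ v)) p) q s)
    sem→sat (allF φ) p q s = not-intro λ e → let u , _ , n = any-true (allFin (nv g)) e in
      not-true n (sem→sat φ (ext₁ refl p) q (s (f u)))
    sem→sat (exSF φ) {ρ} {η = η} p q (S' , s) with ∈subsets (nv g) (S' ∘ f)
    ... | S , S∈ , S≗ = any-intro {p = λ S → sat g φ ρ (S ∷ᶠ η)} S∈ (sem→sat φ p (ext₂ (λ u → ≡sym (S≗ u)) q) s)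
    sem→sat (allSF φ) p q s = not-intro λ e → let S , _ , n = any-true (subsets (nv g)) e in
      not-true n (sem→sat φ p (ext₂ (λ u → cong S (f⁻f u)) q) (s (S ∘ f⁻)))

≅-refl : ∀ {ns ne} {g : Graph ns ne} → g ≅ g
≅-refl = ↔-id _ , (λ _ → refl) , (λ _ _ _ → refl)

module _ {ns ne : ℕ} {g : Graph ns ne} {i j : ℕ} (φ : Form ns ne i j) where

  sem-sound : ∀ {ρ η} → sat g φ ρ η ≡ true → sem g φ ρ η
  sem-sound = sat→sem (≅-refl {g = g}) φ (λ _ → refl) (λ _ _ → refl)

  sem-complete : ∀ {ρ η} → sem g φ ρ η → sat g φ ρ η ≡ true
  sem-complete = sem→sat (≅-refl {g = g}) φ (λ _ → refl) (λ _ _ → refl)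

  sem? : ∀ ρ η → Dec (sem g φ ρ η)
  sem? ρ η = map′ sem-sound sem-complete (sat g φ ρ η Bool.≟ true)

  sem-cong : ∀ {ρ ρ' η η'} → (∀ x → ρ' x ≡ ρ x) → (∀ X u → η' X u ≡ η X u) → sem g φ ρ η → sem g φ ρ' η'
  sem-cong p q s = sat→sem (≅-refl {g = g}) φ p q (sem-complete s)

  sem-≅ : ∀ {h : Graph ns ne} (I : g ≅ h) {ρ ρ' η η'} → Rel₁ {g = g} {h} I ρ ρ' → Rel₂ {g = g} {h} I η η' →
          sem g φ ρ η → sem h φ ρ' η'
  sem-≅ {h} I p q s = sat→sem {g = g} {h} I φ p q (sem-complete s)

-- Images of MSO transductions with one node label

-- Absurd lambdas written at different places are not definitionally equal. Sharing these
-- environments avoids conversions; those inside `sat1` and `sat2` are matched with them pointwise.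
e0 : ∀ {a} {A : Set a} → Fin 0 → A
e0 ()

e1 : ∀ {A : Set} → A → Fin 1 → A
e1 x = x ∷ᶠ e0

e2 : ∀ {A : Set} → A → A → Fin 2 → A
e2 x y = x ∷ᶠ e1 y

fin1 : (x y : Fin 1) → x ≡ y
fin1 zero zero = refl

liftR : ∀ {m n} → (Fin m → Fin n) → Fin (suc m) → Fin (suc n)
liftR r zero = zero
liftR r (suc x) = suc (r x)

ren : ∀ {ns ne i i' j j'} → (Fin i → Fin i') → (Fin j → Fin j') → Form ns ne i j → Form ns ne i' j'
ren r s (labF σ x) = labF σ (r x)
ren r s (edgeF γ x y) = edgeF γ (r x) (r y)
ren r s (eqF x y) = eqF (r x) (r y)
ren r s (memF x X) = memF (r x) (s X)
ren r s (notF φ) = notF (ren r s φ)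
ren r s (orF φ ψ) = orF (ren r s φ) (ren r s ψ)
ren r s (andF φ ψ) = andF (ren r s φ) (ren r s ψ)
ren r s (exF φ) = exF (ren (liftR r) s φ)
ren r s (allF φ) = allF (ren (liftR r) s φ)
ren r s (exSF φ) = exSF (ren r (liftR s) φ)
ren r s (allSF φ) = allSF (ren r (liftR s) φ)

module _ {ns ne : ℕ} (g : Graph ns ne) where
  private
    V = Fin (nv g)

    up₁ : ∀ {i i' u} {r : Fin i → Fin i'} {ρ : Fin i' → V} {ρ' : Fin i → V} →
          (∀ x → ρ' x ≡ ρ (r x)) → ∀ x → (u ∷ᶠ ρ') x ≡ (u ∷ᶠ ρ) (liftR r x)
    up₁ p zero = refl
    up₁ p (suc x) = p x

    up₂ : ∀ {j j' S} {s : Fin j → Fin j'} {η : Fin j' → V → Bool} {η' : Fin j → V → Bool} →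
          (∀ X u → η' X u ≡ η (s X) u) → ∀ X u → (S ∷ᶠ η') X u ≡ (S ∷ᶠ η) (liftR s X) u
    up₂ p zero u = refl
    up₂ p (suc X) = p X

  sem-ren : ∀ {i i' j j'} (φ : Form ns ne i j) {r : Fin i → Fin i'} {s : Fin j → Fin j'} {ρ ρ' η η'} →
            (∀ x → ρ' x ≡ ρ (r x)) → (∀ X u → η' X u ≡ η (s X) u) →
            (sem g (ren r s φ) ρ η → sem g φ ρ' η') × (sem g φ ρ' η' → sem g (ren r s φ) ρ η)
  sem-ren (labF σ x) p q rewrite p x = id , id
  sem-ren (edgeF γ x y) p q rewrite p x | p y = id , id
  sem-ren (eqF x y) p q rewrite p x | p y = id , id
  sem-ren (memF x X) p q rewrite p x =
    trans (q X _) , trans (≡sym (q X _))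
  sem-ren (notF φ) p q = let a , b = sem-ren φ p q in (_∘ b) , (_∘ a)
  sem-ren (orF φ ψ) p q = let a , b = sem-ren φ p q ; c , d = sem-ren ψ p q in
    [ inj₁ ∘ a , inj₂ ∘ c ]′ , [ inj₁ ∘ b , inj₂ ∘ d ]′
  sem-ren (andF φ ψ) p q = let a , b = sem-ren φ p q ; c , d = sem-ren ψ p q in
    (λ (x , y) → a x , c y) , (λ (x , y) → b x , d y)
  sem-ren (exF φ) p q =
    (λ (u , x) → u , proj₁ (sem-ren φ (up₁ p) q) x) , (λ (u , x) → u , proj₂ (sem-ren φ (up₁ p) q) x)
  sem-ren (allF φ) p q =
    (λ x u → proj₁ (sem-ren φ (up₁ p) q) (x u)) , (λ x u → proj₂ (sem-ren φ (up₁ p) q) (x u))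
  sem-ren (exSF φ) p q =
    (λ (u , x) → u , proj₁ (sem-ren φ p (up₂ q)) x) , (λ (u , x) → u , proj₂ (sem-ren φ p (up₂ q)) x)
  sem-ren (allSF φ) p q =
    (λ x u → proj₁ (sem-ren φ p (up₂ q)) (x u)) , (λ x u → proj₂ (sem-ren φ p (up₂ q)) (x u))

-- The syntax has no truth constants. An existential statement about x ≠ x fails in every graph, the
-- empty one included.
falseF trueF : ∀ {ns ne i j} → Form ns ne i j
falseF = exF (notF (eqF zero zero))
trueF = notF falseF

_⇒F_ : ∀ {ns ne i j} → Form ns ne i j → Form ns ne i j → Form ns ne i j
φ ⇒F ψ = orF (notF φ) ψ

bigOr bigAnd : ∀ {ns ne i j k} → (Fin k → Form ns ne i j) → Form ns ne i j
bigOr {k = zero} φs = falseF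
bigOr {k = suc k} φs = orF (φs zero) (bigOr (φs ∘ suc))
bigAnd {k = zero} φs = trueF
bigAnd {k = suc k} φs = andF (φs zero) (bigAnd (φs ∘ suc))

guardF : ∀ {ns ne i j} → Bool → Form ns ne i j → Form ns ne i j
guardF true φ = φ
guardF false φ = falseF

module _ {ns ne i j : ℕ} {g : Graph ns ne} {ρ : Fin i → Fin (nv g)} {η : Fin j → Fin (nv g) → Bool} where

  ¬falseF : ¬ sem g falseF ρ η
  ¬falseF (u , p) = p refl

  ⇒F-elim : ∀ φ ψ → sem g (φ ⇒F ψ) ρ η → sem g φ ρ η → sem g ψ ρ η
  ⇒F-elim φ ψ (inj₁ n) x = ⊥-elim (n x)
  ⇒F-elim φ ψ (inj₂ y) x = y

  -- Implication is encoded as a disjunction, so its introduction has to decide the premise.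
  ⇒F-intro : ∀ φ ψ → (sem g φ ρ η → sem g ψ ρ η) → sem g (φ ⇒F ψ) ρ η
  ⇒F-intro φ ψ f with sem? φ ρ η
  ... | yes x = inj₂ (f x)
  ... | no n = inj₁ n

  bigOr-elim : ∀ {k} (φs : Fin k → Form ns ne i j) → sem g (bigOr φs) ρ η → ∃[ x ] sem g (φs x) ρ η
  bigOr-elim {zero} φs s = ⊥-elim (¬falseF s)
  bigOr-elim {suc k} φs (inj₁ s) = zero , s
  bigOr-elim {suc k} φs (inj₂ s) = let x , t = bigOr-elim (φs ∘ suc) s in suc x , t

  bigOr-intro : ∀ {k} (φs : Fin k → Form ns ne i j) x → sem g (φs x) ρ η → sem g (bigOr φs) ρ η
  bigOr-intro φs zero s = inj₁ s
  bigOr-intro φs (suc x) s = inj₂ (bigOr-intro (φs ∘ suc) x s)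

  bigAnd-elim : ∀ {k} (φs : Fin k → Form ns ne i j) → sem g (bigAnd φs) ρ η → ∀ x → sem g (φs x) ρ η
  bigAnd-elim φs (s , t) zero = s
  bigAnd-elim φs (s , t) (suc x) = bigAnd-elim (φs ∘ suc) t x

  bigAnd-intro : ∀ {k} (φs : Fin k → Form ns ne i j) → (∀ x → sem g (φs x) ρ η) → sem g (bigAnd φs) ρ η
  bigAnd-intro {zero} φs s = ¬falseF
  bigAnd-intro {suc k} φs s = s zero , bigAnd-intro (φs ∘ suc) (s ∘ suc)

  guardF-elim : ∀ b φ → sem g (guardF b φ) ρ η → b ≡ true × sem g φ ρ η
  guardF-elim true φ s = refl , s
  guardF-elim false φ s = ⊥-elim (¬falseF s)

  guardF-intro : ∀ {b} φ → b ≡ true → sem g φ ρ η → sem g (guardF b φ) ρ η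
  guardF-intro φ refl s = s

-- `Output` in terms of `sem`. With a single node label, "exactly one label formula holds" reduces
-- to the formula of that label, and comparing labels is trivial.
record Img {ne₁ ne₂} (T : MSOT 1 ne₁ 1 ne₂) (g : Graph 1 ne₁) (h : Graph 1 ne₂) : Set where
  open MSOT T
  field
    dom   : sem g φdom e0 e0
    f     : Fin (nv h) → Fin (nv g) × Fin nc
    inj   : ∀ {v v'} → f v ≡ f v' → v ≡ v'
    node  : ∀ v → sem g (φnode (proj₂ (f v)) zero) (e1 (proj₁ (f v))) e0
    surj  : ∀ u c → sem g (φnode c zero) (e1 u) e0 → ∃[ v ] f v ≡ (u , c)
    edge→ : ∀ {v γ v'} → edge h v γ v' ≡ true →
            sem g (φedge (proj₂ (f v)) (proj₂ (f v')) γ) (e2 (proj₁ (f v)) (proj₁ (f v'))) e0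
    edge← : ∀ {v γ v'} → sem g (φedge (proj₂ (f v)) (proj₂ (f v')) γ) (e2 (proj₁ (f v)) (proj₁ (f v'))) e0 →
            edge h v γ v' ≡ true

module _ {ne₁ ne₂ : ℕ} (T : MSOT 1 ne₁ 1 ne₂) (g : Graph 1 ne₁) where
  open MSOT T

  private
    one-env : ∀ {u : Fin (nv g)} {z : Fin 0 → Fin (nv g)} x → (u ∷ᶠ z) x ≡ e1 u x
    one-env zero = refl
    two-env : ∀ {u v : Fin (nv g)} {z : Fin 0 → Fin (nv g)} x → (u ∷ᶠ (v ∷ᶠ z)) x ≡ e2 u v x
    two-env zero = refl
    two-env (suc zero) = refl

  sat1→sem : ∀ φ {u} → sat1 T g φ u ≡ true → sem g φ (e1 u) e0
  sat1→sem φ = sat→sem (≅-refl {g = g}) φ (≡sym ∘ one-env) (λ ())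
  sem→sat1 : ∀ φ {u} → sem g φ (e1 u) e0 → sat1 T g φ u ≡ true
  sem→sat1 φ = sem→sat (≅-refl {g = g}) φ (≡sym ∘ one-env) (λ ())
  sat2→sem : ∀ φ {u v} → sat2 T g φ u v ≡ true → sem g φ (e2 u v) e0
  sat2→sem φ = sat→sem (≅-refl {g = g}) φ (≡sym ∘ two-env) (λ ())
  sem→sat2 : ∀ φ {u v} → sem g φ (e2 u v) e0 → sat2 T g φ u v ≡ true
  sem→sat2 φ = sem→sat (≅-refl {g = g}) φ (≡sym ∘ two-env) (λ ())

  isNode→ : ∀ {u c} → isNode T g (u , c) ≡ true → sem g (φnode c zero) (e1 u) e0
  isNode→ {u} {c} e with sat1 T g (φnode c zero) u in eq
  ... | true = sat1→sem (φnode c zero) eq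

  isNode← : ∀ {u c} → sem g (φnode c zero) (e1 u) e0 → isNode T g (u , c) ≡ true
  isNode← {u} {c} s rewrite sem→sat1 (φnode c zero) s = refl

  module _ {h : Graph 1 ne₂} where
    Output→Img : Output T g h → Img T g h
    Output→Img (d , f , inj , n , s , l , e) = record
      { dom = sat→sem (≅-refl {g = g}) φdom (λ ()) (λ ()) d
      ; f = f
      ; inj = inj
      ; node = λ v → isNode→ (n v)
      ; surj = λ u c x → s (u , c) (isNode← x)
      ; edge→ = λ {v} {γ} {v'} x → sat2→sem (φedge _ _ γ) (trans (≡sym (e v γ v')) x)
      ; edge← = λ {v} {γ} {v'} x → trans (e v γ v') (sem→sat2 (φedge _ _ γ) x)
      }

    Img→Output : Img T g h → Output T g h
    Img→Output I = sem→sat (≅-refl {g = g}) φdom (λ ()) (λ ()) dom , f , inj , (λ v → isNode← (node v)) ,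
      (λ (u , c) n → surj u c (isNode→ n)) ,
      (λ v → subst (λ σ → sat1 T g (φnode (proj₂ (f v)) σ) (proj₁ (f v)) ≡ true) (fin1 zero (lab h v))
                (sem→sat1 (φnode _ zero) (node v))) ,
      (λ v γ v' → ⇔→≡ (λ x → sem→sat2 (φedge _ _ γ) (edge→ x)) (λ x → edge← (sat2→sem (φedge _ _ γ) x)))
      where open Img I

  -- Both numberings are bijections onto the same set of pairs (u , c); one followed by the inverse
  -- of the other is the isomorphism. Functionality of MSO definable transductions comes from here.
  Img-unique : ∀ {h h'} → Img T g h → Img T g h' → h ≅ h'
  Img-unique {h} {h'} I I' = mk↔ₛ′ to from (λ v → I'.inj (trans (to≡ (from v)) (from≡ v)))
      (λ v → I.inj (trans (from≡ (to v)) (to≡ v))) , (λ _ → fin1 _ _) ,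
      (λ u γ v → ⇔→≡ (λ e → I.edge← (subst₂′ γ (to≡ u) (to≡ v) (I'.edge→ e)))
                       (λ e → I'.edge← (subst₂′ γ (≡sym (to≡ u)) (≡sym (to≡ v)) (I.edge→ e))))
    where
    module I = Img I
    module I' = Img I'
    to : Fin (nv h) → Fin (nv h')
    to v = proj₁ (I'.surj _ _ (I.node v))
    to≡ : ∀ v → I'.f (to v) ≡ I.f v
    to≡ v = proj₂ (I'.surj _ _ (I.node v))
    from : Fin (nv h') → Fin (nv h)
    from v = proj₁ (I.surj _ _ (I'.node v))
    from≡ : ∀ v → I.f (from v) ≡ I'.f v
    from≡ v = proj₂ (I.surj _ _ (I'.node v))
    subst₂′ : ∀ γ {p q p' q' : Fin (nv g) × Fin nc} → p ≡ p' → q ≡ q' →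
              sem g (φedge (proj₂ p) (proj₂ q) γ) (e2 (proj₁ p) (proj₁ q)) e0 →
              sem g (φedge (proj₂ p') (proj₂ q') γ) (e2 (proj₁ p') (proj₁ q')) e0
    subst₂′ γ refl refl s = s

  Img-≅ʳ : ∀ {h h'} → Img T g h → h ≅ h' → Img T g h'
  Img-≅ʳ {h} {h'} I (i , _ , ie) = record
    { dom = dom
    ; f = f ∘ from
    ; inj = λ e → from-inj (inj e)
    ; node = node ∘ from
    ; surj = λ u c s → let v , e = surj u c s in to v , trans (cong f (strictlyInverseʳ v)) e
    ; edge→ = λ {v} {γ} {v'} e → edge→ (trans (edge-from v γ v') e)
    ; edge← = λ {v} {γ} {v'} s → trans (≡sym (edge-from v γ v')) (edge← s)
    }
    where
    open Img I
    open Inverse i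
    from-inj : ∀ {v v'} → from v ≡ from v' → v ≡ v'
    from-inj {v} {v'} e = trans (≡sym (strictlyInverseˡ v)) (trans (cong to e) (strictlyInverseˡ v'))
    edge-from : ∀ v γ v' → edge h (from v) γ (from v') ≡ edge h' v γ v'
    edge-from v γ v' = trans (≡sym (ie (from v) γ (from v')))
      (cong₂ (λ x y → edge h' x γ y) (strictlyInverseˡ v) (strictlyInverseˡ v'))

≅-sym : ∀ {ns ne} {g h : Graph ns ne} → g ≅ h → h ≅ g
≅-sym {g = g} {h} (i , l , e) = ↔-sym i ,
  (λ u → trans (≡sym (l _)) (cong (lab h) (strictlyInverseˡ u))) ,
  (λ u γ v → trans (≡sym (e _ γ _)) (cong₂ (λ x y → edge h x γ y) (strictlyInverseˡ u) (strictlyInverseˡ v)))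
  where open Inverse i

Img-≅ˡ : ∀ {ne₁ ne₂} (T : MSOT 1 ne₁ 1 ne₂) {g g' h} → Img T g h → g ≅ g' → Img T g' h
Img-≅ˡ T {g} {g'} {h} I J = record
  { dom = sem-≅ φdom {g'} J {e0} {e0} {e0} {e0} (λ ()) (λ ()) dom
  ; f = λ v → to (proj₁ (f v)) , proj₂ (f v)
  ; inj = λ e → inj (cong₂ _,_ (to-inj (cong proj₁ e)) (cong proj₂ e))
  ; node = λ v → sem-≅ (φnode _ zero) {g'} J {η = e0} {η' = e0} env1 (λ ()) (node v)
  ; surj = λ u c s → let v , e = surj (from u) c (sem-≅ (φnode c zero) {g} J⁻ {η = e0} {η' = e0} env1⁻ (λ ()) s) in
      v , cong₂ _,_ (trans (cong (to ∘ proj₁) e) (strictlyInverseˡ u)) (cong proj₂ e)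
  ; edge→ = λ {v} {γ} {v'} e → sem-≅ (φedge _ _ γ) {g'} J {η = e0} {η' = e0} env2 (λ ()) (edge→ e)
  ; edge← = λ {v} {γ} {v'} s → edge← (sem-≅ (φedge _ _ γ) {g} J⁻ {η = e0} {η' = e0} env2⁻ (λ ()) s)
  }
  where
  open MSOT T
  open Img I
  open Inverse (proj₁ J)
  J⁻ = ≅-sym {g = g} {g'} J
  to-inj : ∀ {v v'} → to v ≡ to v' → v ≡ v'
  to-inj {v} {v'} e = trans (≡sym (strictlyInverseʳ v)) (trans (cong from e) (strictlyInverseʳ v'))
  env1 : ∀ {u} x → e1 (to u) x ≡ to (e1 u x)
  env1 zero = refl
  env1⁻ : ∀ {u} x → e1 (from u) x ≡ from (e1 u x)
  env1⁻ zero = refl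
  env2 : ∀ {u v} x → e2 (to u) (to v) x ≡ to (e2 u v x)
  env2 zero = refl
  env2 (suc zero) = refl
  env2⁻ : ∀ {u v} x → e2 u v x ≡ from (e2 (to u) (to v) x)
  env2⁻ zero = ≡sym (strictlyInverseʳ _)
  env2⁻ (suc zero) = ≡sym (strictlyInverseʳ _)

-- The field `mono` makes the vertices of an image graph follow the lexicographic order of their
-- pairs. The order on configurations expressed in MSO can thus be identified with the order of
-- `Fin`.
record Enum {N : ℕ} (P : Fin N → Set) : Set where
  field
    size  : ℕ
    elem  : Fin size → Fin N
    valid : ∀ i → P (elem i)
    index : ∀ x → P x → ∃[ i ] elem i ≡ x
    mono  : ∀ {i j} → toℕ i < toℕ j → toℕ (elem i) < toℕ (elem j)

  elem-inj : ∀ {i j} → elem i ≡ elem j → i ≡ j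
  elem-inj {i} {j} e with ℕ.<-cmp (toℕ i) (toℕ j)
  ... | tri< l _ _ = ⊥-elim (ℕ.<-irrefl (cong toℕ e) (mono l))
  ... | tri≈ _ l _ = Fin.toℕ-injective l
  ... | tri> _ _ l = ⊥-elim (ℕ.<-irrefl (cong toℕ (≡sym e)) (mono l))

enum : ∀ {N} {P : Fin N → Set} → (∀ x → Dec (P x)) → Enum P
enum {zero} P? = record { size = 0 ; elem = e0 ; valid = λ () ; index = λ () ; mono = λ { {()} } }
enum {suc N} {P} P? with P? zero | enum (P? ∘ suc)
... | no ¬p | E = record
  { size = size ; elem = suc ∘ elem ; valid = valid
  ; index = λ { zero p → ⊥-elim (¬p p) ; (suc x) p → let i , e = index x p in i , cong suc e }
  ; mono = λ l → s≤s (mono l) }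
  where open Enum E
... | yes p | E = record
  { size = suc size ; elem = zero ∷ᶠ (suc ∘ elem) ; valid = λ { zero → p ; (suc i) → valid i }
  ; index = λ { zero p → zero , refl ; (suc x) p → let i , e = index x p in suc i , cong suc e }
  ; mono = λ { {zero} {suc j} l → s≤s z≤n ; {suc i} {suc j} (s≤s l) → s≤s (mono l) } }
  where open Enum E

module _ {ne₁ ne₂ : ℕ} (T : MSOT 1 ne₁ 1 ne₂) (g : Graph 1 ne₁) where
  open MSOT T
  private
    isNode′ : Fin (nv g * nc) → Set
    isNode′ x = sem g (φnode (proj₂ (remQuot {nv g} nc x)) zero) (e1 (proj₁ (remQuot {nv g} nc x))) e0
    E : Enum isNode′
    E = enum (λ x → sem? (φnode _ zero) (e1 _) e0)
    module E = Enum E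

  image : Graph 1 ne₂
  image = record
    { nv = E.size
    ; lab = λ _ → zero
    ; edge = λ v γ v' → let u , c = remQuot {nv g} nc (E.elem v) ; u' , c' = remQuot {nv g} nc (E.elem v') in
        sat g (φedge c c' γ) (e2 u u') e0
    }

  Img-image : sem g φdom e0 e0 → Img T g image
  Img-image d = record
    { dom = d
    ; f = λ v → remQuot {nv g} nc (E.elem v)
    ; inj = λ {v} {v'} e → E.elem-inj (trans (≡sym (Fin.combine-remQuot {nv g} nc _))
               (trans (cong (λ (u , c) → combine u c) e) (Fin.combine-remQuot {nv g} nc _)))
    ; node = E.valid
    ; surj = λ u c s → let eq = Fin.remQuot-combine u c
                           i , e = E.index (combine u c) (subst (λ (u , c) → sem g (φnode c zero) (e1 u) e0) (≡sym eq) s)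
                       in i , trans (cong (remQuot {nv g} nc) e) eq
    ; edge→ = λ {v} {γ} {v'} → sem-sound (φedge _ _ γ)
    ; edge← = λ {v} {γ} {v'} → sem-complete (φedge _ _ γ)
    }

  image-mono : ∀ {v v' : Fin (nv image)} → toℕ v < toℕ v' → toℕ (E.elem v) < toℕ (E.elem v')
  image-mono = E.mono

-- Reachability in a finite graph is decided by Warshall's algorithm: `Via ks` allows the
-- intermediate vertices ks.
module _ {N : ℕ} {E : Fin N → Fin N → Set} where
  Via : List (Fin N) → Fin N → Fin N → Set
  Via [] x y = x ≡ y ⊎ E x y
  Via (k ∷ ks) x y = Via ks x y ⊎ (Via ks x k × Via ks k y)

  via? : (∀ x y → Dec (E x y)) → ∀ ks x y → Dec (Via ks x y)
  via? E? [] x y = (x Fin.≟ y) ⊎-dec E? x y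
  via? E? (k ∷ ks) x y = via? E? ks x y ⊎-dec (via? E? ks x k ×-dec via? E? ks k y)

  -- If both paths pass through the pivot `k`, the stretch between the two visits to `k`, which
  -- contains `m`, is cut out.
  via-trans : ∀ {ks x m y} → m ∈ ks → Via ks x m → Via ks m y → Via ks x y
  via-trans (here refl) a b = inj₂ ([ id , proj₁ ]′ a , [ id , proj₂ ]′ b)
  via-trans (there m∈) (inj₁ a) (inj₁ b) = inj₁ (via-trans m∈ a b)
  via-trans (there m∈) (inj₁ a) (inj₂ (b , c)) = inj₂ (via-trans m∈ a b , c)
  via-trans (there m∈) (inj₂ (a , b)) (inj₁ c) = inj₂ (a , via-trans m∈ b c)
  via-trans (there m∈) (inj₂ (a , b)) (inj₂ (c , d)) = inj₂ (a , d)

  via→star : ∀ ks {x y} → Via ks x y → Star E x y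
  via→star [] (inj₁ refl) = ε
  via→star [] (inj₂ e) = e ◅ ε
  via→star (k ∷ ks) (inj₁ a) = via→star ks a
  via→star (k ∷ ks) (inj₂ (a , b)) = via→star ks a ◅◅ via→star ks b

  via-mono : ∀ ks {x y} → Via [] x y → Via ks x y
  via-mono [] a = a
  via-mono (k ∷ ks) a = inj₁ (via-mono ks a)

  star→via : ∀ {x y} → Star E x y → Via (allFin N) x y
  star→via ε = via-mono (allFin N) (inj₁ refl)
  star→via (e ◅ r) = via-trans (Mem.∈-allFin _) (via-mono (allFin N) (inj₂ e)) (star→via r)

  star? : (∀ x y → Dec (E x y)) → ∀ x y → Dec (Star E x y)
  star? E? x y = map′ (via→star _) star→via (via? E? (allFin N) x y)

closedF : ∀ {ns ne i j} → Form ns ne (suc i) (suc j) → Form ns ne (suc (suc i)) (suc j) → Form ns ne i (suc j)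
closedF start step = andF (allF (start ⇒F memF zero zero))
                          (allF (allF (andF (memF (suc zero) zero) step ⇒F memF zero zero)))

-- "Every set containing the start nodes and closed under the steps meets the target"; variable 0
-- of the step formula is the target of the step, variable 1 its source.
lfpF : ∀ {ns ne i j} → Form ns ne (suc i) (suc j) → Form ns ne (suc (suc i)) (suc j) →
       Form ns ne (suc i) (suc j) → Form ns ne i j
lfpF start step target = allSF (closedF start step ⇒F exF (andF (memF zero zero) target))

-- The three formulas stand under the quantifier over the closed set `Z`. The hypotheses say that
-- their meaning does not depend on `Z`, so that the second-order formula becomes plain
-- reachability.
module _ {ns ne i j : ℕ} {g : Graph ns ne} {ρ : Fin i → Fin (nv g)} {η : Fin j → Fin (nv g) → Bool}
  {start target : Form ns ne (suc i) (suc j)} {step : Form ns ne (suc (suc i)) (suc j)}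
  {A B : Fin (nv g) → Set} {E : Fin (nv g) → Fin (nv g) → Set}
  (a : ∀ Z {x} → (sem g start (x ∷ᶠ ρ) (Z ∷ᶠ η) → A x) × (A x → sem g start (x ∷ᶠ ρ) (Z ∷ᶠ η)))
  (e : ∀ Z {x y} → (sem g step (y ∷ᶠ (x ∷ᶠ ρ)) (Z ∷ᶠ η) → E x y) × (E x y → sem g step (y ∷ᶠ (x ∷ᶠ ρ)) (Z ∷ᶠ η)))
  (b : ∀ Z {x} → (sem g target (x ∷ᶠ ρ) (Z ∷ᶠ η) → B x) × (B x → sem g target (x ∷ᶠ ρ) (Z ∷ᶠ η)))
  where
  private
    ∅ : Fin (nv g) → Bool
    ∅ _ = false
    E? : ∀ x y → Dec (E x y)
    E? x y = map′ (proj₁ (e ∅)) (proj₂ (e ∅)) (sem? step _ _)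
    R? : ∀ y → Dec (∃[ x ] (A x × Star E x y))
    R? y = Fin.any? λ x → map′ (proj₁ (a ∅)) (proj₂ (a ∅)) (sem? start _ _) ×-dec star? E? x y

    R : Fin (nv g) → Bool
    R y = ⌊ R? y ⌋
    hitF : Form ns ne i (suc j)
    hitF = exF (andF (memF zero zero) target)

    R-closed : sem g (closedF start step) ρ (R ∷ᶠ η)
    R-closed =
      (λ x → ⇒F-intro start (memF zero zero) λ t → ⌊⌋-intro (R? x) (x , proj₁ (a R) t , ε)) ,
      (λ x y → ⇒F-intro (andF (memF (suc zero) zero) step) (memF zero zero) λ (m , t) →
        let x₀ , ax , r = ⌊⌋-true (R? x) m in ⌊⌋-intro (R? y) (x₀ , ax , r ◅◅ (proj₁ (e R) t ◅ ε)))

  -- The quantified set is instantiated with the vertices reachable from `A`, a Boolean set because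
  -- `star?` decides reachability. It is closed, hence meets the target.
  lfp-elim : sem g (lfpF start step target) ρ η → ∃[ x ] ∃[ y ] (A x × Star E x y × B y)
  lfp-elim s = let y , m , t = ⇒F-elim (closedF start step) hitF (s R) R-closed
                   x , ax , r = ⌊⌋-true (R? y) m
               in x , y , ax , r , proj₁ (b R) t

  lfp-intro : ∀ {x y} → A x → Star E x y → B y → sem g (lfpF start step target) ρ η
  lfp-intro {x} {y} ax r by Z = ⇒F-intro (closedF start step) hitF λ (s , t) →
      y , closed t r (⇒F-elim start (memF zero zero) (s x) (proj₂ (a Z) ax)) , proj₂ (b Z) by
    where
    closed : (∀ x y → sem g (andF (memF (suc zero) zero) step ⇒F memF zero zero) (y ∷ᶠ (x ∷ᶠ ρ)) (Z ∷ᶠ η)) →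
             ∀ {x y} → Star E x y → Z x ≡ true → Z y ≡ true
    closed t ε z = z
    closed t (s ◅ r) z =
      closed t r (⇒F-elim (andF (memF (suc zero) zero) step) (memF zero zero) (t _ _) (z , proj₂ (e Z) s))

exS* allS* : ∀ {ns ne i j} k → Form ns ne i (k + j) → Form ns ne i j
exS* zero φ = φ
exS* (suc k) φ = exS* k (exSF φ)
allS* zero φ = φ
allS* (suc k) φ = allS* k (allSF φ)

app : ∀ {A : Set} {j} k → (Fin k → A) → (Fin j → A) → Fin (k + j) → A
app zero X η = η
app (suc k) X η = X zero ∷ᶠ app k (X ∘ suc) η

app-ˡ : ∀ {A : Set} {j} k (X : Fin k → A) (η : Fin j → A) c → app k X η (c ↑ˡ j) ≡ X c
app-ˡ (suc k) X η zero = refl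
app-ˡ (suc k) X η (suc c) = app-ˡ k (X ∘ suc) η c

app-ʳ : ∀ {A : Set} {j} k (X : Fin k → A) (η : Fin j → A) x → app k X η (k ↑ʳ x) ≡ η x
app-ʳ zero X η x = refl
app-ʳ (suc k) X η x = app-ʳ k (X ∘ suc) η x

module _ {ns ne i j : ℕ} {g : Graph ns ne} {ρ : Fin i → Fin (nv g)} {η : Fin j → Fin (nv g) → Bool} where

  exS*-elim : ∀ k (φ : Form ns ne i (k + j)) → sem g (exS* k φ) ρ η → ∃[ X ] sem g φ ρ (app k X η)
  exS*-elim zero φ s = e0 , s
  exS*-elim (suc k) φ s = let X , S , t = exS*-elim k (exSF φ) s in S ∷ᶠ X , t

  exS*-intro : ∀ k (φ : Form ns ne i (k + j)) X → sem g φ ρ (app k X η) → sem g (exS* k φ) ρ η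
  exS*-intro zero φ X s = s
  exS*-intro (suc k) φ X s = exS*-intro k (exSF φ) (X ∘ suc) (X zero , s)

  allS*-elim : ∀ k (φ : Form ns ne i (k + j)) → sem g (allS* k φ) ρ η → ∀ X → sem g φ ρ (app k X η)
  allS*-elim zero φ s X = s
  allS*-elim (suc k) φ s X = allS*-elim k (allSF φ) s (X ∘ suc) (X zero)

  allS*-intro : ∀ k (φ : Form ns ne i (k + j)) → (∀ X → sem g φ ρ (app k X η)) → sem g (allS* k φ) ρ η
  allS*-intro zero φ s = s e0
  allS*-intro (suc k) φ s = allS*-intro k (allSF φ) (λ X S → s (S ∷ᶠ X))

-- Composition of MSO transductions

-- Backward translation: a node variable x of the image ranges over the pairs (x , κ x), and a set
-- variable X over families of nc sets, with indices combine X c.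
module _ {ne₁ ne₂ : ℕ} (T : MSOT 1 ne₁ 1 ne₂) where
  open MSOT T

  nodeF : ∀ {i j} → Fin nc → Form 1 ne₁ (suc i) j
  nodeF c = ren (λ _ → zero) e0 (φnode c zero)

  back : ∀ {i j} → Form 1 ne₂ i j → (Fin i → Fin nc) → Form 1 ne₁ i (j * nc)
  -- The image has only one node label.
  back (labF σ x) κ = trueF
  back (edgeF γ x y) κ = ren (e2 x y) e0 (φedge (κ x) (κ y) γ)
  back (eqF x y) κ = guardF ⌊ κ x Fin.≟ κ y ⌋ (eqF x y)
  back (memF x X) κ = memF x (combine X (κ x))
  back (notF φ) κ = notF (back φ κ)
  back (orF φ ψ) κ = orF (back φ κ) (back ψ κ)
  back (andF φ ψ) κ = andF (back φ κ) (back ψ κ)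
  back (exF φ) κ = bigOr λ c → exF (andF (nodeF c) (back φ (c ∷ᶠ κ)))
  back (allF φ) κ = bigAnd λ c → allF (nodeF c ⇒F back φ (c ∷ᶠ κ))
  back (exSF φ) κ = exS* nc (back φ κ)
  back (allSF φ) κ = allS* nc (back φ κ)

  module _ {g : Graph 1 ne₁} {h : Graph 1 ne₂} (I : Img T g h) where
    open Img I

    private
      node→ : ∀ {i j c u} {ρ : Fin i → Fin (nv g)} {η : Fin j → Fin (nv g) → Bool} →
              sem g (nodeF c) (u ∷ᶠ ρ) η → sem g (φnode c zero) (e1 u) e0
      node→ {c = c} = proj₁ (sem-ren g (φnode c zero) (λ { zero → refl }) (λ ()))
      node← : ∀ {i j c u} {ρ : Fin i → Fin (nv g)} {η : Fin j → Fin (nv g) → Bool} →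
              sem g (φnode c zero) (e1 u) e0 → sem g (nodeF c) (u ∷ᶠ ρ) η
      node← {c = c} = proj₂ (sem-ren g (φnode c zero) (λ { zero → refl }) (λ ()))

      Nodes : ∀ {i} → (Fin i → Fin (nv h)) → (Fin i → Fin (nv g)) → (Fin i → Fin nc) → Set
      Nodes ρ ρ' κ = ∀ x → f (ρ x) ≡ (ρ' x , κ x)
      Sets : ∀ {j} → (Fin j → Fin (nv h) → Bool) → (Fin (j * nc) → Fin (nv g) → Bool) → Set
      Sets η η' = ∀ X v → η' (combine X (proj₂ (f v))) (proj₁ (f v)) ≡ η X v

      ext-nodes : ∀ {i v u c} {ρ : Fin i → Fin (nv h)} {ρ' κ} → f v ≡ (u , c) →
                  Nodes ρ ρ' κ → Nodes (v ∷ᶠ ρ) (u ∷ᶠ ρ') (c ∷ᶠ κ)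
      ext-nodes p q zero = p
      ext-nodes p q (suc x) = q x

      ext-sets : ∀ {j S X} {η : Fin j → Fin (nv h) → Bool} {η'} →
                 (∀ v → X (proj₂ (f v)) (proj₁ (f v)) ≡ S v) → Sets η η' → Sets (S ∷ᶠ η) (app nc X η')
      ext-sets {X = X} {η' = η'} p q zero v =
        trans (cong (λ Y → Y (proj₁ (f v))) (app-ˡ nc X η' (proj₂ (f v)))) (p v)
      ext-sets {X = X} {η' = η'} p q (suc Y) v =
        trans (cong (λ Y → Y (proj₁ (f v))) (app-ʳ nc X η' (combine Y (proj₂ (f v))))) (q Y v)

      -- Spreads a set of image nodes over the copies; pairs that are no image nodes belong to none
      -- of the resulting sets.
      at? : ∀ (S : Fin (nv h) → Bool) u c → Dec (∃[ v ] (f v ≡ (u , c) × S v ≡ true))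
      at? S u c = Fin.any? λ v → Σ.≡-dec Fin._≟_ Fin._≟_ (f v) (u , c) ×-dec (S v Bool.≟ true)

      at≡ : ∀ S v → ⌊ at? S (proj₁ (f v)) (proj₂ (f v)) ⌋ ≡ S v
      at≡ S v = ⇔→≡
        (λ e → let v' , p , q = ⌊⌋-true (at? S _ _) e in trans (cong S (inj (≡sym p))) q)
        (λ e → ⌊⌋-intro (at? S _ _) (v , refl , e))

    back-sem : ∀ {i j} (φ : Form 1 ne₂ i j) {ρ ρ' κ η η'} → Nodes ρ ρ' κ → Sets η η' →
               (sem h φ ρ η → sem g (back φ κ) ρ' η') × (sem g (back φ κ) ρ' η' → sem h φ ρ η)
    back-sem (labF σ x) p q = (λ _ (_ , n) → n refl) , (λ _ → fin1 _ _)
    back-sem (edgeF γ x y) {ρ} {ρ'} {κ} p q =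
        (λ e → proj₂ r (subst (λ (u , c) → ∀ {v d} → f (ρ y) ≡ (v , d) → sem g (φedge c d γ) (e2 u v) e0) (p x)
                 (λ { refl → edge→ e }) (p y))) ,
        (λ s → edge← (subst (λ (u , c) → ∀ {v d} → (v , d) ≡ f (ρ y) → sem g (φedge c d γ) (e2 u v) e0) (≡sym (p x))
                 (λ {v} {d} eq → subst (λ (v , d) → sem g (φedge (κ x) d γ) (e2 (ρ' x) v) e0)
                     (trans (≡sym (p y)) (≡sym eq)) (proj₁ r s)) refl))
      where
      r = sem-ren g (φedge (κ x) (κ y) γ) {r = e2 x y} {s = e0} {ρ = ρ'} {ρ' = e2 (ρ' x) (ρ' y)} {η' = e0}
            (λ { zero → refl ; (suc zero) → refl }) (λ ())
    back-sem (eqF x y) {ρ} {ρ'} {κ} p q =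
      (λ e → let e' = trans (≡sym (p x)) (trans (cong f e) (p y)) in
             guardF-intro (eqF x y) (⌊⌋-intro (κ x Fin.≟ κ y) (cong proj₂ e')) (cong proj₁ e')) ,
      (λ s → let b , e = guardF-elim _ (eqF x y) s in
             inj (trans (p x) (trans (cong₂ _,_ e (⌊⌋-true (κ x Fin.≟ κ y) b)) (≡sym (p y)))))
    back-sem (memF x X) {ρ} {η = η} {η'} p q = (λ e → trans eq e) , (λ e → trans (≡sym eq) e)
      where
      eq = trans (cong (λ (u , c) → η' (combine X c) u) (≡sym (p x))) (q X (ρ x))
    back-sem (notF φ) p q = let a , b = back-sem φ p q in (_∘ b) , (_∘ a)
    back-sem (orF φ ψ) p q = let a , b = back-sem φ p q ; c , d = back-sem ψ p q in
      [ inj₁ ∘ a , inj₂ ∘ c ]′ , [ inj₁ ∘ b , inj₂ ∘ d ]′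
    back-sem (andF φ ψ) p q = let a , b = back-sem φ p q ; c , d = back-sem ψ p q in
      (λ (x , y) → a x , c y) , (λ (x , y) → b x , d y)
    back-sem (exF φ) {κ = κ} p q =
      (λ (v , s) → bigOr-intro (λ c → exF (andF (nodeF c) (back φ (c ∷ᶠ κ)))) (proj₂ (f v))
          (proj₁ (f v) , node← (node v) , proj₁ (back-sem φ (ext-nodes refl p) q) s)) ,
      (λ s → let c , u , n , t = bigOr-elim (λ c → exF (andF (nodeF c) (back φ (c ∷ᶠ κ)))) s
                 v , e = surj u c (node→ n)
             in v , proj₂ (back-sem φ (ext-nodes e p) q) t)
    back-sem (allF φ) {κ = κ} p q =
      (λ s → bigAnd-intro (λ c → allF (nodeF c ⇒F back φ (c ∷ᶠ κ))) λ c u →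
          ⇒F-intro (nodeF c) (back φ (c ∷ᶠ κ)) λ n →
          let v , e = surj u c (node→ n) in proj₁ (back-sem φ (ext-nodes e p) q) (s v)) ,
      (λ s v → proj₂ (back-sem φ (ext-nodes refl p) q)
          (⇒F-elim (nodeF _) (back φ _) (bigAnd-elim (λ c → allF (nodeF c ⇒F back φ (c ∷ᶠ κ))) s (proj₂ (f v))
              (proj₁ (f v)))
            (node← (node v))))
    back-sem (exSF φ) {κ = κ} p q =
      (λ (S , s) → exS*-intro nc (back φ κ) (λ c u → ⌊ at? S u c ⌋)
          (proj₁ (back-sem φ p (ext-sets (at≡ S) q)) s)) ,
      (λ s → let X , t = exS*-elim nc (back φ κ) s in
          (λ v → X (proj₂ (f v)) (proj₁ (f v))) , proj₂ (back-sem φ p (ext-sets (λ _ → refl) q)) t)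
    back-sem (allSF φ) {κ = κ} p q =
      (λ s → allS*-intro nc (back φ κ) λ X →
          proj₁ (back-sem φ p (ext-sets (λ _ → refl) q)) (s (λ v → X (proj₂ (f v)) (proj₁ (f v))))) ,
      (λ s S → proj₂ (back-sem φ p (ext-sets (at≡ S) q))
          (allS*-elim nc (back φ κ) s (λ c u → ⌊ at? S u c ⌋)))

compT : ∀ {ne₁ ne₂ ne₃} → MSOT 1 ne₁ 1 ne₂ → MSOT 1 ne₂ 1 ne₃ → MSOT 1 ne₁ 1 ne₃
compT T₁ T₂ = record
  { φdom = andF T₁.φdom (back T₁ T₂.φdom e0)
  ; nc = T₁.nc * T₂.nc
  ; φnode = λ c σ → let c₁ , c₂ = remQuot {T₁.nc} T₂.nc c in
      andF (T₁.φnode c₁ zero) (back T₁ (T₂.φnode c₂ σ) (e1 c₁))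
  ; φedge = λ c d γ → let c₁ , c₂ = remQuot {T₁.nc} T₂.nc c ; d₁ , d₂ = remQuot {T₁.nc} T₂.nc d in
      back T₁ (T₂.φedge c₂ d₂ γ) (e2 c₁ d₁)
  }
  where
  module T₁ = MSOT T₁
  module T₂ = MSOT T₂

module _ {ne₁ ne₂ ne₃ : ℕ} (T₁ : MSOT 1 ne₁ 1 ne₂) (T₂ : MSOT 1 ne₂ 1 ne₃) where
  private
    module T₁ = MSOT T₁
    module T₂ = MSOT T₂
    module T = MSOT (compT T₁ T₂)

  comp-dom : ∀ {g h} → Img T₁ g h → sem h T₂.φdom e0 e0 → sem g T.φdom e0 e0
  comp-dom {g} {h} I d = Img.dom I , proj₁ (back-sem T₁ I T₂.φdom {e0} {e0} {e0} {e0} {e0} (λ ()) (λ ())) d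

  dom-comp : ∀ {g} → sem g T.φdom e0 e0 → sem g T₁.φdom e0 e0 × (∀ {h} → Img T₁ g h → sem h T₂.φdom e0 e0)
  dom-comp (d , e) = d , λ I → proj₂ (back-sem T₁ I T₂.φdom {e0} {e0} {e0} {e0} {e0} (λ ()) (λ ())) e

  Img-comp : ∀ {g h k} → Img T₁ g h → Img T₂ h k → Img (compT T₁ T₂) g k
  Img-comp {g} {h} {k} I J = record
    { dom = comp-dom I J.dom
    ; f = λ v → let x , c₂ = J.f v ; u , c₁ = I.f x in u , combine c₁ c₂
    ; inj = λ {v} {v'} e →
        let x , c = J.f v ; y , d = J.f v' ; u , c₁ = I.f x ; w , d₁ = I.f y
            eq = trans (≡sym (Fin.remQuot-combine c₁ c)) (trans (cong (remQuot {T₁.nc} T₂.nc) (cong proj₂ e))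
                (Fin.remQuot-combine d₁ d))
        in J.inj (cong₂ _,_ (I.inj (cong₂ _,_ (cong proj₁ e) (cong proj₁ eq))) (cong proj₂ eq))
    ; node = λ v → let x , c₂ = J.f v ; u , c₁ = I.f x in
        subst (λ (c₁ , c₂) → sem g (andF (T₁.φnode c₁ zero) (back T₁ (T₂.φnode c₂ zero) (e1 c₁))) (e1 u) e0)
          (≡sym (Fin.remQuot-combine c₁ c₂))
          (I.node x , proj₁ (node-sem refl) (J.node v))
    ; surj = λ u c (n₁ , n₂) → let c₁ , c₂ = remQuot {T₁.nc} T₂.nc c ; x , e = I.surj u c₁ n₁
                                   v , e' = J.surj x c₂ (proj₂ (node-sem e) n₂)
        in v , trans (cong (λ (x , c₂) → proj₁ (I.f x) , combine (proj₂ (I.f x)) c₂) e')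
                 (trans (cong (λ (u , c₁) → u , combine c₁ c₂) e) (cong (u ,_) (Fin.combine-remQuot {T₁.nc} T₂.nc c)))
    ; edge→ = λ {v} {γ} {v'} e → subst (λ P → P) (≡sym (edge-eq v v' γ)) (proj₁ edge-sem (J.edge→ e))
    ; edge← = λ {v} {γ} {v'} s → J.edge← (proj₂ edge-sem (subst (λ P → P) (edge-eq v v' γ) s))
    }
    where
    module I = Img I
    module J = Img J
    node-sem : ∀ {x u c₁ c₂} → I.f x ≡ (u , c₁) →
      (sem h (T₂.φnode c₂ zero) (e1 x) e0 → sem g (back T₁ (T₂.φnode c₂ zero) (e1 c₁)) (e1 u) e0) ×
      (sem g (back T₁ (T₂.φnode c₂ zero) (e1 c₁)) (e1 u) e0 → sem h (T₂.φnode c₂ zero) (e1 x) e0)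
    node-sem e = back-sem T₁ I (T₂.φnode _ zero) (λ { zero → e }) (λ ())
    edge-sem : ∀ {x y c d γ} →
      let u , c₁ = I.f x ; u' , d₁ = I.f y in
      (sem h (T₂.φedge c d γ) (e2 x y) e0 → sem g (back T₁ (T₂.φedge c d γ) (e2 c₁ d₁)) (e2 u u') e0) ×
      (sem g (back T₁ (T₂.φedge c d γ) (e2 c₁ d₁)) (e2 u u') e0 → sem h (T₂.φedge c d γ) (e2 x y) e0)
    edge-sem {γ = γ} = back-sem T₁ I (T₂.φedge _ _ γ) (λ { zero → refl ; (suc zero) → refl }) (λ ())
    edge-eq : ∀ v v' γ → let x , c₂ = J.f v ; u , c₁ = I.f x ; y , d₂ = J.f v' ; u' , d₁ = I.f y in
      sem g (T.φedge (combine c₁ c₂) (combine d₁ d₂) γ) (e2 u u') e0 ≡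
      sem g (back T₁ (T₂.φedge c₂ d₂ γ) (e2 c₁ d₁)) (e2 u u') e0
    edge-eq v v' γ = let x , c₂ = J.f v ; u , c₁ = I.f x ; y , d₂ = J.f v' ; u' , d₁ = I.f y in
      cong₂ (λ (c₁ , c₂) (d₁ , d₂) → sem g (back T₁ (T₂.φedge c₂ d₂ γ) (e2 c₁ d₁)) (e2 u u') e0)
        (Fin.remQuot-combine c₁ c₂) (Fin.remQuot-combine d₁ d₂)

-- String graphs and uniformization

data Walk {V A : Set} (R : V → A → V → Set) : V → List A → V → Set where
  []  : ∀ {x} → Walk R x [] x
  _∷_ : ∀ {x a y z e} → R x a y → Walk R y z e → Walk R x (a ∷ z) e

module _ {V A : Set} {R : V → A → V → Set} where

  -- Positions beyond the end of the walk are sent to its last vertex.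
  at : ∀ {x z y} → Walk R x z y → ℕ → V
  at {x = x} w zero = x
  at {x = x} [] (suc k) = x
  at (r ∷ w) (suc k) = at w k

  at-end : ∀ {x z y} (w : Walk R x z y) → at w (length z) ≡ y
  at-end [] = refl
  at-end (r ∷ w) = at-end w

  at-step : ∀ {x z y} (w : Walk R x z y) k {a} → nth z k ≡ just a → R (at w k) a (at w (suc k))
  at-step (r ∷ []) zero refl = r
  at-step (r ∷ (_ ∷ _)) zero refl = r
  at-step (r ∷ w) (suc k) e = at-step w k e

  Simple : ∀ {x z y} → Walk R x z y → Set
  Simple {z = z} w = ∀ {i j} → i ≤ length z → j ≤ length z → at w i ≡ at w j → i ≡ j

  dropW : ∀ {x z y} (w : Walk R x z y) k → k ≤ length z →
          ∃[ z' ] Σ (Walk R (at w k) z' y) λ w' → k + length z' ≡ length z × (∀ i → at w' i ≡ at w (k + i))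
  dropW w zero l = _ , w , refl , λ _ → refl
  dropW (r ∷ w) (suc k) (s≤s l) = let z' , w' , e , f = dropW w k l in z' , w' , cong suc e , f

  -- Loop erasure from the end: if the new first vertex already occurs on the simple rest, the walk
  -- is entered at that occurrence instead.
  simplify : (∀ x y → Dec (x ≡ y)) → ∀ {x z y} → Walk R x z y → ∃[ z' ] Σ (Walk R x z' y) Simple
  simplify _≟_ [] = [] , [] , λ { z≤n z≤n _ → refl }
  simplify _≟_ {x} (r ∷ w) with simplify _≟_ w
  ... | z , w' , s with ℕ.anyUpTo? (λ k → at w' k ≟ x) (suc (length z))
  ... | yes (k , s≤s k≤ , refl) =
        let z'' , w'' , e , f = dropW w' k k≤
            bound : ∀ {i} → i ≤ length z'' → k + i ≤ length z
            bound l = ℕ.≤-trans (ℕ.+-monoʳ-≤ k l) (ℕ.≤-reflexive e)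
        in z'' , w'' , λ {i} {j} i≤ j≤ eq →
             ℕ.+-cancelˡ-≡ k i j (s (bound i≤) (bound j≤) (trans (≡sym (f i)) (trans eq (f j))))
  ... | no n = _ , r ∷ w' , λ
        { {zero} {zero} _ _ _ → refl
        ; {zero} {suc j} _ j≤ e → ⊥-elim (n (j , j≤ , ≡sym e))
        ; {suc i} {zero} i≤ _ e → ⊥-elim (n (i , i≤ , e))
        ; {suc i} {suc j} (s≤s i≤) (s≤s j≤) e → cong suc (s i≤ j≤ e) }

nth-lookup : ∀ {A : Set} (w : List A) k → nth w (toℕ k) ≡ just (lookup w k)
nth-lookup (a ∷ w) zero = refl
nth-lookup (a ∷ w) (suc k) = nth-lookup w k

nth-< : ∀ {A : Set} (w : List A) {k} → k < length w → ∃[ a ] nth w k ≡ just a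
nth-< (a ∷ w) {zero} _ = a , refl
nth-< (a ∷ w) {suc k} (s≤s l) = nth-< w l

nth-bound : ∀ {A : Set} (w : List A) {k a} → nth w k ≡ just a → k < length w
nth-bound (_ ∷ w) {zero} e = s≤s z≤n
nth-bound (_ ∷ w) {suc k} e = s≤s (nth-bound w e)

nth-length : ∀ {A : Set} (w : List A) → nth w (length w) ≡ nothing
nth-length [] = refl
nth-length (a ∷ w) = nth-length w

nth-ext : ∀ {A : Set} (w w' : List A) → (∀ k {a} → nth w k ≡ just a → nth w' k ≡ just a) →
          (∀ k {a} → nth w' k ≡ just a → nth w k ≡ just a) → w ≡ w'
nth-ext [] [] f g = refl
nth-ext [] (b ∷ w') f g with () ← g 0 refl
nth-ext (a ∷ w) [] f g with () ← f 0 refl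
nth-ext (a ∷ w) (b ∷ w') f g with refl ← f 0 refl = cong (a ∷_) (nth-ext w w' (f ∘ suc) (g ∘ suc))

module _ {n : ℕ} (h : Graph 1 n) where
  E[_] : Fin (nv h) → Fin n → Fin (nv h) → Set
  E[ x ] a y = edge h x a y ≡ true

  Adj : Fin (nv h) → Fin (nv h) → Set
  Adj x y = ∃[ a ] E[ x ] a y

  star→walk : ∀ {x y} → Star Adj x y → ∃[ z ] Walk E[_] x z y
  star→walk ε = [] , []
  star→walk ((a , e) ◅ r) = let z , w = star→walk r in a ∷ z , e ∷ w

  -- The position on the walk is the bijection. The relation `R` of the walk may differ from the
  -- edges of `h`, which enter through `t` and `u`; this allows a walk found before the edges were
  -- redefined. At the last position `u` says that there is no outgoing edge.
  walk-≅ : ∀ {R x z y} (w : Walk R x z y) → (∀ i {a} → nth z i ≡ just a → E[ at w i ] a (at w (suc i))) →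
           Simple w → (∀ v → ∃[ k ] (k ≤ length z × at w k ≡ v)) →
           (∀ {i a v} → i ≤ length z → E[ at w i ] a v → nth z i ≡ just a × v ≡ at w (suc i)) → egr z ≅ h
  walk-≅ {z = z} w t s c u = mk↔ₛ′ to from to-from from-to , (λ _ → fin1 _ _) , λ i a j →
      ⇔→≡ (λ e → let p , q = u (bound i) e in egr-edge z {i} {a} {j} (index-suc i j p q) p)
           (λ e → let p , q = edge-egr z {i} {a} {j} e in
              subst (λ k → E[ at w (toℕ i) ] a (at w k)) (≡sym p) (t (toℕ i) q))
    where
    bound : (i : Fin (suc (length z))) → toℕ i ≤ length z
    bound i = ℕ.≤-pred (Fin.toℕ<n i)
    to : Fin (suc (length z)) → Fin (nv h)
    to i = at w (toℕ i)
    from : Fin (nv h) → Fin (suc (length z))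
    from v = fromℕ< {proj₁ (c v)} (s≤s (proj₁ (proj₂ (c v))))
    to-from : ∀ v → to (from v) ≡ v
    to-from v = trans (cong (at w) (Fin.toℕ-fromℕ< (s≤s (proj₁ (proj₂ (c v)))))) (proj₂ (proj₂ (c v)))
    from-to : ∀ i → from (to i) ≡ i
    from-to i = Fin.toℕ-injective (s (bound (from (to i))) (bound i) (to-from (to i)))
    index-suc : ∀ i j {a} → nth z (toℕ i) ≡ just a → at w (toℕ j) ≡ at w (suc (toℕ i)) → toℕ j ≡ suc (toℕ i)
    index-suc i j p q = s (bound j) (nth-bound z p) q

  stepF : ∀ {i j} → Fin i → Fin i → Form 1 n i j
  stepF x y = bigOr λ a → edgeF a x y

  stepF-elim : ∀ {i j} {x y : Fin i} {ρ} {η : Fin j → Fin (nv h) → Bool} → sem h (stepF x y) ρ η → Adj (ρ x) (ρ y)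
  stepF-elim s = bigOr-elim (λ a → edgeF a _ _) s

  stepF-intro : ∀ {i j} {x y : Fin i} {ρ} {η : Fin j → Fin (nv h) → Bool} → Adj (ρ x) (ρ y) → sem h (stepF x y) ρ η
  stepF-intro (a , e) = bigOr-intro (λ a → edgeF a _ _) a e

module _ {n : ℕ} where
  bothF equalF : Fin n → Fin n → Form 1 n 3 0
  bothF a b = andF (edgeF a (suc (suc zero)) (suc zero)) (edgeF b (suc (suc zero)) zero)
  equalF a b = guardF ⌊ a Fin.≟ b ⌋ (eqF (suc zero) zero)

  -- Characterizes string graphs: at most one edge leaves each vertex, some vertex is a sink, and
  -- all vertices are reachable from a root. Since the sink is reached too, determinism excludes
  -- cycles.
  detF stringF : Form 1 n 0 0
  detF = allF (allF (allF (bigAnd λ a → bigAnd λ b → bothF a b ⇒F equalF a b)))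

  reachF : ∀ {i j} → Form 1 n (suc (suc i)) (suc j) → Fin i → Fin i → Form 1 n i j
  reachF step x y = lfpF (eqF zero (suc x)) step (eqF zero (suc y))

  anyStepF : ∀ {i j} → Form 1 n (suc (suc i)) j
  anyStepF = bigOr λ a → edgeF a (suc zero) zero

  -- Under the innermost quantifiers variable 0 is the vertex in question, 1 the sink and 2 the
  -- root.
  stringF = andF detF (exF (exF (andF
    (allF (bigAnd λ a → notF (edgeF a (suc zero) zero)))
    (allF (reachF anyStepF (suc (suc zero)) zero)))))

module _ {n i j : ℕ} {g : Graph 1 n} {ρ : Fin i → Fin (nv g)} {η : Fin j → Fin (nv g) → Bool}
  (step : Form 1 n (suc (suc i)) (suc j)) {E : Fin (nv g) → Fin (nv g) → Set}
  (e : ∀ Z {x y} → (sem g step (y ∷ᶠ (x ∷ᶠ ρ)) (Z ∷ᶠ η) → E x y) × (E x y → sem g step (y ∷ᶠ (x ∷ᶠ ρ)) (Z ∷ᶠ η)))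
  {x y : Fin i} where

  reach-elim : sem g (reachF step x y) ρ η → Star E (ρ x) (ρ y)
  reach-elim s with lfp-elim {start = eqF zero (suc x)} {eqF zero (suc y)} {step} {A = _≡ ρ x} {B = _≡ ρ y}
      (λ _ → id , id) e (λ _ → id , id) s
  ... | _ , _ , refl , r , refl = r

  reach-intro : Star E (ρ x) (ρ y) → sem g (reachF step x y) ρ η
  reach-intro r = lfp-intro {start = eqF zero (suc x)} {eqF zero (suc y)} {step} {A = _≡ ρ x} {B = _≡ ρ y}
      (λ _ → id , id) e (λ _ → id , id) refl r refl

anyStep-sem : ∀ {n i j} {g : Graph 1 n} {ρ : Fin i → Fin (nv g)} {η : Fin j → Fin (nv g) → Bool} Z {x y} →
  (sem g anyStepF (y ∷ᶠ (x ∷ᶠ ρ)) (Z ∷ᶠ η) → Adj g x y) × (Adj g x y → sem g anyStepF (y ∷ᶠ (x ∷ᶠ ρ)) (Z ∷ᶠ η))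
anyStep-sem {g = g} Z = stepF-elim g , stepF-intro g

Det : ∀ {n} → Graph 1 n → Set
Det g = ∀ {x y y' a b} → edge g x a y ≡ true → edge g x b y' ≡ true → a ≡ b × y ≡ y'

det-elim : ∀ {n} {g : Graph 1 n} → sem g detF e0 e0 → Det g
det-elim {n} {g} s {x} {y} {y'} {a} {b} e f =
  let p , q = guardF-elim {ρ = ρ} _ (eqF (suc zero) zero)
        (⇒F-elim {ρ = ρ} (bothF a b) (equalF a b) (bigAnd-elim {ρ = ρ} (imp a) (bigAnd-elim {ρ = ρ} (bigAnd ∘ imp) (s x y y') a) b)
          (e , f))
  in ⌊⌋-true (a Fin.≟ b) p , q
  where
  ρ : Fin 3 → Fin (nv g)
  ρ = y' ∷ᶠ e2 y x
  imp : Fin n → Fin n → Form 1 n 3 0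
  imp a b = bothF a b ⇒F equalF a b

det-intro : ∀ {n} {g : Graph 1 n} → Det g → sem g detF e0 e0
det-intro {g = g} d x y y' =
  bigAnd-intro {ρ = ρ} (λ a → bigAnd λ b → bothF a b ⇒F equalF a b) λ a →
  bigAnd-intro {ρ = ρ} (λ b → bothF a b ⇒F equalF a b) λ b →
  ⇒F-intro {ρ = ρ} (bothF a b) (equalF a b) λ (e , f) → let p , q = d e f in
  guardF-intro {ρ = ρ} (eqF (suc zero) zero) (⌊⌋-intro (a Fin.≟ b) p) q
  where
  ρ : Fin 3 → Fin (nv g)
  ρ = y' ∷ᶠ e2 y x

-- Take a simple walk from root to sink. By determinism the only edge leaving one of its vertices is
-- the next step, so nothing reachable from the root lies off the walk.
string→egr : ∀ {n} {g : Graph 1 n} → sem g stringF e0 e0 → ∃[ w ] egr w ≅ g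
string→egr {g = g} (d , r , e , no-out , all) =
    let z₀ , w₀ = star→walk g (reach e) ; z , w , s = simplify Fin._≟_ w₀ in
    z , walk-≅ g w (at-step w) s (λ v → on-walk w (reach v) (0 , z≤n , refl)) (next w)
  where
  det : Det g
  det = det-elim {g = g} d
  reach : ∀ v → Star (Adj g) r v
  reach v = reach-elim {ρ = v ∷ᶠ (e ∷ᶠ (r ∷ᶠ e0))} anyStepF (anyStep-sem {g = g}) {suc (suc zero)} {zero} (all v)
  sink : ∀ {a v} → ¬ edge g e a v ≡ true
  sink {a} {v} = bigAnd-elim {ρ = v ∷ᶠ (e ∷ᶠ (r ∷ᶠ e0))} {η = e0} (λ a → notF (edgeF a (suc zero) zero)) (no-out v) a
  next : ∀ {z} (w : Walk (E[_] g) r z e) {i a v} → i ≤ length z → edge g (at w i) a v ≡ true →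
         nth z i ≡ just a × v ≡ at w (suc i)
  next {z} w {i} i≤ x with ℕ.m≤n⇒m<n∨m≡n i≤
  ... | inj₂ refl = ⊥-elim (sink (subst (λ u → edge g u _ _ ≡ true) (at-end w) x))
  ... | inj₁ i< = let b , p = nth-< z i< ; q , q' = det x (at-step w i p) in trans p (cong just (≡sym q)) , q'
  on-walk : ∀ {z} (w : Walk (E[_] g) r z e) {u v} → Star (Adj g) u v →
            ∃[ k ] (k ≤ length z × at w k ≡ u) → ∃[ k ] (k ≤ length z × at w k ≡ v)
  on-walk w ε p = p
  on-walk {z} w ((a , x) ◅ r) (k , k≤ , refl) with ℕ.m≤n⇒m<n∨m≡n k≤
  ... | inj₁ k< = on-walk w r (suc k , k< , ≡sym (proj₂ (next w k≤ x)))
  ... | inj₂ refl = ⊥-elim (sink (subst (λ u → edge g u _ _ ≡ true) (at-end w) x))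

egr-succ : ∀ {n} (w : Str n) {x y} → toℕ y ≡ suc (toℕ x) → Adj (egr w) x y
egr-succ w {x} {suc y} e = lookup w y , egr-edge w {x} {lookup w y} {suc y} e
  (trans (cong (nth w) (≡sym (ℕ.suc-injective e))) (nth-lookup w y))

egr-pred : ∀ {n} (w : Str n) y → Adj (egr w) (inject₁ y) (suc y)
egr-pred w y = egr-succ w {inject₁ y} {suc y} (cong suc (≡sym (Fin.toℕ-inject₁ y)))

egr-star : ∀ {n} (w : Str n) d {x y} → toℕ y ≡ d + toℕ x → Star (Adj (egr w)) x y
egr-star w zero e with refl ← Fin.toℕ-injective e = ε
egr-star w (suc d) {x} {suc y} e =
  egr-star w d {x} {inject₁ y} (trans (Fin.toℕ-inject₁ y) (ℕ.suc-injective e)) ◅◅ (egr-pred w y ◅ ε)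

star-egr : ∀ {n} (w : Str n) {x y} → Star (Adj (egr w)) x y → toℕ x ≤ toℕ y
star-egr w ε = ℕ.≤-refl
star-egr w ((a , e) ◅ r) =
  ℕ.≤-trans (ℕ.n≤1+n _) (ℕ.≤-trans (ℕ.≤-reflexive (≡sym (proj₁ (edge-egr w e)))) (star-egr w r))

egr-det : ∀ {n} (w : Str n) → Det (egr w)
egr-det w e f = let p , q = edge-egr w e ; p' , q' = edge-egr w f in
  Maybe.just-injective (trans (≡sym q) q') , Fin.toℕ-injective (trans p (≡sym p'))

egr-sink : ∀ {n} (w : Str n) {a v} → ¬ edge (egr w) (fromℕ (length w)) a v ≡ true
egr-sink w {a} {v} e with () ← trans (≡sym (nth-length w))
  (trans (cong (nth w) (≡sym (Fin.toℕ-fromℕ (length w)))) (proj₂ (edge-egr w {y = v} e)))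

egr-string : ∀ {n} (w : Str n) → sem (egr w) stringF e0 e0
egr-string {n} w = det-intro {g = egr w} (egr-det w) , zero , fromℕ (length w) ,
  (λ v → bigAnd-intro {g = egr w} {ρ = v ∷ᶠ ρ} (λ a → notF (edgeF a (suc zero) zero)) λ a → egr-sink w {a} {v}) ,
  (λ v → reach-intro {ρ = v ∷ᶠ ρ} anyStepF (anyStep-sem {g = egr w}) {suc (suc zero)} {zero}
           (egr-star w (toℕ v) (≡sym (ℕ.+-identityʳ _))))
  where
  ρ : Fin 2 → Fin (suc (length w))
  ρ = fromℕ (length w) ∷ᶠ (zero ∷ᶠ e0)

-- An isomorphism preserves positions: only position 0 has no incoming edge, and successors go to
-- successors. Hence the letters agree position by position.
egr-inj : ∀ {n} {w w' : Str n} → egr w ≅ egr w' → w ≡ w'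
egr-inj {n} {w} {w'} I = nth-ext w w' (λ k → transport w w' I k) (λ k → transport w' w (≅-sym {g = egr w} {egr w'} I) k)
  where
  source : ∀ (w w' : Str n) (I : egr w ≅ egr w') → toℕ (Inverse.to (proj₁ I) zero) ≡ 0
  source w w' I@(i , _ , e) with Inverse.to i zero in eq
  ... | zero = refl
  ... | suc y = let a , x = egr-pred w' y in
    contradiction (proj₁ (edge-egr w {Inverse.from i (inject₁ y)} {a} {zero} (trans (≡sym (e _ a zero))
      (trans (cong₂ (λ u v → edge (egr w') u a v) (Inverse.strictlyInverseˡ i _) eq) x)))) λ ()
  place : ∀ (w w' : Str n) (I : egr w ≅ egr w') k (x : Fin (suc (length w))) → toℕ x ≡ k →
          toℕ (Inverse.to (proj₁ I) x) ≡ k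
  place w w' I zero zero refl = source w w' I
  place w w' I@(i , _ , e) (suc k) (suc y) eq = let a , x = egr-pred w y in
    trans (proj₁ (edge-egr w' {Inverse.to i (inject₁ y)} {a} {Inverse.to i (suc y)} (trans (e (inject₁ y) a (suc y)) x)))
      (cong suc (place w w' I k (inject₁ y) (trans (Fin.toℕ-inject₁ y) (ℕ.suc-injective eq))))
  transport : ∀ (w w' : Str n) → egr w ≅ egr w' → ∀ k {a} → nth w k ≡ just a → nth w' k ≡ just a
  transport w w' I@(i , _ , e) k {a} p =
    trans (cong (nth w') (≡sym (place w w' I k x (trans (Fin.toℕ-inject₁ y) (Fin.toℕ-fromℕ< k<)))))
      (proj₂ (edge-egr w' {Inverse.to i x} {a} {Inverse.to i (suc y)}
          (trans (e x a (suc y)) (egr-edge w {x} {a} {suc y} (cong suc (≡sym (Fin.toℕ-inject₁ y)))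
        (trans (cong (nth w) (trans (Fin.toℕ-inject₁ y) (Fin.toℕ-fromℕ< k<))) p)))))
    where
    k< = nth-bound w p
    y = fromℕ< k<
    x = inject₁ y

-- On strings `T` defines a function contained in `m` and with the same domain. Nothing is said
-- about input graphs that are not strings.
Unif : ∀ {n₁ n₂} → MSOT 1 n₁ 1 n₂ → Trans n₁ n₂ → Set
Unif T m = (∀ w → sem (egr w) (MSOT.φdom T) e0 e0 → ∃[ z ] (Img T (egr w) (egr z) × m w z)) ×
           (∀ w z → m w z → sem (egr w) (MSOT.φdom T) e0 e0)

-- Functionality identifies the value chosen by `T` with the given one. The domain formula is
-- strengthened by `stringF`, because membership in MSOe also constrains the inputs that are not
-- string graphs.
Unif→InMSOe : ∀ {n₁ n₂} (T : MSOT 1 n₁ 1 n₂) {m : Trans n₁ n₂} → Functional m → Unif T m → InMSOe m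
Unif→InMSOe T {m} fun (exists , total) = T' , λ g h →
    (λ (w , z , mwz , g≅ , h≅) →
      let z' , I , mwz' = exists w (total w z mwz)
          J = Img-≅ˡ T {g' = g} {h} (Img-≅ʳ T (egr w) {h' = h} I
                (subst (λ z → egr z ≅ h) (fun w z z' mwz mwz') (≅-sym {g = h} {egr z} h≅))) (≅-sym {g = g} {egr w} g≅)
      in Img→Output T' g (restrict J (sem-≅ stringF {g} (≅-sym {g = g} {egr w} g≅) {e0} {e0} {e0} {e0} (λ ()) (λ ())
          (egr-string w)))) ,
    (λ O → let J , s = relax (Output→Img T' g O)
               w , w≅ = string→egr {g = g} s
               g≅ = ≅-sym {g = egr w} {g} w≅
               K = Img-≅ˡ T {g' = egr w} {h} J g≅
               z , I , mwz = exists w (Img.dom K)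
           in w , z , mwz , g≅ , Img-unique T (egr w) K I)
  where
  T' = record T { φdom = andF (MSOT.φdom T) stringF }
  restrict : ∀ {g h} → Img T g h → sem g stringF e0 e0 → Img T' g h
  restrict J s = record { Img J ; dom = Img.dom J , s }
  relax : ∀ {g h} → Img T' g h → Img T g h × sem g stringF e0 e0
  relax J = record { Img J ; dom = proj₁ (Img.dom J) } , proj₂ (Img.dom J)

-- Canonical accepting walks

least : ∀ {n} {P : Fin n → Set} → (∀ i → Dec (P i)) → ∃ P → ∃[ i ] (P i × (∀ j → toℕ j < toℕ i → ¬ P j))
least {suc n} P? (i , p) with P? zero
... | yes p₀ = zero , p₀ , λ _ ()
least {suc n} P? (zero , p) | no ¬p₀ = ⊥-elim (¬p₀ p)
least {suc n} P? (suc i , p) | no ¬p₀ with least (P? ∘ suc) (i , p)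
... | k , pk , m = suc k , pk , λ { zero _ → ¬p₀ ; (suc j) (s≤s l) → m j l }

-- Lexicographic order with false < true, so that a least set is minimal for inclusion.
LexLe : ∀ {n} → (Fin n → Bool) → (Fin n → Bool) → Set
LexLe {n} S S' = ∀ x → S x ≡ true × ¬ S' x ≡ true → ∃[ y ] (toℕ y < toℕ x × ¬ S y ≡ true × S' y ≡ true)

anySet? : ∀ {n} {P : (Fin n → Bool) → Set} → (∀ S → Dec (P S)) → (∀ {S S'} → S ≗ S' → P S → P S') → Dec (∃ P)
anySet? {n} P? ext = map′ (λ a → let S , _ , p = find a in S , p)
  (λ (S , p) → let S' , S'∈ , e = ∈subsets n S in lose S'∈ (ext (λ x → ≡sym (e x)) p)) (Any.any? P? (subsets n))

-- Greedy choice: element 0 is left out whenever some solution omits it, and the remaining elements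
-- are treated in the same way. The assumption on `≗` stands in for extensionality.
least-set : ∀ {n} {P : (Fin n → Bool) → Set} → (∀ S → Dec (P S)) → (∀ {S S'} → S ≗ S' → P S → P S') →
            ∃ P → ∃[ S ] (P S × (∀ S' → P S' → LexLe S S'))
least-set {zero} P? ext (S , p) = S , p , λ _ _ ()
least-set {suc n} {P} P? ext (S , p)
  with anySet? {P = λ S → P (false ∷ᶠ S)} (λ S → P? _) (λ e → ext λ { zero → refl ; (suc x) → e x })
... | yes ex = let S₀ , p₀ , m = least-set {P = λ S → P (false ∷ᶠ S)} (λ S → P? _)
                                   (λ e → ext λ { zero → refl ; (suc x) → e x }) ex
               in false ∷ᶠ S₀ , p₀ , smaller S₀ m
  where
  smaller : ∀ S₀ → (∀ S' → P (false ∷ᶠ S') → LexLe S₀ S') → ∀ S' → P S' → LexLe (false ∷ᶠ S₀) S'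
  smaller S₀ m S' p' zero (() , _)
  smaller S₀ m S' p' (suc x) c with S' zero in eq
  ... | true = zero , s≤s z≤n , (λ ()) , eq
  ... | false = let y , l , a , b = m (S' ∘ suc) (ext (λ { zero → eq ; (suc _) → refl }) p') x c in suc y , s≤s l , a , b
... | no ¬ex = let S₀ , p₀ , m = least-set {P = λ S → P (true ∷ᶠ S)} (λ S → P? _)
                                   (λ e → ext λ { zero → refl ; (suc x) → e x })
                                       (S ∘ suc , ext (λ { zero → head S p ; (suc _) → refl }) p)
               in true ∷ᶠ S₀ , p₀ , λ S' p' → λ
                    { zero (_ , n) → ⊥-elim (n (head S' p'))
                    ; (suc x) c → let y , l , a , b = m (S' ∘ suc) (ext (λ { zero → head S' p' ; (suc _) → refl }) p') x c
                                  in suc y , s≤s l , a , b }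
  where
  head : ∀ S → P S → S zero ≡ true
  head S p with S zero in eq
  ... | true = refl
  ... | false = ⊥-elim (¬ex (S ∘ suc , ext (λ { zero → eq ; (suc _) → refl }) p))

-- A disagreement at `x` yields one at a smaller position, so strong induction applies. Uniqueness
-- of the least set lets every node formula speak of it by an existential quantifier of its own.
LexLe-antisym : ∀ {n} {S S' : Fin n → Bool} → LexLe S S' → LexLe S' S → S ≗ S'
LexLe-antisym {n} {S} {S'} l l' x = below (suc (toℕ x)) x ℕ.≤-refl
  where
  below : ∀ k x → toℕ x < k → S x ≡ S' x
  below (suc k) x (s≤s x≤) with S x in e | S' x in e'
  ... | true | true = refl
  ... | false | false = refl
  ... | true | false = let y , y< , a , b = l x (e , λ t → contradiction (trans (≡sym e') t) λ ()) in
        ⊥-elim (a (trans (below k y (ℕ.≤-trans y< x≤)) b))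
  ... | false | true = let y , y< , a , b = l' x (e' , λ t → contradiction (trans (≡sym e) t) λ ()) in
        ⊥-elim (a (trans (≡sym (below k y (ℕ.≤-trans y< x≤))) b))

relabelT : ∀ {ne₁ ne₂} → (Fin ne₂ → Form 1 ne₁ 2 0) → MSOT 1 ne₁ 1 ne₂
relabelT φ = record { φdom = trueF ; nc = 1 ; φnode = λ _ _ → trueF ; φedge = λ _ _ γ → φ γ }

relabel : ∀ {ne₁ ne₂} → (Fin ne₂ → Form 1 ne₁ 2 0) → Graph 1 ne₁ → Graph 1 ne₂
relabel φ g = record { nv = nv g ; lab = λ _ → zero ; edge = λ x γ y → sat g (φ γ) (e2 x y) e0 }

module _ {ne₁ ne₂ : ℕ} (φ : Fin ne₂ → Form 1 ne₁ 2 0) (g : Graph 1 ne₁) where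
  relabel-elim : ∀ x γ y → edge (relabel φ g) x γ y ≡ true → sem g (φ γ) (e2 x y) e0
  relabel-elim x γ y = sem-sound {g = g} (φ γ)

  relabel-intro : ∀ x γ y → sem g (φ γ) (e2 x y) e0 → edge (relabel φ g) x γ y ≡ true
  relabel-intro x γ y = sem-complete {g = g} (φ γ)

Img-relabel : ∀ {ne₁ ne₂} (φ : Fin ne₂ → Form 1 ne₁ 2 0) g → Img (relabelT φ) g (relabel φ g)
Img-relabel φ g = record
  { dom = λ (u , n) → n refl
  ; f = λ v → v , zero
  ; inj = cong proj₁
  ; node = λ v (u , n) → n refl
  ; surj = λ { u zero _ → u , refl }
  ; edge→ = λ {v} {γ} {v'} → relabel-elim φ g v γ v'
  ; edge← = λ {v} {γ} {v'} → relabel-intro φ g v γ v'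
  }

-- Edge labels: < is the order of the nodes, I and F are loops at the initial and final nodes, ε marks
-- the steps without output, and the others are letters; the index counts the labels before the letters.
module _ {n : ℕ} where
  pattern L< = zero
  pattern LI = suc zero
  pattern LF = suc (suc zero)
  pattern Lε = suc (suc (suc zero))
  pattern L₄ a = suc (suc (suc (suc a)))
  pattern L₃ a = suc (suc (suc a))
  pattern KI = zero
  pattern KF = suc zero
  pattern K₂ a = suc (suc a)

  data EWalk (h : Graph 1 (4 + n)) : Fin (nv h) → Str n → Fin (nv h) → Set where
    []  : ∀ {x} → EWalk h x [] x
    eps : ∀ {x y z e} → edge h x Lε y ≡ true → EWalk h y z e → EWalk h x z e
    _∷_ : ∀ {x a y z e} → edge h x (L₄ a) y ≡ true → EWalk h y z e → EWalk h x (a ∷ z) e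

  Accept : Graph 1 (4 + n) → Str n → Set
  Accept h z = ∃[ x ] ∃[ y ] (edge h x LI x ≡ true × EWalk h x z y × edge h y LF y ≡ true)

  Accept₃ : Graph 1 (3 + n) → Str n → Set
  Accept₃ h z = ∃[ x ] ∃[ y ] (edge h x LI x ≡ true ×
    Walk (λ x a y → edge h x (L₃ a) y ≡ true) x z y × edge h y LF y ≡ true)

  reachεF : Fin 3 → Fin 3 → Form 1 (4 + n) 3 0
  reachεF x y = lfpF (eqF zero (suc x)) (edgeF Lε (suc zero) zero) (eqF zero (suc y))

  -- As in the removal of silent moves from automata, a letter absorbs the silent steps before it
  -- and acceptance absorbs those at the end. Edges labelled LF may also leave the diagonal, but
  -- only loops are ever inspected.
  epsF : Fin (3 + n) → Form 1 (4 + n) 2 0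
  epsF L< = edgeF L< zero (suc zero)
  epsF LI = edgeF LI zero (suc zero)
  epsF LF = exF (andF (reachεF (suc zero) zero) (edgeF LF zero zero))
  epsF (L₃ a) = exF (andF (reachεF (suc zero) zero) (edgeF (L₄ a) zero (suc (suc zero))))

  module _ (h : Graph 1 (4 + n)) where
    private
      h₁ = relabel epsF h
      Eε : Fin (nv h) → Fin (nv h) → Set
      Eε x y = edge h x Lε y ≡ true

      reachε-elim : ∀ {ρ x y} → sem h (reachεF x y) ρ e0 → Star Eε (ρ x) (ρ y)
      reachε-elim {ρ} {x} {y} s with lfp-elim {g = h} {ρ = ρ} {η = e0} {start = eqF zero (suc x)} {eqF zero (suc y)}
          {edgeF Lε (suc zero) zero}
        {A = _≡ ρ x} {B = _≡ ρ y} {E = Eε} (λ _ → id , id) (λ _ → id , id) (λ _ → id , id) s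
      ... | _ , _ , refl , r , refl = r

      reachε-intro : ∀ {ρ x y} → Star Eε (ρ x) (ρ y) → sem h (reachεF x y) ρ e0
      reachε-intro {ρ} {x} {y} r = lfp-intro {g = h} {ρ = ρ} {η = e0} {start = eqF zero (suc x)} {eqF zero (suc y)}
          {edgeF Lε (suc zero) zero}
        {A = _≡ ρ x} {B = _≡ ρ y} {E = Eε} (λ _ → id , id) (λ _ → id , id) (λ _ → id , id) refl r refl

      final→ : ∀ x → edge h₁ x LF x ≡ true → ∃[ z ] (Star Eε x z × edge h z LF z ≡ true)
      final→ x e = let z , r , f = relabel-elim epsF h x LF x e in z , reachε-elim {z ∷ᶠ e2 x x} {suc zero} {zero} r , f

      final← : ∀ x {z} → Star Eε x z → edge h z LF z ≡ true → edge h₁ x LF x ≡ true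
      final← x {z} r f = relabel-intro epsF h x LF x (z , reachε-intro {z ∷ᶠ e2 x x} {suc zero} {zero} r , f)

      letter→ : ∀ x {a y} → edge h₁ x (L₃ a) y ≡ true → ∃[ z ] (Star Eε x z × edge h z (L₄ a) y ≡ true)
      letter→ x {a} {y} e = let z , r , f = relabel-elim epsF h x (L₃ a) y e in z , reachε-elim {z ∷ᶠ e2 x y}
                                  {suc zero} {zero} r , f

      letter← : ∀ x {a y z} → Star Eε x z → edge h z (L₄ a) y ≡ true → edge h₁ x (L₃ a) y ≡ true
      letter← x {a} {y} {z} r f = relabel-intro epsF h x (L₃ a) y (z , reachε-intro {z ∷ᶠ e2 x y} {suc zero} {zero} r , f)

      R₁ : Fin (nv h) → Fin n → Fin (nv h) → Set
      R₁ x a y = edge h₁ x (L₃ a) y ≡ true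

      walk : ∀ {x z y} → EWalk h x z y → edge h y LF y ≡ true → ∃[ y' ] (Walk R₁ x z y' × edge h₁ y' LF y' ≡ true)
      walk {x} [] f = x , [] , final← x ε f
      walk {x} (eps e w) f with walk w f
      ... | y , [] , f' = let _ , r , g = final→ y f' in x , [] , final← x (e ◅ r) g
      ... | y , s ∷ w' , f' = let _ , r , g = letter→ _ s in y , letter← _ (e ◅ r) g ∷ w' , f'
      walk (e ∷ w) f = let y , w' , f' = walk w f in y , letter← _ ε e ∷ w' , f'

      prepend : ∀ {x y z e} → Star Eε x y → EWalk h y z e → EWalk h x z e
      prepend ε w = w
      prepend (e ◅ r) w = eps e (prepend r w)

      unwalk : ∀ {x z y y'} → Walk R₁ x z y → EWalk h y [] y' → EWalk h x z y'
      unwalk [] v = v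
      unwalk (s ∷ w) v = let _ , r , g = letter→ _ s in prepend r (g ∷ unwalk w v)

    eps-accept : ∀ {z} → Accept h z → Accept₃ h₁ z
    eps-accept (x , y , i , w , f) = let y' , w' , f' = walk w f in
      x , y' , relabel-intro epsF h x LI x i , w' , f'

    accept-eps : ∀ {z} → Accept₃ h₁ z → Accept h z
    accept-eps (x , y , i , w , f) = let _ , r , g = final→ y f in
      x , _ , relabel-elim epsF h x LI x i , unwalk w (prepend r []) , g

-- The least set that carries an accepting walk

module _ {n : ℕ} where
  anyLetter₃ : ∀ {i j} → Fin i → Fin i → Form 1 (3 + n) i j
  anyLetter₃ x y = bigOr λ a → edgeF (L₃ a) x y

  -- `suc X` steps over the set variable bound by `lfpF`.
  okStart okTarget : ∀ {i j} → Fin j → Form 1 (3 + n) (suc i) (suc j)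
  okStart X = andF (edgeF LI zero zero) (memF zero (suc X))
  okTarget X = edgeF LF zero zero
  okStep : ∀ {i j} → Fin j → Form 1 (3 + n) (suc (suc i)) (suc j)
  okStep X = andF (anyLetter₃ (suc zero) zero) (memF zero (suc X))

  okF : ∀ {i j} → Fin j → Form 1 (3 + n) i j
  okF X = lfpF (okStart X) (okStep X) (okTarget X)

  -- Set variable 1 is the candidate for the least set and set variable 0 its competitor; together
  -- these formulas express `LexLe`.
  inOnlyF beforeF : ∀ {i} → Form 1 (3 + n) (suc i) 2
  inOnlyF = andF (memF zero (suc zero)) (notF (memF zero zero))
  beforeF = exF (andF (edgeF L< zero (suc zero)) (andF (notF (memF zero (suc zero))) (memF zero zero)))

  lexF : ∀ {i} → Form 1 (3 + n) i 2
  lexF = allF (inOnlyF ⇒F beforeF)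

  leastF : ∀ {i} → Form 1 (3 + n) i 1
  leastF = andF (okF zero) (allSF (okF zero ⇒F lexF))

  -- Keeps the subgraph induced by the least set. The order label is dropped, having served its
  -- purpose, which shifts the remaining labels by one.
  pruneT : MSOT 1 (3 + n) 1 (2 + n)
  pruneT = record
    { φdom = exSF (okF zero)
    ; nc = 1
    ; φnode = λ _ _ → exSF (andF leastF (memF zero zero))
    ; φedge = λ _ _ γ → edgeF (suc γ) zero (suc zero)
    }

  Adj₃ : (h : Graph 1 (3 + n)) → Fin (nv h) → Fin (nv h) → Set
  Adj₃ h x y = ∃[ a ] edge h x (L₃ a) y ≡ true

  Adj₂ : (h : Graph 1 (2 + n)) → Fin (nv h) → Fin (nv h) → Set
  Adj₂ h x y = ∃[ a ] edge h x (K₂ a) y ≡ true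

  Ok : (h : Graph 1 (3 + n)) → (Fin (nv h) → Bool) → Set
  Ok h S = ∃[ x ] ∃[ y ] ((edge h x LI x ≡ true × S x ≡ true) ×
    Star (λ p q → Adj₃ h p q × S q ≡ true) x y × edge h y LF y ≡ true)

  Reached : (h : Graph 1 (2 + n)) → Set
  Reached h = ∃[ x ] ∃[ y ] (edge h x KI x ≡ true × Star (Adj₂ h) x y × edge h y KF y ≡ true)

  ReachedAvoiding : (h : Graph 1 (2 + n)) → Fin (nv h) → Set
  ReachedAvoiding h v = ∃[ x ] ∃[ y ] ((edge h x KI x ≡ true × x ≢ v) ×
    Star (λ p q → Adj₂ h p q × q ≢ v) x y × edge h y KF y ≡ true)

  -- What remains of minimality after the order is gone: accepting walks exist, and each of them
  -- meets every vertex.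
  Critical : Graph 1 (2 + n) → Set
  Critical h = Reached h × (∀ v → ¬ ReachedAvoiding h v)

  module _ (h : Graph 1 (3 + n)) where
    private
      V = Fin (nv h)

    module _ {i j : ℕ} {X : Fin j} {ρ : Fin i → V} {η : Fin j → V → Bool} where
      private
        step : ∀ Z {x y} → (sem h (okStep X) (y ∷ᶠ (x ∷ᶠ ρ)) (Z ∷ᶠ η) → Adj₃ h x y × η X y ≡ true) ×
                            (Adj₃ h x y × η X y ≡ true → sem h (okStep X) (y ∷ᶠ (x ∷ᶠ ρ)) (Z ∷ᶠ η))
        step Z {x} {y} =
          (λ (s , m) → bigOr-elim {g = h} {y ∷ᶠ (x ∷ᶠ ρ)} {Z ∷ᶠ η} (λ a → edgeF (L₃ a) (suc zero) zero) s , m) ,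
          (λ ((a , e) , m) → bigOr-intro {g = h} {y ∷ᶠ (x ∷ᶠ ρ)} {Z ∷ᶠ η} (λ a → edgeF (L₃ a) (suc zero) zero) a e , m)

      ok-elim : sem h (okF X) ρ η → Ok h (η X)
      ok-elim = lfp-elim {g = h} {ρ} {η} {okStart X} {okTarget X} {okStep X}
                  (λ _ → id , id) step (λ _ → id , id)

      ok-intro : Ok h (η X) → sem h (okF X) ρ η
      ok-intro (x , y , a , r , b) = lfp-intro {g = h} {ρ} {η} {okStart X} {okTarget X} {okStep X}
                  (λ _ → id , id) step (λ _ → id , id) a r b

    Ok-ext : ∀ {S S'} → S ≗ S' → Ok h S → Ok h S'
    Ok-ext e (x , y , (i , s) , r , f) = x , y , (i , trans (≡sym (e x)) s) ,
      gmap id (λ (a , s) → a , trans (≡sym (e _)) s) r , f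

    Least : (V → Bool) → Set
    Least S = Ok h S × (∀ S' → Ok h S' → LexLe S S')

    module _ (ord : ∀ {x y} → edge h x L< y ≡ true → toℕ x < toℕ y)
             (ord⁻ : ∀ {x y} → toℕ x < toℕ y → edge h x L< y ≡ true) where

      least-elim : ∀ {i} {ρ : Fin i → V} {S} → sem h leastF ρ (e1 S) → Least S
      least-elim {ρ = ρ} {S} (o , m) = ok-elim {X = zero} {ρ} {e1 S} o , λ S' o' x c →
        let y , l , c' = ⇒F-elim {g = h} {x ∷ᶠ ρ} {e2 S' S} inOnlyF beforeF
              (⇒F-elim {g = h} {ρ} {e2 S' S} (okF zero) lexF (m S') (ok-intro {X = zero} {ρ} {e2 S' S} o') x) c
        in y , ord l , c'

      least-intro : ∀ {i} {ρ : Fin i → V} {S} → Least S → sem h leastF ρ (e1 S)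
      least-intro {ρ = ρ} {S} (o , m) = ok-intro {X = zero} {ρ} {e1 S} o , λ S' →
        ⇒F-intro {g = h} {ρ} {e2 S' S} (okF zero) lexF λ o' x →
        ⇒F-intro {g = h} {x ∷ᶠ ρ} {e2 S' S} inOnlyF beforeF λ c →
        let y , l , c' = m S' (ok-elim {X = zero} {ρ} {e2 S' S} o') x c in y , ord⁻ l , c'

      least-unique : ∀ {S S'} → Least S → Least S' → S ≗ S'
      least-unique (o , m) (o' , m') = LexLe-antisym (m _ o') (m' _ o)

      exS-e1 : ∀ {i} (φ : Form 1 (3 + n) i 1) {ρ : Fin i → V} → sem h (exSF φ) ρ e0 → ∃[ S ] sem h φ ρ (e1 S)
      exS-e1 φ (S , s) = S , s

      module _ {h₂} (I : Img pruneT h h₂) {S₀ : V → Bool} (l₀ : Least S₀) where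
        open Img I
        private
          f₁ : Fin (nv h₂) → V
          f₁ v = proj₁ (f v)
          inj₁′ : ∀ {v v'} → f₁ v ≡ f₁ v' → v ≡ v'
          inj₁′ e = inj (cong₂ _,_ e (fin1 _ _))
          member : ∀ v → S₀ (f₁ v) ≡ true
          member v = let S , l , m = node v in trans (least-unique l₀ (least-elim {ρ = e1 (f₁ v)} l) (f₁ v)) m
          preimage : ∀ u → S₀ u ≡ true → ∃[ v ] f₁ v ≡ u
          preimage u s = let v , e = surj u zero (S₀ , least-intro {ρ = e1 u} l₀ , s) in v , cong proj₁ e
          lift : ∀ x {u u'} → f₁ x ≡ u → Star (λ p q → Adj₃ h p q × S₀ q ≡ true) u u' →
                 ∃[ y ] (f₁ y ≡ u' × Star (Adj₂ h₂) x y)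
          lift x e ε = x , e , ε
          lift x refl (_◅_ {j = u} ((a , e) , s) r) =
            let y , p = preimage u s ; y' , q , t = lift y p r
            in y' , q , (a , edge← (subst (λ u → edge h (f₁ x) (L₃ a) u ≡ true) (≡sym p) e)) ◅ t

        least-reached : Reached h₂
        least-reached =
          let x , y , (i , s) , r , e = proj₁ l₀ ; x' , p = preimage x s ; y' , q , t = lift x' p r
          in x' , y' , edge← (subst (λ u → edge h u LI u ≡ true) (≡sym p) i) , t ,
             edge← (subst (λ u → edge h u LF u ≡ true) (≡sym q) e)

        module _ (v : Fin (nv h₂)) where
          private
            S₁ : V → Bool
            S₁ u = S₀ u ∧ not ⌊ u Fin.≟ f₁ v ⌋
            out : S₁ (f₁ v) ≡ true → ⊥
            out t = not-true (proj₂ (∧-true {S₀ (f₁ v)} t)) (⌊⌋-intro (f₁ v Fin.≟ f₁ v) refl)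
            into : ∀ {w} → w ≢ v → S₁ (f₁ w) ≡ true
            into {w} n = ∧-intro (member w) (not-intro λ t → n (inj₁′ (⌊⌋-true (f₁ w Fin.≟ f₁ v) t)))

          -- If an accepting walk avoided `v`, then `S₁`, which is `S₀` without `v`, would still be
          -- admissible. Comparing `S₀` with it at `v` would produce an element of `S₁` outside
          -- `S₀`.
          least-critical : ¬ ReachedAvoiding h₂ v
          least-critical (x , y , (i , x≢) , r , e) =
            let y , _ , a , b = proj₂ l₀ S₁ (f₁ x , f₁ y , (edge→ i , into x≢) ,
                                  gmap f₁ (λ ((a , e) , n) → (a , edge→ e) , into n) r , edge→ e) (f₁ v) (member v , out)
            in a (proj₁ (∧-true b))

      prune-critical : ∀ {h₂} → Img pruneT h h₂ → Critical h₂
      prune-critical {h₂} I = let S₀ , l₀ = least-set ok? Ok-ext some in least-reached I {S₀} l₀ , least-critical I {S₀} l₀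
        where
        ok? : ∀ S → Dec (Ok h S)
        ok? S = map′ (ok-elim {X = zero} {e0} {e1 S}) (ok-intro {X = zero} {e0} {e1 S}) (sem? (okF zero) e0 (e1 S))
        some : ∃ (Ok h)
        some = let S , s = exS-e1 (okF zero) {e0} (Img.dom I) in S , ok-elim {X = zero} {e0} {e1 S} s

-- Reading a string off a critical graph

module _ {n : ℕ} where
  anyLetter₂ : ∀ {i j} → Fin i → Fin i → Form 1 (2 + n) i j
  anyLetter₂ x y = bigOr λ a → edgeF (K₂ a) x y

  avoidStart avoidTarget : Form 1 (2 + n) 3 1
  avoidStart = andF (edgeF KI zero zero) (notF (eqF zero (suc zero)))
  avoidTarget = eqF zero (suc (suc zero))
  avoidStep : Form 1 (2 + n) 4 1
  avoidStep = andF (anyLetter₂ (suc zero) zero) (notF (eqF zero (suc (suc zero))))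

  -- Variable 1 is reached from an initial node without visiting variable 0.
  avoidF : Form 1 (2 + n) 2 0
  avoidF = lfpF avoidStart avoidStep avoidTarget

  -- Two vertices may be joined by edges with several letters. Keeping the smallest one gives each
  -- step a single letter.
  smallerF : Fin n → Form 1 (2 + n) 2 0
  smallerF a = bigOr λ b → guardF ⌊ toℕ b <? toℕ a ⌋ (edgeF (K₂ b) zero (suc zero))

  nextF : Fin n → Form 1 (2 + n) 2 0
  nextF a = andF (andF (edgeF (K₂ a) zero (suc zero)) (notF (smallerF a))) (andF (notF (eqF zero (suc zero))) (notF avoidF))

  module _ (h : Graph 1 (2 + n)) where
    private
      V = Fin (nv h)

    FirstEdge : V → Fin n → V → Set
    FirstEdge x a y = edge h x (K₂ a) y ≡ true × (∀ b → toℕ b < toℕ a → ¬ edge h x (K₂ b) y ≡ true)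

    Avoid : V → V → Set
    Avoid v y = ∃[ x ] ((edge h x KI x ≡ true × x ≢ v) × Star (λ p q → Adj₂ h p q × q ≢ v) x y)

    Next : V → Fin n → V → Set
    Next x a y = FirstEdge x a y × x ≢ y × ¬ Avoid x y

    private
      step : ∀ {u v} Z {x y} → (sem h avoidStep (y ∷ᶠ (x ∷ᶠ e2 u v)) (e1 Z) → Adj₂ h x y × y ≢ u) ×
                          (Adj₂ h x y × y ≢ u → sem h avoidStep (y ∷ᶠ (x ∷ᶠ e2 u v)) (e1 Z))
      step {u} {v} Z {x} {y} =
        (λ (s , m) → bigOr-elim {g = h} {y ∷ᶠ (x ∷ᶠ e2 u v)} {e1 Z} (λ a → edgeF (K₂ a) (suc zero) zero) s , m) ,
        (λ ((a , e) , m) → bigOr-intro {g = h} {y ∷ᶠ (x ∷ᶠ e2 u v)} {e1 Z} (λ a → edgeF (K₂ a) (suc zero) zero) a e , m)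

      avoid-elim : ∀ {u v} → sem h avoidF (e2 u v) e0 → Avoid u v
      avoid-elim {u} {v} s =
        let x , y , a , r , eq = lfp-elim {g = h} {e2 u v} {e0} {avoidStart} {avoidTarget} {avoidStep} {B = _≡ v}
                                   (λ _ → id , id) step (λ _ → id , id) s
        in x , a , subst (Star _ x) eq r

      avoid-intro : ∀ {u v} → Avoid u v → sem h avoidF (e2 u v) e0
      avoid-intro {u} {v} (x , a , r) = lfp-intro {g = h} {e2 u v} {e0} {avoidStart} {avoidTarget} {avoidStep} {B = _≡ v}
                                   (λ _ → id , id) step (λ _ → id , id) a r refl

    next-elim : ∀ {x a y} → edge (relabel nextF h) x a y ≡ true → Next x a y
    next-elim {x} {a} {y} e = let (p , q) , r , s = relabel-elim nextF h x a y e in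
      (p , λ b l t → q (bigOr-intro {g = h} {e2 x y} {e0} (λ b → guardF ⌊ toℕ b <? toℕ a ⌋ (edgeF (K₂ b) zero (suc zero))) b
          (guardF-intro {g = h} {e2 x y} {e0} (edgeF (K₂ b) zero (suc zero)) (⌊⌋-intro (toℕ b <? toℕ a) l) t))) ,
      r , λ t → s (avoid-intro t)

    next-intro : ∀ {x a y} → Next x a y → edge (relabel nextF h) x a y ≡ true
    next-intro {x} {a} {y} ((p , q) , r , s) = relabel-intro nextF h x a y
      ((p , λ t → let b , t' = bigOr-elim {g = h} {e2 x y} {e0}
                        (λ b → guardF ⌊ toℕ b <? toℕ a ⌋ (edgeF (K₂ b) zero (suc zero))) t
                      l , t'' = guardF-elim {g = h} {e2 x y} {e0} _ (edgeF (K₂ b) zero (suc zero)) t'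
                  in q b (⌊⌋-true (toℕ b <? toℕ a) l) t'') ,
       r , λ t → s (avoid-elim t))

    private
      first-walk : ∀ {x y} → Star (Adj₂ h) x y → ∃[ z ] Walk FirstEdge x z y
      first-walk ε = [] , []
      first-walk (s ◅ t) = let a , p = least (λ a → edge h _ (K₂ a) _ Bool.≟ true) s ; z , w = first-walk t in a ∷ z , p ∷ w

    -- In a critical graph a simple accepting walk visits all vertices, and its steps are recognised
    -- as the edges x → y such that y cannot be reached without visiting x.
    module _ {r e z} (ir : edge h r KI r ≡ true) (fe : edge h e KF e ≡ true) (crit : ∀ v → ¬ ReachedAvoiding h v)
             (w : Walk FirstEdge r z e) (simple : Simple w) where
     private
      p : ℕ → V
      p = at w
      N = length z
      seg : ∀ {v} d i j → i + d ≡ j → j ≤ N → (∀ k → i < k → k ≤ j → p k ≢ v) →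
            Star (λ x y → Adj₂ h x y × y ≢ v) (p i) (p j)
      seg zero i j eq j≤ n with refl ← trans (≡sym (ℕ.+-identityʳ i)) eq = ε
      seg (suc d) i j eq j≤ n =
        let eq' = trans (≡sym (ℕ.+-suc i d)) eq
            i<j = ℕ.≤-trans (ℕ.m≤m+n (suc i) d) (ℕ.≤-reflexive eq')
            b , q = nth-< z (ℕ.≤-trans i<j j≤)
        in ((b , proj₁ (at-step w i q)) , n (suc i) ℕ.≤-refl i<j) ◅
           seg d (suc i) j eq' j≤ (λ k l → n k (ℕ.<-trans (ℕ.n<1+n i) l))
      segment : ∀ {v} i j → i ≤ j → j ≤ N → (∀ k → i < k → k ≤ j → p k ≢ v) →
                Star (λ x y → Adj₂ h x y × y ≢ v) (p i) (p j)
      segment i j i≤ = seg (j ∸ i) i j (ℕ.m+[n∸m]≡n i≤)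
      final : edge h (p N) KF (p N) ≡ true
      final = subst (λ v → edge h v KF v ≡ true) (≡sym (at-end w)) fe
      cover : ∀ v → ∃[ k ] (k ≤ N × p k ≡ v)
      cover v with ℕ.anyUpTo? (λ k → p k Fin.≟ v) (suc N)
      ... | yes (k , s≤s k≤ , eq) = k , k≤ , eq
      -- A vertex off the walk would be avoided by it.
      ... | no n = ⊥-elim (crit v (r , p N , (ir , λ eq → n (0 , s≤s z≤n , eq)) ,
                     segment 0 N z≤n ℕ.≤-refl (λ k _ k≤ eq → n (k , s≤s k≤ , eq)) , final))
      distinct : ∀ {i j} → i ≤ N → j ≤ N → i < j → p j ≢ p i
      distinct i≤ j≤ l eq = ℕ.<-irrefl (≡sym (simple j≤ i≤ eq)) l
      consecutive : ∀ i {a} → nth z i ≡ just a → edge (relabel nextF h) (p i) a (p (suc i)) ≡ true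
      consecutive i q = next-intro (at-step w i q ,
          (λ eq → distinct (ℕ.<⇒≤ i<) i< ℕ.≤-refl (≡sym eq)) ,
          -- A route to the next vertex that avoids `p i`, continued along the rest of the simple
          -- walk, would be an accepting walk avoiding `p i`.
          λ (x , a , t) → crit (p i) (x , p N , a ,
            t ◅◅ segment (suc i) N i< ℕ.≤-refl (λ k l k≤ → distinct (ℕ.<⇒≤ i<) k≤ (ℕ.<-trans (ℕ.n<1+n i) l)) , final))
        where
        i< = nth-bound z q
      unique : ∀ {i a} j → i ≤ N → j ≤ N → Next (p i) a (p j) → nth z i ≡ just a × j ≡ suc i
      unique {i} {a} j i≤ j≤ ((x , m) , ≢ , ¬av) with ℕ.<-cmp j i
      ... | tri≈ _ refl _ = ⊥-elim (≢ refl)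
      -- Backward edge: the initial segment of the walk reaches `p j` before `p i`.
      ... | tri< l _ _ = ⊥-elim (¬av (r , (ir , λ eq → distinct z≤n i≤ (ℕ.≤-trans (s≤s z≤n) l) (≡sym eq)) ,
              segment 0 j z≤n j≤ (λ k _ k≤ eq → distinct (ℕ.≤-trans k≤ j≤) i≤ (ℕ.≤-<-trans k≤ l) (≡sym eq))))
      ... | tri> _ _ l with ℕ.m≤n⇒m<n∨m≡n l
      -- Shortcut: taking this edge instead of the segment from i to j gives an accepting walk that
      -- avoids `p (suc i)`.
      ... | inj₁ l' = ⊥-elim (crit (p (suc i)) (r , p N ,
              (ir , λ eq → distinct z≤n i+1≤ (s≤s z≤n) (≡sym eq)) ,
              segment 0 i z≤n i≤ (λ k _ k≤ eq → distinct (ℕ.≤-trans k≤ i≤) i+1≤ (s≤s k≤) (≡sym eq)) ◅◅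
              (((a , x) , distinct i+1≤ j≤ l') ◅
              segment j N j≤ ℕ.≤-refl (λ k l'' k≤ → distinct i+1≤ k≤ (ℕ.<-trans l' l''))) , final))
        where
        i+1≤ = ℕ.≤-trans l j≤
      ... | inj₂ refl = let b , q = nth-< z j≤ in trans q (cong just (≡sym (first≡ (x , m) (at-step w i q)))) , refl
        where
        first≡ : ∀ {x y a b} → FirstEdge x a y → FirstEdge x b y → a ≡ b
        first≡ {a = a} {b} (x , m) (y , m') with ℕ.<-cmp (toℕ a) (toℕ b)
        ... | tri< a<b _ _ = ⊥-elim (m' a a<b x)
        ... | tri> _ _ b<a = ⊥-elim (m b b<a y)
        ... | tri≈ _ a≡b _ = Fin.toℕ-injective a≡b

     simple-string : egr z ≅ relabel nextF h
     simple-string = walk-≅ (relabel nextF h) w consecutive simple cover λ {i} {a} {v} i≤ t →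
       let j , j≤ , eq = cover v
           q , q' = unique j i≤ j≤ (subst (Next (p i) a) (≡sym eq) (next-elim t))
       in q , trans (≡sym eq) (cong p q')

    critical-string : Critical h → ∃[ z ] (egr z ≅ relabel nextF h ×
      ∃[ x ] ∃[ y ] (edge h x KI x ≡ true × Walk FirstEdge x z y × edge h y KF y ≡ true))
    critical-string ((r , e , ir , st , fe) , crit) =
      let z , w , simple = simplify Fin._≟_ (proj₂ (first-walk st))
      in z , simple-string ir fe crit w simple , r , e , ir , w , fe

module _ {n : ℕ} where
  uniT : MSOT 1 (4 + n) 1 n
  uniT = compT (compT (relabelT epsF) pruneT) (relabelT nextF)

  Ok-accept : ∀ (h : Graph 1 (3 + n)) {z} → Accept₃ h z → Ok h (λ _ → true)
  Ok-accept h (x , y , i , w , f) = x , y , (i , refl) , star w , f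
    where
    star : ∀ {x z y} → Walk (λ x a y → edge h x (L₃ a) y ≡ true) x z y → Star (λ p q → Adj₃ h p q × true ≡ true) x y
    star [] = ε
    star (e ∷ w) = ((_ , e) , refl) ◅ star w

  module _ (h : Graph 1 (4 + n))
           (ord : ∀ {x y} → edge h x L< y ≡ true → toℕ x < toℕ y)
           (ord⁻ : ∀ {x y} → toℕ x < toℕ y → edge h x L< y ≡ true) where
    private
      h₁ = relabel epsF h

      module _ {h₂} (I : Img pruneT h₁ h₂) where
        open Img I
        lift-walk : ∀ {x z y} → Walk (FirstEdge h₂) x z y →
                    Walk (λ x a y → edge h₁ x (L₃ a) y ≡ true) (proj₁ (f x)) z (proj₁ (f y))
        lift-walk [] = []
        lift-walk ((e , _) ∷ w) = edge→ e ∷ lift-walk w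

        uniq : Σ (Str n) λ z → Img uniT h (egr z) × Accept h z
        uniq = let z , i , r , e , ir , w , fe = critical-string h₂
                     (prune-critical h₁ (λ {x} {y} s → ord (relabel-elim epsF h x L< y s))
                                        (λ {x} {y} l → relabel-intro epsF h x L< y (ord⁻ l)) {h₂} I)
               in z , Img-comp (compT (relabelT epsF) pruneT) (relabelT nextF)
                        (Img-comp (relabelT epsF) pruneT (Img-relabel epsF h) I)
                        (Img-≅ʳ (relabelT nextF) h₂ (Img-relabel nextF h₂) (≅-sym {g = egr z} {relabel nextF h₂} i)) ,
                  accept-eps h (proj₁ (f r) , proj₁ (f e) , edge→ ir , lift-walk w , edge→ fe)

    uniT-accept : sem h (MSOT.φdom uniT) e0 e0 → ∃[ z ] (Img uniT h (egr z) × Accept h z)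
    uniT-accept d =
      let d' , _ = dom-comp (compT (relabelT epsF) pruneT) (relabelT nextF) {h} d
          _ , d₁ = dom-comp (relabelT epsF) pruneT {h} d'
      in uniq {image pruneT h₁} (Img-image pruneT h₁ (d₁ (Img-relabel epsF h)))

    accept-uniT : ∀ {z} → Accept h z → sem h (MSOT.φdom uniT) e0 e0
    accept-uniT a = comp-dom (compT (relabelT epsF) pruneT) (relabelT nextF)
        (Img-comp (relabelT epsF) pruneT (Img-relabel epsF h) (Img-image pruneT h₁ d))
        (Img.dom (Img-relabel nextF (image pruneT h₁)))
      where
      d : sem h₁ (MSOT.φdom pruneT) e0 e0
      d = (λ _ → true) , sem-cong (okF zero) {ρ = e0} {e0} {e1 (λ _ → true)} (λ _ → refl) (λ { zero u → refl })
            (ok-intro h₁ {X = zero} {e0} {e1 (λ _ → true)} (Ok-accept h₁ (eps-accept h a)))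

-- Two-way machines

symOf : ∀ {n} → Fin (2 + n) → TSym n
symOf zero = lend
symOf (suc zero) = rend
symOf (suc (suc a)) = sym a

symIx : ∀ {n} → TSym n → Fin (2 + n)
symIx lend = zero
symIx rend = suc zero
symIx (sym a) = suc (suc a)

symOf-Ix : ∀ {n} (τ : TSym n) → symOf (symIx τ) ≡ τ
symOf-Ix lend = refl
symOf-Ix rend = refl
symOf-Ix (sym a) = refl

moveOf : Fin 3 → Move
moveOf zero = left
moveOf (suc zero) = stay
moveOf (suc (suc zero)) = right

moveIx : Move → Fin 3
moveIx left = zero
moveIx stay = suc zero
moveIx right = suc (suc zero)

moveOf-Ix : ∀ m → moveOf (moveIx m) ≡ m
moveOf-Ix left = refl
moveOf-Ix stay = refl
moveOf-Ix right = refl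

emit : ∀ {n} → Maybe (Fin n) → Str n → Str n
emit nothing z = z
emit (just a) z = a ∷ z

-- Two-way transducers whose transitions test the scanned symbol positively and emit at most one letter.
record Mach (n₁ n₂ : ℕ) : Set₁ where
  field
    State  : Set
    K      : ℕ
    index  : State ↔ Fin K
    Tr     : State → TSym n₁ → Maybe (Fin n₂) → Move → State → Set
    Tr?    : ∀ p τ o ε q → Dec (Tr p τ o ε q)
    Init Final : State → Set
    Init?  : ∀ p → Dec (Init p)
    Final? : ∀ p → Dec (Final p)

module _ {n₁ n₂ : ℕ} (M : Mach n₁ n₂) (w : Str n₁) where
  open Mach M

  data MRun : State → ℕ → Str n₂ → State → ℕ → Set where
    done : ∀ {p i} → MRun p i [] p i
    go   : ∀ {p i τ o ε q j τ' z r k} → tapeAt w i ≡ just τ → Tr p τ o ε q → move ε i ≡ just j → tapeAt w j ≡ just τ' →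
           MRun q j z r k → MRun p i (emit o z) r k

  MRel : Str n₂ → Set
  MRel z = ∃[ p ] ∃[ r ] ∃[ k ] (Init p × MRun p 0 z r k × Final r)

-- The order on configurations that MSO can express: positions are compared by reachability in the
-- word, copies by a finite case distinction.
Lex : ∀ {m k} → Fin m × Fin k → Fin m × Fin k → Set
Lex (u , c) (u' , c') = toℕ u < toℕ u' ⊎ (u ≡ u' × toℕ c < toℕ c')

Lex→combine : ∀ {m k} {p q : Fin m × Fin k} → Lex p q →
              toℕ (combine (proj₁ p) (proj₂ p)) < toℕ (combine (proj₁ q) (proj₂ q))
Lex→combine (inj₁ l) = Fin.combine-monoˡ-< _ _ l
Lex→combine {k = k} {u , c} {.u , c'} (inj₂ (refl , l))
  rewrite Fin.toℕ-combine u c | Fin.toℕ-combine u c' = ℕ.+-monoʳ-< (k * toℕ u) l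

Lex-total : ∀ {m k} (p q : Fin m × Fin k) → Lex p q ⊎ p ≡ q ⊎ Lex q p
Lex-total (u , c) (u' , c') with ℕ.<-cmp (toℕ u) (toℕ u') | ℕ.<-cmp (toℕ c) (toℕ c')
... | tri< l _ _ | _ = inj₁ (inj₁ l)
... | tri> _ _ l | _ = inj₂ (inj₂ (inj₁ l))
... | tri≈ _ e _ | tri< l _ _ = inj₁ (inj₂ (Fin.toℕ-injective e , l))
... | tri≈ _ e _ | tri≈ _ e' _ = inj₂ (inj₁ (cong₂ _,_ (Fin.toℕ-injective e) (Fin.toℕ-injective e')))
... | tri≈ _ e _ | tri> _ _ l = inj₂ (inj₂ (inj₂ (Fin.toℕ-injective (≡sym e) , l)))

module _ {ne₁ ne₂ : ℕ} (T : MSOT 1 ne₁ 1 ne₂) (g : Graph 1 ne₁) (d : sem g (MSOT.φdom T) e0 e0) where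
  open MSOT T
  open Img (Img-image T g d)
  private
    code : Fin (nv (image T g)) → Fin (nv g * nc)
    code v = combine (proj₁ (f v)) (proj₂ (f v))

    mono : ∀ {v v'} → toℕ v < toℕ v' → toℕ (code v) < toℕ (code v')
    mono {v} {v'} l = subst (λ (x , y) → toℕ x < toℕ y)
      (cong₂ _,_ (≡sym (Fin.combine-remQuot {nv g} nc _)) (≡sym (Fin.combine-remQuot {nv g} nc _))) (image-mono T g l)

  image-lex : ∀ {v v'} → toℕ v < toℕ v' → Lex (f v) (f v')
  image-lex {v} {v'} l with Lex-total (f v) (f v')
  ... | inj₁ x = x
  ... | inj₂ (inj₁ e) = ⊥-elim (ℕ.<-irrefl (cong (λ (u , c) → toℕ (combine u c)) e) (mono {v} {v'} l))
  ... | inj₂ (inj₂ x) = ⊥-elim (ℕ.<-asym (mono {v} {v'} l) (Lex→combine x))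

  lex-image : ∀ {v v'} → Lex (f v) (f v') → toℕ v < toℕ v'
  lex-image {v} {v'} x with ℕ.<-cmp (toℕ v) (toℕ v')
  ... | tri< l _ _ = l
  ... | tri≈ _ e _ = ⊥-elim (ℕ.<-irrefl (cong (toℕ ∘ code) (Fin.toℕ-injective e)) (Lex→combine x))
  ... | tri> _ _ l = ⊥-elim (ℕ.<-asym (mono {v'} {v} l) (Lex→combine x))

tapeSym-letter : ∀ {n} (w : Str n) k {a} → tapeSym w k ≡ just (sym a) → nth w k ≡ just a
tapeSym-letter [] zero ()
tapeSym-letter [] (suc k) ()
tapeSym-letter (a ∷ w) zero refl = refl
tapeSym-letter (a ∷ w) (suc k) e = tapeSym-letter w k e

letter-tapeSym : ∀ {n} (w : Str n) k {a} → nth w k ≡ just a → tapeSym w k ≡ just (sym a)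
letter-tapeSym (a ∷ w) zero refl = refl
letter-tapeSym (a ∷ w) (suc k) e = letter-tapeSym w k e

tapeSym-rend : ∀ {n} (w : Str n) k → tapeSym w k ≡ just rend → k ≡ length w
tapeSym-rend [] zero e = refl
tapeSym-rend (a ∷ w) (suc k) e = cong suc (tapeSym-rend w k e)

rend-tapeSym : ∀ {n} (w : Str n) → tapeSym w (length w) ≡ just rend
rend-tapeSym [] = refl
rend-tapeSym (a ∷ w) = rend-tapeSym w

tapeSym-lend : ∀ {n} (w : Str n) k → ¬ tapeSym w k ≡ just lend
tapeSym-lend [] zero ()
tapeSym-lend [] (suc k) ()
tapeSym-lend (a ∷ w) zero ()
tapeSym-lend (a ∷ w) (suc k) e = tapeSym-lend w k e

tapeSym-bound : ∀ {n} (w : Str n) k {τ} → tapeSym w k ≡ just τ → k < suc (length w)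
tapeSym-bound [] zero e = s≤s z≤n
tapeSym-bound (a ∷ w) zero e = s≤s z≤n
tapeSym-bound (a ∷ w) (suc k) e = s≤s (tapeSym-bound w k e)

tapeSym-total : ∀ {n} (w : Str n) (u : Fin (suc (length w))) → ∃[ τ ] tapeSym w (toℕ u) ≡ just τ
tapeSym-total [] zero = rend , refl
tapeSym-total (a ∷ w) zero = sym a , refl
tapeSym-total (a ∷ w) (suc u) = tapeSym-total w u

-- A tape position is a node of egr w with a flag: node u with flag 0 is position u + 1, whose symbol
-- labels the edge leaving u (or is the right end marker); node 0 with flag 1 is position 0.
module _ {n₁ : ℕ} where
  pattern main = zero
  pattern start = suc zero

  firstF lastF : ∀ {i j} → Fin i → Form 1 n₁ i j
  firstF x = allF (bigAnd λ a → notF (edgeF a zero (suc x)))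
  lastF x = allF (bigAnd λ a → notF (edgeF a (suc x) zero))

  scanF : TSym n₁ → Fin 2 → Form 1 n₁ 2 0
  scanF (sym a) main = exF (edgeF a (suc zero) zero)
  scanF rend main = lastF zero
  scanF lend start = trueF
  scanF _ _ = falseF

  moveF : Move → Fin 2 → Fin 2 → Form 1 n₁ 2 0
  moveF stay main main = eqF zero (suc zero)
  moveF stay start start = eqF zero (suc zero)
  moveF right main main = bigOr λ a → edgeF a zero (suc zero)
  -- Tape positions 0 and 1 share node 0, so only the flag changes. The same holds for the move
  -- back.
  moveF right start main = eqF zero (suc zero)
  moveF left main main = bigOr λ a → edgeF a (suc zero) zero
  moveF left main start = andF (firstF zero) (eqF zero (suc zero))
  moveF _ _ _ = falseF

  module _ (w : Str n₁) where
    private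
      V = Fin (suc (length w))

    pos : V → Fin 2 → ℕ
    pos u main = suc (toℕ u)
    pos u start = 0

    -- Every pair is a node of the configuration graph, including flag 1 at nodes other than 0,
    -- which stands for no position. Moves from valid configurations lead only to valid ones.
    Valid : V → Fin 2 → Set
    Valid u main = ⊤
    Valid u start = u ≡ zero

    first-elim : ∀ {i j x} {ρ : Fin i → V} {η : Fin j → V → Bool} → sem (egr w) (firstF x) ρ η → ρ x ≡ zero
    first-elim {x = x} {ρ} {η} s with ρ x in eq
    ... | zero = refl
    ... | suc y = let a , e = egr-pred w y in
      ⊥-elim (bigAnd-elim {g = egr w} {inject₁ y ∷ᶠ ρ} {η} (λ a → notF (edgeF a zero (suc x))) (s (inject₁ y)) a
               (subst (λ v → edge (egr w) (inject₁ y) a v ≡ true) (≡sym eq) e))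

    first-intro : ∀ {i j x} {ρ : Fin i → V} {η : Fin j → V → Bool} → ρ x ≡ zero → sem (egr w) (firstF x) ρ η
    first-intro {x = x} {ρ} {η} eq y = bigAnd-intro {g = egr w} {y ∷ᶠ ρ} {η} (λ a → notF (edgeF a zero (suc x))) λ a e →
      contradiction (trans (≡sym (cong toℕ eq)) (proj₁ (edge-egr w {y} {a} {ρ x} e))) λ ()

    last-elim : ∀ {i j x} {ρ : Fin i → V} {η : Fin j → V → Bool} → sem (egr w) (lastF x) ρ η →
                tapeSym w (toℕ (ρ x)) ≡ just rend
    last-elim {x = x} {ρ} {η} s with tapeSym-total w (ρ x)
    ... | rend , e = e
    ... | lend , e = ⊥-elim (tapeSym-lend w _ e)
    ... | sym a , e = ⊥-elim (bigAnd-elim {g = egr w} {y ∷ᶠ ρ} {η} (λ a → notF (edgeF a (suc x) zero)) (s y) a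
                        (egr-edge w {ρ x} {a} {y} (Fin.toℕ-fromℕ< l) q))
      where
      q = tapeSym-letter w _ e
      l = s≤s (nth-bound w q)
      y = fromℕ< l

    last-intro : ∀ {i j x} {ρ : Fin i → V} {η : Fin j → V → Bool} → tapeSym w (toℕ (ρ x)) ≡ just rend →
                 sem (egr w) (lastF x) ρ η
    last-intro {x = x} {ρ} {η} eq y = bigAnd-intro {g = egr w} {y ∷ᶠ ρ} {η} (λ a → notF (edgeF a (suc x) zero)) λ a e →
      contradiction (trans (≡sym eq) (letter-tapeSym w _ (proj₂ (edge-egr w {ρ x} {a} {y} e)))) λ ()

    scan-elim : ∀ τ {u v} b → sem (egr w) (scanF τ b) (e2 u v) e0 → tapeAt w (pos u b) ≡ just τ
    scan-elim (sym a) {u} {v} main (y , e) = trans (tapeAt≡ w (toℕ u))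
        (letter-tapeSym w _ (proj₂ (edge-egr w {u} {a} {y} e)))
    scan-elim rend {u} {v} main s = trans (tapeAt≡ w (toℕ u)) (last-elim {x = zero} {e2 u v} {e0} s)
    scan-elim lend start s = refl
    scan-elim lend main (_ , n) = ⊥-elim (n refl)
    scan-elim rend start (_ , n) = ⊥-elim (n refl)
    scan-elim (sym a) start (_ , n) = ⊥-elim (n refl)

    scan-intro : ∀ τ {u v} b → tapeAt w (pos u b) ≡ just τ → sem (egr w) (scanF τ b) (e2 u v) e0
    scan-intro (sym a) {u} main e = let q = tapeSym-letter w _ (trans (≡sym (tapeAt≡ w (toℕ u))) e) in next u q
      where
      next : ∀ u → nth w (toℕ u) ≡ just a → ∃[ y ] edge (egr w) u a y ≡ true
      next u q = let l = s≤s (nth-bound w q) in fromℕ< l , egr-edge w {u} {a} {fromℕ< l} (Fin.toℕ-fromℕ< l) q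
    scan-intro rend {u} {v} main e = last-intro {x = zero} {e2 u v} {e0} (trans (≡sym (tapeAt≡ w (toℕ u))) e)
    scan-intro lend {u} main e = ⊥-elim (tapeSym-lend w _ (trans (≡sym (tapeAt≡ w (toℕ u))) e))
    scan-intro lend start e (_ , n) = n refl
    scan-intro rend start ()
    scan-intro (sym a) start ()

    move-elim : ∀ ε {u v} b b' → Valid u b → sem (egr w) (moveF ε b b') (e2 u v) e0 →
                move ε (pos u b) ≡ just (pos v b') × Valid v b'
    move-elim stay main main _ refl = refl , tt
    move-elim stay start start refl refl = refl , refl
    move-elim right {u} {v} main main _ s = let a , e = bigOr-elim {g = egr w} {e2 u v} {e0}
                                                  (λ a → edgeF a zero (suc zero)) s in
      cong (just ∘ suc) (≡sym (proj₁ (edge-egr w {u} {a} {v} e))) , tt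
    move-elim right start main refl refl = refl , tt
    move-elim left {u} {v} main main _ s = let a , e = bigOr-elim {g = egr w} {e2 u v} {e0}
                                                 (λ a → edgeF a (suc zero) zero) s in
      cong just (proj₁ (edge-egr w {v} {a} {u} e)) , tt
    move-elim left {u} {v} main start _ (s , eq) = let z = first-elim {x = zero} {e2 u v} {e0} s in
      cong (just ∘ toℕ) z , trans (≡sym eq) z
    move-elim stay main start _ (_ , n) = ⊥-elim (n refl)
    move-elim stay start main _ (_ , n) = ⊥-elim (n refl)
    move-elim right main start _ (_ , n) = ⊥-elim (n refl)
    move-elim right start start _ (_ , n) = ⊥-elim (n refl)
    move-elim left start main _ (_ , n) = ⊥-elim (n refl)
    move-elim left start start _ (_ , n) = ⊥-elim (n refl)

    move-intro : ∀ ε {u v} b b' → Valid u b → Valid v b' → move ε (pos u b) ≡ just (pos v b') →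
                 sem (egr w) (moveF ε b b') (e2 u v) e0
    move-intro stay main main _ _ e = Fin.toℕ-injective (ℕ.suc-injective (Maybe.just-injective e))
    move-intro stay start start refl refl e = refl
    move-intro right {u} {v} main main _ _ e = let a , x = egr-succ w {u} {v}
                                                     (≡sym (ℕ.suc-injective (Maybe.just-injective e))) in
      bigOr-intro {g = egr w} {e2 u v} {e0} (λ a → edgeF a zero (suc zero)) a x
    move-intro right {v = zero} start main refl _ e = refl
    move-intro left {u} {v} main main _ _ e = let a , x = egr-succ w {v} {u} (Maybe.just-injective e) in
      bigOr-intro {g = egr w} {e2 u v} {e0} (λ a → edgeF a (suc zero) zero) a x
    move-intro left {zero} {v} main start _ refl e = first-intro {x = zero} {e2 zero v} {e0} refl , refl
    move-intro left {suc u} main start _ refl ()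
    move-intro left start main _ _ ()
    move-intro left start start _ _ ()
    move-intro stay main start _ _ ()
    move-intro stay start main _ _ ()
    move-intro right main start _ _ ()
    move-intro right start start _ _ ()
    move-intro right {v = suc v} start main refl _ ()

    on-tape : ∀ u b → ∃[ τ ] tapeAt w (pos u b) ≡ just τ
    on-tape u start = lend , refl
    on-tape u main = let τ , e = tapeSym-total w u in τ , trans (tapeAt≡ w (toℕ u)) e

    locate : ∀ j {τ} → tapeAt w j ≡ just τ → ∃[ v ] ∃[ b ] (Valid v b × pos v b ≡ j)
    locate zero e = zero , start , refl , refl
    locate (suc j) e = let l = tapeSym-bound w j (trans (≡sym (tapeAt≡ w j)) e) in
      fromℕ< l , main , tt , cong suc (Fin.toℕ-fromℕ< l)

-- The configuration graph of a machine

module _ {n₁ n₂ : ℕ} (M : Mach n₁ n₂) where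
  open Mach M
  private
    st : Fin (K * 2) → State
    st c = Inverse.from index (proj₁ (remQuot {K} 2 c))

    flag : Fin (K * 2) → Fin 2
    flag c = proj₂ (remQuot {K} 2 c)

    cfg : State → Fin 2 → Fin (K * 2)
    cfg q b = combine (Inverse.to index q) b

    st-cfg : ∀ q b → st (cfg q b) ≡ q
    st-cfg q b = trans (cong (Inverse.from index ∘ proj₁) (Fin.remQuot-combine {K} (Inverse.to index q) b))
                       (Inverse.strictlyInverseʳ index q)

    flag-cfg : ∀ q b → flag (cfg q b) ≡ b
    flag-cfg q b = cong proj₂ (Fin.remQuot-combine {K} (Inverse.to index q) b)

    act : TSym n₁ → Move → Fin (K * 2) → Fin (K * 2) → Form 1 n₁ 2 0
    act τ m c c' = andF (scanF τ (flag c)) (moveF m (flag c) (flag c'))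

    transF : Maybe (Fin n₂) → Fin (K * 2) → Fin (K * 2) → Fin (2 + n₁) → Fin 3 → Form 1 n₁ 2 0
    transF o c c' τ m = guardF ⌊ Tr? (st c) (symOf τ) o (moveOf m) (st c') ⌋ (act (symOf τ) (moveOf m) c c')

    machStepF : Maybe (Fin n₂) → Fin (K * 2) → Fin (K * 2) → Form 1 n₁ 2 0
    machStepF o c c' = bigOr λ τ → bigOr λ m → transF o c c' τ m

    edgesF : Fin (K * 2) → Fin (K * 2) → Fin (4 + n₂) → Form 1 n₁ 2 0
    edgesF c c' L< = orF (andF (reachF anyStepF zero (suc zero)) (notF (eqF zero (suc zero))))
                         (andF (eqF zero (suc zero)) (guardF ⌊ toℕ c <? toℕ c' ⌋ trueF))
    edgesF c c' LI = guardF ⌊ Init? (st c) ⌋ (guardF ⌊ flag c Fin.≟ start ⌋ (firstF zero))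
    edgesF c c' LF = guardF ⌊ Final? (st c) ⌋ trueF
    edgesF c c' Lε = machStepF nothing c c'
    edgesF c c' (L₄ a) = machStepF (just a) c c'

    label : Maybe (Fin n₂) → Fin (4 + n₂)
    label nothing = Lε
    label (just a) = L₄ a

    edges-label : ∀ o c c' → edgesF c c' (label o) ≡ machStepF o c c'
    edges-label nothing c c' = refl
    edges-label (just a) c c' = refl

    cons-label : ∀ {h : Graph 1 (4 + n₂)} {x y z e} o → edge h x (label o) y ≡ true → EWalk h y z e → EWalk h x (emit o z) e
    cons-label nothing = eps
    cons-label (just a) = _∷_

  -- The image of egr w is the configuration graph of M on w.
  machT : MSOT 1 n₁ 1 (4 + n₂)
  machT = record { φdom = trueF ; nc = K * 2 ; φnode = λ _ _ → trueF ; φedge = edgesF }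

  module _ (w : Str n₁) where
    private
      g = egr w

      step-elim : ∀ {o c c' u v} → Valid w u (flag c) → sem g (machStepF o c c') (e2 u v) e0 →
        ∃[ τ ] ∃[ m ] (tapeAt w (pos w u (flag c)) ≡ just τ × Tr (st c) τ o m (st c') ×
                       move m (pos w u (flag c)) ≡ just (pos w v (flag c')) × Valid w v (flag c'))
      step-elim {o} {c} {c'} {u} {v} ok s =
        let τ , s₁ = bigOr-elim {g = g} {e2 u v} {e0} (λ τ → bigOr (transF o c c' τ)) s
            m , s₂ = bigOr-elim {g = g} {e2 u v} {e0} (transF o c c' τ) s₁
            t , sc , mv = guardF-elim {g = g} {e2 u v} {e0} _ (act (symOf τ) (moveOf m) c c') s₂
        in symOf τ , moveOf m , scan-elim w (symOf τ) {u} {v} (flag c) sc , ⌊⌋-true (Tr? _ _ _ _ _) t ,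
           move-elim w (moveOf m) {u} {v} (flag c) (flag c') ok mv

      step-intro : ∀ {o c c' u v τ m} → Valid w u (flag c) → Valid w v (flag c') →
        tapeAt w (pos w u (flag c)) ≡ just τ → Tr (st c) τ o m (st c') →
        move m (pos w u (flag c)) ≡ just (pos w v (flag c')) → sem g (machStepF o c c') (e2 u v) e0
      step-intro {o} {c} {c'} {u} {v} {τ} {m} ok ok' sc t mv =
        bigOr-intro {g = g} {e2 u v} {e0} (λ τ → bigOr (transF o c c' τ)) (symIx τ)
          (bigOr-intro {g = g} {e2 u v} {e0} (transF o c c' (symIx τ)) (moveIx m)
            (subst₂′ (≡sym (symOf-Ix τ)) (≡sym (moveOf-Ix m))
              (guardF-intro {g = g} {e2 u v} {e0} (act τ m c c') (⌊⌋-intro (Tr? _ _ _ _ _) t)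
                (scan-intro w τ {u} {v} (flag c) sc , move-intro w m {u} {v} (flag c) (flag c') ok ok' mv))))
        where
        subst₂′ : ∀ {τ' m'} → τ ≡ τ' → m ≡ m' → sem g (guardF ⌊ Tr? (st c) τ o m (st c') ⌋ (act τ m c c')) (e2 u v) e0 →
                  sem g (guardF ⌊ Tr? (st c) τ' o m' (st c') ⌋ (act τ' m' c c')) (e2 u v) e0
        subst₂′ refl refl s = s

      true-sem : ∀ {i} {ρ : Fin i → Fin (nv g)} → sem g trueF ρ e0
      true-sem (_ , n) = n refl

    module _ {h} (I : Img machT g h) where
      open Img I
      private
        node-of : Fin (nv h) → Fin (nv g)
        node-of v = proj₁ (f v)
        P : Fin (nv h) → State
        P v = st (proj₂ (f v))
        B : Fin (nv h) → Fin 2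
        B v = flag (proj₂ (f v))
        at′ : Fin (nv h) → ℕ
        at′ v = pos w (node-of v) (B v)
        Ok′ : Fin (nv h) → Set
        Ok′ v = Valid w (node-of v) (B v)

        place : ∀ u b q → ∃[ v ] (node-of v ≡ u × B v ≡ b × P v ≡ q)
        place u b q = let v , e = surj u (cfg q b) (true-sem {ρ = e1 u}) in
          v , cong proj₁ e , trans (cong (flag ∘ proj₂) e) (flag-cfg q b) , trans (cong (st ∘ proj₂) e) (st-cfg q b)

        step→ : ∀ o {x y} → Ok′ x → edge h x (label o) y ≡ true → ∀ {z r k} → MRun M w (P y) (at′ y) z r k →
                MRun M w (P x) (at′ x) (emit o z) r k × Ok′ y
        step→ o {x} {y} ok e R =
          let τ , m , sc , t , mv , ok' = step-elim {o} {proj₂ (f x)} {proj₂ (f y)} {node-of x} {node-of y} ok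
                (subst (λ φ → sem g φ (e2 (node-of x) (node-of y)) e0) (edges-label o _ _) (edge→ e))
              τ' , on = on-tape w (node-of y) (B y)
          in go sc t mv on R , ok'

        ok-step : ∀ o {x y} → Ok′ x → edge h x (label o) y ≡ true → Ok′ y
        ok-step o {x} {y} ok e = proj₂ (step→ o {x} {y} ok e done)

        walk→run : ∀ {x z y} → Ok′ x → EWalk h x z y → MRun M w (P x) (at′ x) z (P y) (at′ y)
        walk→run ok [] = done
        walk→run {x} ok (eps {y = y} e t) = proj₁ (step→ nothing {x} {y} ok e (walk→run (ok-step nothing {x} {y} ok e) t))
        walk→run {x} ok (_∷_ {a = a} {y} e t) = proj₁ (step→ (just a) {x} {y} ok e
            (walk→run (ok-step (just a) {x} {y} ok e) t))

        run→walk : ∀ {p i z q j} → MRun M w p i z q j → ∀ v → Ok′ v → P v ≡ p → at′ v ≡ i →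
                   ∃[ v' ] (EWalk h v z v' × P v' ≡ q)
        run→walk done v ok eq _ = v , [] , eq
        run→walk (go {o = o} {ε = m} {q} {j} sc t mv on R) v ok refl refl =
          let u , b , ok₁ , eq = locate w j on
              v₁ , e₁ , e₂ , e₃ = place u b q
              ok₁′ = subst (λ (u , b) → Valid w u b) (cong₂ _,_ (≡sym e₁) (≡sym e₂)) ok₁
              at₁ = trans (cong₂ (pos w) e₁ e₂) eq
              v' , W , e = run→walk R v₁ ok₁′ e₃ at₁
          in v' , cons-label o (edge← (subst (λ φ → sem g φ (e2 (node-of v) (node-of v₁)) e0) (≡sym (edges-label o _ _))
                 (step-intro {o} {proj₂ (f v)} {proj₂ (f v₁)} {node-of v} {node-of v₁} ok ok₁′ sc
                   (subst (Tr (P v) _ o m) (≡sym e₃) t) (trans mv (cong just (≡sym at₁)))))) W , e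

      accept→mrel : ∀ {z} → Accept h z → MRel M w z
      accept→mrel (x , y , i , W , fin) =
        let init , i' = guardF-elim {g = g} {e2 (node-of x) (node-of x)} {e0} _
                (guardF ⌊ B x Fin.≟ start ⌋ (firstF zero)) (edge→ i)
            st≡ , fst = guardF-elim {g = g} {e2 (node-of x) (node-of x)} {e0} _ (firstF zero) i'
            b≡ = ⌊⌋-true (B x Fin.≟ start) st≡
            u≡ = first-elim w {x = zero} {e2 (node-of x) (node-of x)} {e0} fst
            final , _ = guardF-elim {g = g} {e2 (node-of y) (node-of y)} {e0} _ trueF (edge→ fin)
        in P x , P y , at′ y , ⌊⌋-true (Init? _) init ,
           subst (λ i → MRun M w (P x) i _ (P y) (at′ y)) (cong (pos w (node-of x)) b≡)
             (walk→run (subst (Valid w (node-of x)) (≡sym b≡) u≡) W) ,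
           ⌊⌋-true (Final? _) final

      mrel→accept : ∀ {z} → MRel M w z → Accept h z
      mrel→accept (p , r , k , init , R , final) =
        let x , u≡ , b≡ , p≡ = place zero start p
            y , W , r≡ = run→walk R x (subst (Valid w (node-of x)) (≡sym b≡) u≡) p≡ (cong (pos w (node-of x)) b≡)
        in x , y ,
           edge← (guardF-intro {g = g} {e2 (node-of x) (node-of x)} {e0} (guardF ⌊ B x Fin.≟ start ⌋ (firstF zero))
             (⌊⌋-intro (Init? (P x)) (subst Init (≡sym p≡) init))
             (guardF-intro {g = g} {e2 (node-of x) (node-of x)} {e0} (firstF zero) (⌊⌋-intro (B x Fin.≟ start) b≡)
               (first-intro w {x = zero} {e2 (node-of x) (node-of x)} {e0} u≡))) ,
           W ,
           edge← (guardF-intro {g = g} {e2 (node-of y) (node-of y)} {e0} trueF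
             (⌊⌋-intro (Final? (P y)) (subst Final (≡sym r≡) final)) (true-sem {ρ = e2 (node-of y) (node-of y)}))

      private
        order-sem : ∀ c c' {u v} → (sem g (edgesF c c' L<) (e2 u v) e0 → Lex (u , c) (v , c')) ×
                                   (Lex (u , c) (v , c') → sem g (edgesF c c' L<) (e2 u v) e0)
        order-sem c c' {u} {v} =
          [ (λ (r , n) → inj₁ (ℕ.≤∧≢⇒< (star-egr w (reach-elim {g = g} {e2 u v} {e0} anyStepF (anyStep-sem {g = g})
              {zero} {suc zero} r))
                                  (λ e → n (Fin.toℕ-injective e)))) ,
            (λ (e , s) → inj₂ (e , ⌊⌋-true (toℕ c <? toℕ c') (proj₁ (guardF-elim {g = g} {e2 u v} {e0} _ trueF s)))) ]′ ,
          [ (λ l → inj₁ (reach-intro {g = g} {e2 u v} {e0} anyStepF (anyStep-sem {g = g}) {zero} {suc zero}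
                            (egr-star w (toℕ v ∸ toℕ u) (≡sym (ℕ.m∸n+n≡m (ℕ.<⇒≤ l)))) ,
                         λ e → ℕ.<-irrefl (cong toℕ e) l)) ,
            (λ (e , l) → inj₂ (e , guardF-intro {g = g} {e2 u v} {e0} trueF (⌊⌋-intro (toℕ c <? toℕ c') l)
                (true-sem {ρ = e2 u v}))) ]′

      order→ : ∀ {v v'} → edge h v L< v' ≡ true → Lex (f v) (f v')
      order→ {v} {v'} e = proj₁ (order-sem (proj₂ (f v)) (proj₂ (f v'))) (edge→ e)

      order← : ∀ {v v'} → Lex (f v) (f v') → edge h v L< v' ≡ true
      order← {v} {v'} l = edge← (proj₂ (order-sem (proj₂ (f v)) (proj₂ (f v'))) l)

  -- The configuration graph is taken in its concrete form `image`, because only its numbering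
  -- agrees with the order given by the label L<.
  Unif-mach : Unif (compT machT uniT) (MRel M)
  Unif-mach =
    (λ w d → let _ , d' = dom-comp machT uniT {egr w} d
                 z , J , a = uniT-accept (h w) (λ {x} {y} → ord w {x} {y}) (λ {x} {y} → ord⁻ w {x} {y}) (d' (I w))
             in z , Img-comp machT uniT (I w) J , accept→mrel w (I w) a) ,
    (λ w z r → comp-dom machT uniT (I w)
        (accept-uniT (h w) (λ {x} {y} → ord w {x} {y}) (λ {x} {y} → ord⁻ w {x} {y}) (mrel→accept w (I w) r)))
    where
    d₀ : ∀ w → sem (egr w) (trueF {1} {n₁}) e0 e0
    d₀ w (_ , n) = n refl
    h : Str n₁ → Graph 1 (4 + n₂)
    h w = image machT (egr w)
    I : ∀ w → Img machT (egr w) (h w)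
    I w = Img-image machT (egr w) (d₀ w)
    ord : ∀ w {x y} → edge (h w) x L< y ≡ true → toℕ x < toℕ y
    ord w {x} {y} e = lex-image machT (egr w) (d₀ w) {x} {y} (order→ w (I w) {x} {y} e)
    ord⁻ : ∀ w {x y} → toℕ x < toℕ y → edge (h w) x L< y ≡ true
    ord⁻ w {x} {y} l = order← w (I w) {x} {y} (image-lex machT (egr w) (d₀ w) {x} {y} l)

-- Computes structurally, so that the mark of `suc x` read from the second node on is definitionally
-- the mark of `x`. The inductions over automaton runs with `β ∘ suc` use this.
_==_ : ∀ {n} → Fin n → Fin n → Bool
zero == zero = true
zero == suc y = false
suc x == zero = false
suc x == suc y = x == y

==-true : ∀ {n} (x y : Fin n) → (x == y) ≡ true → x ≡ y
==-true zero zero e = refl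
==-true (suc x) (suc y) e = cong suc (==-true x y e)

==-refl : ∀ {n} (x : Fin n) → (x == x) ≡ true
==-refl zero = refl
==-refl (suc x) = ==-refl x

Bits : ℕ → ℕ → Set
Bits i j = Vec Bool i × Vec Bool j

-- Büchi's theorem

-- Automata reading the nodes of egr w from left to right; the letter of a node is the label of the
-- edge leaving it (shifted by one), or zero for the last node.
record Aut (n i j : ℕ) : Set₁ where
  field
    Q     : Set
    K     : ℕ
    index : Q ↔ Fin K
    q₀    : Q
    δ     : Q → Fin (suc n) → Bits i j → Q
    acc   : Q → Bool

  run : (w : Str n) → (Fin (suc (length w)) → Bits i j) → Q → Q
  run [] β q = δ q zero (β zero)
  run (a ∷ w) β q = run w (β ∘ suc) (δ q (suc a) (β zero))

  eqQ : Q → Q → Bool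
  eqQ p q = Inverse.to index p == Inverse.to index q

  eqQ-true : ∀ p q → eqQ p q ≡ true → p ≡ q
  eqQ-true p q e = trans (≡sym (Inverse.strictlyInverseʳ index p))
    (trans (cong (Inverse.from index) (==-true _ _ e)) (Inverse.strictlyInverseʳ index q))

  eqQ-refl : ∀ q → eqQ q q ≡ true
  eqQ-refl q = ==-refl (Inverse.to index q)

  anyQ : (Q → Bool) → Bool
  anyQ p = any (p ∘ Inverse.from index) (allFin K)

  anyQ-true : ∀ p → anyQ p ≡ true → ∃[ q ] p q ≡ true
  anyQ-true p e = let i , _ , t = any-true {p = p ∘ Inverse.from index} (allFin K) e in Inverse.from index i , t

  anyQ-intro : ∀ p q → p q ≡ true → anyQ p ≡ true
  anyQ-intro p q t = anyF-intro {p = p ∘ Inverse.from index} (Inverse.to index q)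
    (trans (cong p (Inverse.strictlyInverseʳ index q)) t)

  mem : Vec Bool K → Q → Bool
  mem S q = lookupᵛ S (Inverse.to index q)

  mkSet : (Q → Bool) → Vec Bool K
  mkSet p = tabulate (p ∘ Inverse.from index)

  mem-mkSet : ∀ p q → mem (mkSet p) q ≡ p q
  mem-mkSet p q = trans (Vec.lookup∘tabulate (p ∘ Inverse.from index) (Inverse.to index q))
                        (cong p (Inverse.strictlyInverseʳ index q))

-- State sets are vectors because Boolean functions have no such bijection without extensionality;
-- `2 ^ n` counts the subsets.
vec↔ : ∀ n → Vec Bool n ↔ Fin (2 ^ n)
vec↔ zero = mk↔ₛ′ (λ _ → zero) (λ _ → []ᵛ) (λ { zero → refl }) (λ { []ᵛ → refl })
vec↔ (suc n) = ↔-sym Fin.*↔× ↔-∘ ((↔-sym Fin.2↔Bool ×.×-↔ vec↔ n) ↔-∘ uncons)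
  where
  uncons : Vec Bool (suc n) ↔ (Bool × Vec Bool n)
  uncons = mk↔ₛ′ (λ { (b ∷ᵛ v) → b , v }) (λ (b , v) → b ∷ᵛ v) (λ _ → refl) (λ { (b ∷ᵛ v) → refl })

bits : ∀ {i j N} → (Fin i → Fin N) → (Fin j → Fin N → Bool) → Fin N → Bits i j
bits ρ η k = tabulate (λ x → ρ x == k) , tabulate (λ X → η X k)

-- Only markings that come from an assignment are considered, so each node variable marks exactly
-- one position.
Recognizes : ∀ {n i j} → Aut n i j → Form 1 n i j → Set
Recognizes A φ = ∀ w ρ η → acc (run w (bits ρ η) q₀) ≡ sat (egr w) φ ρ η
  where open Aut A

constA : ∀ {n i j} → Bool → Aut n i j
constA b = record { Q = Fin 1 ; K = 1 ; index = ↔-id _ ; q₀ = zero ; δ = λ q _ _ → q ; acc = λ _ → b }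

notA : ∀ {n i j} → Aut n i j → Aut n i j
notA A = record A { acc = not ∘ Aut.acc A }

run-notA : ∀ {n i j} (A : Aut n i j) w β q → Aut.run (notA A) w β q ≡ Aut.run A w β q
run-notA A [] β q = refl
run-notA A (a ∷ w) β q = run-notA A w _ _

binA : ∀ {n i j} → (Bool → Bool → Bool) → Aut n i j → Aut n i j → Aut n i j
binA op A B = record
  { Q = A.Q × B.Q ; K = A.K * B.K ; index = ↔-sym Fin.*↔× ↔-∘ (A.index ×.×-↔ B.index) ; q₀ = A.q₀ , B.q₀
  ; δ = λ (p , q) ℓ b → A.δ p ℓ b , B.δ q ℓ b ; acc = λ (p , q) → op (A.acc p) (B.acc q) }
  where
  module A = Aut A
  module B = Aut B

run-binA : ∀ {n i j} op (A B : Aut n i j) w β p q → Aut.run (binA op A B) w β (p , q) ≡ (Aut.run A w β p , Aut.run B w β q)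
run-binA op A B [] β p q = refl
run-binA op A B (a ∷ w) β p q = run-binA op A B w _ _ _

-- Serves both x = y and x ∈ X: the state latches the outcome of the test at the position marked by
-- `x`.
testA : ∀ {n i j} → Fin i → (Bits i j → Bool) → Aut n i j
testA x t = record { Q = Bool ; K = 2 ; index = ↔-sym Fin.2↔Bool ; q₀ = false
                   ; δ = λ q _ b → q ∨ (lookupᵛ (proj₁ b) x ∧ t b) ; acc = id }

module _ {n i j : ℕ} (x : Fin i) (t : Bits i j → Bool) where
  private
    A = testA {n} x t
    At : ∀ {N} → (Fin N → Bits i j) → Fin N → Set
    At β k = lookupᵛ (proj₁ (β k)) x ≡ true × t (β k) ≡ true

    run→ : ∀ w β q → Aut.run A w β q ≡ true → q ≡ true ⊎ ∃ (At β)
    run→ [] β q e with ∨-true e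
    ... | inj₁ e' = inj₁ e'
    ... | inj₂ e' = inj₂ (zero , ∧-true e')
    run→ (a ∷ w) β q e with run→ w (β ∘ suc) _ e
    ... | inj₂ (k , m) = inj₂ (suc k , m)
    ... | inj₁ e' with ∨-true {q} e'
    ... | inj₁ e'' = inj₁ e''
    ... | inj₂ e'' = inj₂ (zero , ∧-true e'')

    run← : ∀ w β q → q ≡ true ⊎ ∃ (At β) → Aut.run A w β q ≡ true
    run← [] β q (inj₁ e) = ∨-intro (inj₁ e)
    run← [] β q (inj₂ (zero , m , m')) = ∨-intro {q} (inj₂ (∧-intro m m'))
    run← (a ∷ w) β q (inj₁ e) = run← w (β ∘ suc) _ (inj₁ (∨-intro (inj₁ e)))
    run← (a ∷ w) β q (inj₂ (zero , m , m')) = run← w (β ∘ suc) _ (inj₁ (∨-intro {q} (inj₂ (∧-intro m m'))))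
    run← (a ∷ w) β q (inj₂ (suc k , m)) = run← w (β ∘ suc) _ (inj₂ (k , m))

  testA-run : ∀ w (ρ : Fin i → Fin (suc (length w))) η → Aut.run A w (bits ρ η) false ≡ t (bits ρ η (ρ x))
  testA-run w ρ η = ⇔→≡
    (λ e → [ (λ ()) , (λ (k , m , m') → trans (cong (t ∘ bits ρ η) (at≡ k m)) m') ]′ (run→ w (bits ρ η) false e))
    (λ e → run← w (bits ρ η) false (inj₂ (ρ x , trans (Vec.lookup∘tabulate _ x) (==-refl (ρ x)) , e)))
    where
    at≡ : ∀ k → lookupᵛ (tabulate (λ x → ρ x == k)) x ≡ true → ρ x ≡ k
    at≡ k m = ==-true (ρ x) k (trans (≡sym (Vec.lookup∘tabulate (λ x → ρ x == k) x)) m)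

-- `armed` records that the node just read was `x` with outgoing letter `a`; the edge is found if
-- `y` comes directly after it.
edgeA : ∀ {n i j} → Fin n → Fin i → Fin i → Aut n i j
edgeA a x y = record { Q = Bool × Bool ; K = 2 * 2 ; index = ↔-sym Fin.*↔× ↔-∘ (↔-sym Fin.2↔Bool ×.×-↔ ↔-sym Fin.2↔Bool)
  ; q₀ = false , false ; δ = λ (found , armed) ℓ b → found ∨ (armed ∧ lookupᵛ (proj₁ b) y) ,
                                              lookupᵛ (proj₁ b) x ∧ (ℓ == suc a)
  ; acc = proj₁ }

module _ {n i j : ℕ} (a : Fin n) (x y : Fin i) where
  private
    A = edgeA {n} {i} {j} a x y
    X Y : ∀ {N} → (Fin N → Bits i j) → Fin N → Set
    X β k = lookupᵛ (proj₁ (β k)) x ≡ true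
    Y β k = lookupᵛ (proj₁ (β k)) y ≡ true
    Hit : ∀ (w : Str n) → (Fin (suc (length w)) → Bits i j) → Set
    Hit w β = ∃[ k ] ∃[ k' ] (toℕ k' ≡ suc (toℕ k) × nth w (toℕ k) ≡ just a × X β k × Y β k')

    run→ : ∀ w β f m → proj₁ (Aut.run A w β (f , m)) ≡ true → (f ≡ true ⊎ (m ≡ true × Y β zero)) ⊎ Hit w β
    run→ [] β f m e with ∨-true e
    ... | inj₁ e' = inj₁ (inj₁ e')
    ... | inj₂ e' = inj₁ (inj₂ (∧-true e'))
    run→ (b ∷ w) β f m e with run→ w (β ∘ suc) _ _ e
    ... | inj₂ (k , k' , p , q , r) = inj₂ (suc k , suc k' , cong suc p , q , r)
    ... | inj₁ (inj₂ (e' , s)) = let r , l = ∧-true e' in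
          inj₂ (zero , suc zero , refl , cong just (Fin.suc-injective (==-true (suc b) (suc a) l)) , r , s)
    ... | inj₁ (inj₁ e') with ∨-true {f} e'
    ... | inj₁ e'' = inj₁ (inj₁ e'')
    ... | inj₂ e'' = inj₁ (inj₂ (∧-true e''))

    run← : ∀ w β f m → (f ≡ true ⊎ (m ≡ true × Y β zero)) ⊎ Hit w β → proj₁ (Aut.run A w β (f , m)) ≡ true
    run← [] β f m (inj₁ (inj₁ e)) = ∨-intro (inj₁ e)
    run← [] β f m (inj₁ (inj₂ (e , e'))) = ∨-intro {f} (inj₂ (∧-intro e e'))
    run← (b ∷ w) β f m (inj₁ (inj₁ e)) = run← w (β ∘ suc) _ _ (inj₁ (inj₁ (∨-intro (inj₁ e))))
    run← (b ∷ w) β f m (inj₁ (inj₂ (e , e'))) = run← w (β ∘ suc) _ _ (inj₁ (inj₁ (∨-intro {f} (inj₂ (∧-intro e e')))))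
    run← (b ∷ w) β f m (inj₂ (zero , suc zero , p , refl , r , s)) =
      run← w (β ∘ suc) _ _ (inj₁ (inj₂ (∧-intro r (==-refl (suc b)) , s)))
    run← (b ∷ w) β f m (inj₂ (suc k , suc k' , p , q , r)) =
      run← w (β ∘ suc) _ _ (inj₂ (k , k' , ℕ.suc-injective p , q , r))

  edgeA-run : Recognizes A (edgeF a x y)
  edgeA-run w ρ η = ⇔→≡
      (λ e → hit→ (run→ w (bits ρ η) false false e))
      (λ e → let p , q = edge-egr w {ρ x} {a} {ρ y} e in
        run← w (bits ρ η) false false (inj₂ (ρ x , ρ y , p , q , bit← x , bit← y)))
    where
    bit→ : ∀ z k → lookupᵛ (tabulate (λ z → ρ z == k)) z ≡ true → ρ z ≡ k
    bit→ z k m = ==-true (ρ z) k (trans (≡sym (Vec.lookup∘tabulate (λ z → ρ z == k) z)) m)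
    bit← : ∀ z → lookupᵛ (tabulate (λ z' → ρ z' == ρ z)) z ≡ true
    bit← z = trans (Vec.lookup∘tabulate _ z) (==-refl (ρ z))
    hit→ : (false ≡ true ⊎ (false ≡ true × Y (bits ρ η) zero)) ⊎ Hit w (bits ρ η) → edge (egr w) (ρ x) a (ρ y) ≡ true
    hit→ (inj₂ (k , k' , p , q , r , s)) with refl ← bit→ x k r with refl ← bit→ y k' s = egr-edge w {ρ x} {a} {ρ y} p q
    hit→ (inj₁ (inj₁ ()))
    hit→ (inj₁ (inj₂ (() , _)))

push₁ : ∀ {i j} → Bool → Bits i j → Bits (suc i) j
push₁ x (b , c) = x ∷ᵛ b , c

push₂ : ∀ {i j} → Bool → Bits i j → Bits i (suc j)
push₂ x (b , c) = b , x ∷ᵛ c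

-- A state is reached without a position for the bound variable, together with the set of states
-- reached with one.
exA : ∀ {n i j} → Aut n (suc i) j → Aut n i j
exA {n} {i} {j} A = record
  { Q = Q × Vec Bool K ; K = K * 2 ^ K ; index = ↔-sym Fin.*↔× ↔-∘ (index ×.×-↔ vec↔ K) ; q₀ = q₀ , mkSet (λ _ → false)
  ; δ = λ (q , S) ℓ b → δ q ℓ (push₁ false b) ,
      mkSet (λ q' → eqQ q' (δ q ℓ (push₁ true b)) ∨ anyQ (λ p → mem S p ∧ eqQ q' (δ p ℓ (push₁ false b))))
  ; acc = λ (q , S) → anyQ (λ p → mem S p ∧ acc p) }
  where open Aut A

-- The subset construction for the automaton that guesses, at each node, the bit of the quantified
-- set.
exSA : ∀ {n i j} → Aut n i (suc j) → Aut n i j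
exSA A = record
  { Q = Vec Bool K ; K = 2 ^ K ; index = vec↔ K ; q₀ = mkSet (λ q → eqQ q q₀)
  ; δ = λ S ℓ b → mkSet (λ q' → anyQ (λ p → mem S p ∧ (eqQ q' (δ p ℓ (push₂ false b)) ∨ eqQ q' (δ p ℓ (push₂ true b)))))
  ; acc = λ S → anyQ (λ p → mem S p ∧ acc p) }
  where open Aut A

module _ {n i j : ℕ} (A : Aut n (suc i) j) where
  open Aut A
  private
    module A' = Aut (exA A)
    -- Either the bound variable has been placed already, and some state in `S` accepts the rest
    -- without a mark, or it is still to be placed on the rest, starting from `q`.
    Goal : ∀ w → (Fin (suc (length w)) → Bits i j) → Q → Vec Bool K → Set
    Goal w β q S = (∃[ p ] (mem S p ≡ true × acc (run w (λ k → push₁ false (β k)) p) ≡ true)) ⊎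
                   (∃[ x ] acc (run w (λ k → push₁ (x == k) (β k)) q) ≡ true)

    old new : Q → Vec Bool K → Fin (suc n) → Bits i j → Q → Q → Bool
    old q S ℓ b q' p = mem S p ∧ eqQ q' (δ p ℓ (push₁ false b))
    new q S ℓ b q' _ = eqQ q' (δ q ℓ (push₁ true b))
    reached : Q → Vec Bool K → Fin (suc n) → Bits i j → Q → Bool
    reached q S ℓ b q' = new q S ℓ b q' q ∨ anyQ (old q S ℓ b q')

    δ-mem→ : ∀ q S ℓ b q' → mem (proj₂ (A'.δ (q , S) ℓ b)) q' ≡ true →
             q' ≡ δ q ℓ (push₁ true b) ⊎ ∃[ p ] (mem S p ≡ true × q' ≡ δ p ℓ (push₁ false b))
    δ-mem→ q S ℓ b q' e with ∨-true {new q S ℓ b q' q} (trans (≡sym (mem-mkSet (reached q S ℓ b) q')) e)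
    ... | inj₁ e' = inj₁ (eqQ-true _ _ e')
    ... | inj₂ e' = let p , e'' = anyQ-true (old q S ℓ b q') e' ; m , x = ∧-true e'' in inj₂ (p , m , eqQ-true _ _ x)

    δ-mem₁ : ∀ q S ℓ b → mem (proj₂ (A'.δ (q , S) ℓ b)) (δ q ℓ (push₁ true b)) ≡ true
    δ-mem₁ q S ℓ b = trans (mem-mkSet (reached q S ℓ b) _) (∨-intro (inj₁ (eqQ-refl _)))

    δ-mem₂ : ∀ q S ℓ b {p} → mem S p ≡ true → mem (proj₂ (A'.δ (q , S) ℓ b)) (δ p ℓ (push₁ false b)) ≡ true
    δ-mem₂ q S ℓ b {p} m = let q' = δ p ℓ (push₁ false b) in trans (mem-mkSet (reached q S ℓ b) _)
      (∨-intro {new q S ℓ b q' q} (inj₂ (anyQ-intro (old q S ℓ b q') p (∧-intro m (eqQ-refl _)))))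

    acc→ : ∀ {q S} → A'.acc (q , S) ≡ true → ∃[ p ] (mem S p ≡ true × acc p ≡ true)
    acc→ {S = S} e = let p , e' = anyQ-true (λ p → mem S p ∧ acc p) e in p , ∧-true e'

    acc← : ∀ {q S p} → mem S p ≡ true → acc p ≡ true → A'.acc (q , S) ≡ true
    acc← {S = S} {p} m a = anyQ-intro (λ p → mem S p ∧ acc p) p (∧-intro m a)

    run→ : ∀ w β q S → A'.acc (A'.run w β (q , S)) ≡ true → Goal w β q S
    run→ [] β q S e with acc→ {δ q zero (push₁ false (β zero))} {proj₂ (A'.δ (q , S) zero (β zero))} e
    ... | p , m , a with δ-mem→ q S zero (β zero) p m
    ... | inj₁ refl = inj₂ (zero , a)
    ... | inj₂ (p' , m' , refl) = inj₁ (p' , m' , a)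
    run→ (c ∷ w) β q S e with run→ w (β ∘ suc) _ (proj₂ (A'.δ (q , S) (suc c) (β zero))) e
    ... | inj₂ (x , a) = inj₂ (suc x , a)
    ... | inj₁ (p , m , a) with δ-mem→ q S (suc c) (β zero) p m
    ... | inj₁ refl = inj₂ (zero , a)
    ... | inj₂ (p' , m' , refl) = inj₁ (p' , m' , a)

    run← : ∀ w β q S → Goal w β q S → A'.acc (A'.run w β (q , S)) ≡ true
    run← [] β q S (inj₁ (p , m , a)) = acc← {δ q zero (push₁ false (β zero))} {proj₂ (A'.δ (q , S) zero (β zero))}
        (δ-mem₂ q S zero (β zero) m) a
    run← [] β q S (inj₂ (zero , a)) = acc← {δ q zero (push₁ false (β zero))} {proj₂ (A'.δ (q , S) zero (β zero))}
        (δ-mem₁ q S zero (β zero)) a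
    run← (c ∷ w) β q S (inj₁ (p , m , a)) = run← w (β ∘ suc) _ (proj₂ (A'.δ (q , S) (suc c) (β zero)))
        (inj₁ (_ , δ-mem₂ q S (suc c) (β zero) m , a))
    run← (c ∷ w) β q S (inj₂ (zero , a)) = run← w (β ∘ suc) _ (proj₂ (A'.δ (q , S) (suc c) (β zero)))
        (inj₁ (_ , δ-mem₁ q S (suc c) (β zero) , a))
    run← (c ∷ w) β q S (inj₂ (suc x , a)) = run← w (β ∘ suc) _ (proj₂ (A'.δ (q , S) (suc c) (β zero))) (inj₂ (x , a))

  exA-run : ∀ φ → Recognizes A φ → Recognizes (exA A) (exF φ)
  exA-run φ r w ρ η = ⇔→≡
    (λ e → [ (λ (p , m , _) → ⊥-elim (empty p m)) ,
             (λ (x , a) → anyF-intro {p = λ x → sat (egr w) φ (x ∷ᶠ ρ) η} x (trans (≡sym (r w (x ∷ᶠ ρ) η)) a)) ]′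
           (run→ w (bits ρ η) q₀ (mkSet (λ _ → false)) e))
    (λ e → let x , _ , a = any-true {p = λ x → sat (egr w) φ (x ∷ᶠ ρ) η} (allFin _) e in
           run← w (bits ρ η) q₀ (mkSet (λ _ → false)) (inj₂ (x , trans (r w (x ∷ᶠ ρ) η) a)))
    where
    empty : ∀ p → ¬ mem (mkSet (λ _ → false)) p ≡ true
    empty p m with () ← trans (≡sym (mem-mkSet (λ _ → false) p)) m

module _ {n i j : ℕ} (A : Aut n i (suc j)) where
  open Aut A
  private
    module A' = Aut (exSA A)
    Goal : ∀ w → (Fin (suc (length w)) → Bits i j) → Vec Bool K → Set
    Goal w β S = ∃[ p ] (mem S p ≡ true × Σ (Fin (suc (length w)) → Bool) λ X →
                 acc (run w (λ k → push₂ (X k) (β k)) p) ≡ true)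

    source : Vec Bool K → Fin (suc n) → Bits i j → Q → Q → Bool
    source S ℓ b q' p = mem S p ∧ (eqQ q' (δ p ℓ (push₂ false b)) ∨ eqQ q' (δ p ℓ (push₂ true b)))

    δ-mem→ : ∀ S ℓ b q' → mem (A'.δ S ℓ b) q' ≡ true → ∃[ p ] (mem S p ≡ true × ∃[ x ] q' ≡ δ p ℓ (push₂ x b))
    δ-mem→ S ℓ b q' e with anyQ-true (source S ℓ b q') (trans (≡sym (mem-mkSet (λ q' → anyQ (source S ℓ b q')) q')) e)
    ... | p , e' with ∧-true {mem S p} e'
    ... | m , e'' with ∨-true {eqQ q' (δ p ℓ (push₂ false b))} e''
    ... | inj₁ x = p , m , false , eqQ-true _ _ x
    ... | inj₂ x = p , m , true , eqQ-true _ _ x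

    δ-mem← : ∀ S ℓ b {p} x → mem S p ≡ true → mem (A'.δ S ℓ b) (δ p ℓ (push₂ x b)) ≡ true
    δ-mem← S ℓ b {p} x m = trans (mem-mkSet (λ q' → anyQ (source S ℓ b q')) _)
        (anyQ-intro (source S ℓ b (δ p ℓ (push₂ x b))) p (∧-intro m (bit x)))
      where
      bit : ∀ x → eqQ (δ p ℓ (push₂ x b)) (δ p ℓ (push₂ false b)) ∨ eqQ (δ p ℓ (push₂ x b)) (δ p ℓ (push₂ true b)) ≡ true
      bit false = ∨-intro (inj₁ (eqQ-refl _))
      bit true = ∨-intro {eqQ (δ p ℓ (push₂ true b)) (δ p ℓ (push₂ false b))} (inj₂ (eqQ-refl _))

    acc→ : ∀ S → A'.acc S ≡ true → ∃[ p ] (mem S p ≡ true × acc p ≡ true)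
    acc→ S e = let p , e' = anyQ-true (λ p → mem S p ∧ acc p) e in p , ∧-true e'

    acc← : ∀ S {p} → mem S p ≡ true → acc p ≡ true → A'.acc S ≡ true
    acc← S {p} m a = anyQ-intro (λ p → mem S p ∧ acc p) p (∧-intro m a)

    run→ : ∀ w β S → A'.acc (A'.run w β S) ≡ true → Goal w β S
    run→ [] β S e with acc→ (A'.δ S zero (β zero)) e
    ... | p , m , a with δ-mem→ S zero (β zero) p m
    ... | p' , m' , x , refl = p' , m' , (λ _ → x) , a
    run→ (c ∷ w) β S e with run→ w (β ∘ suc) (A'.δ S (suc c) (β zero)) e
    ... | p , m , X , a with δ-mem→ S (suc c) (β zero) p m
    ... | p' , m' , x , refl = p' , m' , x ∷ᶠ X , a

    run← : ∀ w β S → Goal w β S → A'.acc (A'.run w β S) ≡ true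
    run← [] β S (p , m , X , a) = acc← (A'.δ S zero (β zero)) (δ-mem← S zero (β zero) (X zero) m) a
    run← (c ∷ w) β S (p , m , X , a) = run← w (β ∘ suc) (A'.δ S (suc c) (β zero))
        (_ , δ-mem← S (suc c) (β zero) (X zero) m , X ∘ suc , a)

  exSA-run : ∀ φ → Recognizes A φ → Recognizes (exSA A) (exSF φ)
  exSA-run φ r w ρ η = ⇔→≡
    (λ e → let p , m , X , a = run→ w (bits ρ η) (mkSet (λ q → eqQ q q₀)) e
               eq = eqQ-true p q₀ (trans (≡sym (mem-mkSet (λ q → eqQ q q₀) p)) m)
           in sem-complete {g = egr w} (exSF φ) {ρ} {η} (X , sem-sound {g = egr w} φ
                (trans (≡sym (r w ρ (X ∷ᶠ η))) (subst (λ p → acc (run w (bits ρ (X ∷ᶠ η)) p) ≡ true) eq a))))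
    (λ e → let X , s = sem-sound {g = egr w} (exSF φ) {ρ} {η} e in
           run← w (bits ρ η) (mkSet (λ q → eqQ q q₀))
             (q₀ , trans (mem-mkSet (λ q → eqQ q q₀) q₀) (eqQ-refl q₀) , X ,
              trans (r w ρ (X ∷ᶠ η)) (sem-complete {g = egr w} φ s)))

notA-run : ∀ {n i j} (A : Aut n i j) φ → Recognizes A φ → Recognizes (notA A) (notF φ)
notA-run A φ r w ρ η = cong not (trans (cong (Aut.acc A) (run-notA A w (bits ρ η) (Aut.q₀ A))) (r w ρ η))

büchi : ∀ {n i j} (φ : Form 1 n i j) → Σ (Aut n i j) λ A → Recognizes A φ
büchi (labF σ x) = constA ⌊ zero Fin.≟ σ ⌋ , λ _ _ _ → refl
büchi (edgeF γ x y) = edgeA γ x y , edgeA-run γ x y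
büchi (eqF x y) = testA x t , λ w ρ η → trans (testA-run x t w ρ η) (⇔→≡
    (λ e → ⌊⌋-intro (ρ x Fin.≟ ρ y) (≡sym (==-true (ρ y) (ρ x) (trans (≡sym (Vec.lookup∘tabulate _ y)) e))))
    (λ e → trans (Vec.lookup∘tabulate _ y) (subst (λ v → (ρ y == v) ≡ true) (≡sym (⌊⌋-true (ρ x Fin.≟ ρ y) e))
        (==-refl (ρ y)))))
  where
  t = λ b → lookupᵛ (proj₁ b) y
büchi (memF x X) = testA x t , λ w ρ η → trans (testA-run x t w ρ η) (Vec.lookup∘tabulate _ X)
  where
  t = λ b → lookupᵛ (proj₂ b) X
büchi (notF φ) = let A , r = büchi φ in notA A , notA-run A φ r
büchi (orF φ ψ) = let A , r = büchi φ ; B , s = büchi ψ in binA _∨_ A B , λ w ρ η →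
  trans (cong (Aut.acc (binA _∨_ A B)) (run-binA _∨_ A B w (bits ρ η) _ _)) (cong₂ _∨_ (r w ρ η) (s w ρ η))
büchi (andF φ ψ) = let A , r = büchi φ ; B , s = büchi ψ in binA _∧_ A B , λ w ρ η →
  trans (cong (Aut.acc (binA _∧_ A B)) (run-binA _∧_ A B w (bits ρ η) _ _)) (cong₂ _∧_ (r w ρ η) (s w ρ η))
büchi (exF φ) = let A , r = büchi φ in exA A , exA-run A φ r
büchi (allF φ) = let A , r = büchi φ in notA (exA (notA A)) ,
  notA-run (exA (notA A)) (exF (notF φ)) (exA-run (notA A) (notF φ) (notA-run A φ r))
büchi (exSF φ) = let A , r = büchi φ in exSA A , exSA-run A φ r
büchi (allSF φ) = let A , r = büchi φ in notA (exSA (notA A)) ,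
  notA-run (exSA (notA A)) (exSF (notF φ)) (exSA-run (notA A) (notF φ) (notA-run A φ r))

_≟ˢ_ : ∀ {n} (σ τ : TSym n) → Dec (σ ≡ τ)
σ ≟ˢ τ = map′ (λ e → trans (≡sym (symOf-Ix σ)) (trans (cong symOf e) (symOf-Ix τ))) (cong symIx) (symIx σ Fin.≟ symIx τ)

_≟ᵐ_ : (m m' : Move) → Dec (m ≡ m')
m ≟ᵐ m' = map′ (λ e → trans (≡sym (moveOf-Ix m)) (trans (cong moveOf e) (moveOf-Ix m'))) (cong moveIx)
    (moveIx m Fin.≟ moveIx m')

_≟ᵒ_ : ∀ {n} (o o' : Maybe (Fin n)) → Dec (o ≡ o')
_≟ᵒ_ = Maybe.≡-dec Fin._≟_

_≟ʷ_ : ∀ {n} (z z' : Str n) → Dec (z ≡ z')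
_≟ʷ_ = List.≡-dec Fin._≟_

-- Restricting a machine to outputs in a regular language

module _ {n₁ n₂ : ℕ} (M : Mach n₁ n₂) (A : Aut n₂ 0 0) where
  private
    module M = Mach M
    module A = Aut A

  read : A.Q → Fin n₂ → A.Q
  read s a = A.δ s (suc a) ([]ᵛ , []ᵛ)

  -- A string graph has one node more than the string has letters. The last node is read here, after
  -- the output is complete.
  Accepting : A.Q → Set
  Accepting s = A.acc (A.δ s zero ([]ᵛ , []ᵛ)) ≡ true

  private
    adv : A.Q → Maybe (Fin n₂) → A.Q
    adv s nothing = s
    adv s (just a) = read s a

    _≟Q_ : ∀ s t → Dec (s ≡ t)
    s ≟Q t = map′ (λ e → trans (≡sym (Inverse.strictlyInverseʳ A.index s))
                           (trans (cong (Inverse.from A.index) e) (Inverse.strictlyInverseʳ A.index t)))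
                  (cong (Inverse.to A.index)) (Inverse.to A.index s Fin.≟ Inverse.to A.index t)

    foldl-emit : ∀ s o z → foldl read s (emit o z) ≡ foldl read (adv s o) z
    foldl-emit s nothing z = refl
    foldl-emit s (just a) z = refl

  prodM : Mach n₁ n₂
  prodM = record
    { State = M.State × A.Q ; K = M.K * A.K ; index = ↔-sym Fin.*↔× ↔-∘ (M.index ×.×-↔ A.index)
    ; Tr = λ (p , s) τ o ε (q , t) → M.Tr p τ o ε q × t ≡ adv s o
    ; Tr? = λ (p , s) τ o ε (q , t) → M.Tr? p τ o ε q ×-dec (t ≟Q adv s o)
    ; Init = λ (p , s) → M.Init p × s ≡ A.q₀ ; Final = λ (p , s) → M.Final p × Accepting s
    ; Init? = λ (p , s) → M.Init? p ×-dec (s ≟Q A.q₀) ; Final? = λ (p , s) → M.Final? p ×-dec (_ Bool.≟ true) }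

  module _ {w : Str n₁} where
    private
      run→ : ∀ {p s i z r t k} → MRun prodM w (p , s) i z (r , t) k → MRun M w p i z r k × t ≡ foldl read s z
      run→ done = done , refl
      run→ {s = s} (go {o = o} {z = z} sc (t , refl) mv on R) =
        let R' , e = run→ R in go sc t mv on R' , trans e (≡sym (foldl-emit s o z))

      run← : ∀ {p i z r k} s → MRun M w p i z r k → MRun prodM w (p , s) i z (r , foldl read s z) k
      run← s done = done
      run← s (go {p} {i} {o = o} {z = z} {r} {k} sc t mv on R) =
        subst (λ t → MRun prodM w (p , s) i (emit o z) (r , t) k) (≡sym (foldl-emit s o z))
          (go sc (t , refl) mv on (run← (adv s o) R))

    prod→ : ∀ {z} → MRel prodM w z → MRel M w z × Accepting (foldl read A.q₀ z)
    prod→ ((p , s) , (r , t) , k , (i , refl) , R , f , a) = let R' , e = run→ R in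
      (p , r , k , i , R' , f) , subst Accepting e a

    prod← : ∀ {z} → MRel M w z → Accepting (foldl read A.q₀ z) → MRel prodM w z
    prod← (p , r , k , i , R , f) a = _ , _ , k , (i , refl) , run← A.q₀ R , f , a

  closed-run : ∀ z s → A.run z (λ _ → []ᵛ , []ᵛ) s ≡ A.δ (foldl read s z) zero ([]ᵛ , []ᵛ)
  closed-run [] s = refl
  closed-run (a ∷ z) s = closed-run z (read s a)

  module _ {φ : Form 1 n₂ 0 0} (rec : Recognizes A φ) where
    accepting→sem : ∀ z → Accepting (foldl read A.q₀ z) → sem (egr z) φ e0 e0
    accepting→sem z a = sem-sound {g = egr z} φ {e0} {e0} (trans (≡sym (rec z e0 e0))
        (trans (cong A.acc (closed-run z A.q₀)) a))

    sem→accepting : ∀ z → sem (egr z) φ e0 e0 → Accepting (foldl read A.q₀ z)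
    sem→accepting z s = trans (cong A.acc (≡sym (closed-run z A.q₀)))
        (trans (rec z e0 e0) (sem-complete {g = egr z} φ {e0} {e0} s))

-- A state of the letter-by-letter machine is a state of the 2gsm with the output still to be emitted.
module _ {n₁ n₂ : ℕ} (M : TwoGSM n₁ n₂) where
  open TwoGSM M
  open Instr
  private
    tails : Str n₂ → List (Str n₂)
    tails [] = [] ∷ []
    tails (a ∷ z) = (a ∷ z) ∷ tails z

    tails-refl : ∀ z → z ∈ tails z
    tails-refl [] = here refl
    tails-refl (a ∷ z) = here refl

    tails-tail : ∀ {a β} z → (a ∷ β) ∈ tails z → β ∈ tails z
    tails-tail (_ ∷ z) (here refl) = there (tails-refl z)
    tails-tail (_ ∷ z) (there m) = there (tails-tail z m)
    tails-tail [] (here ())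
    tails-tail [] (there ())

    outs : Instr nq n₁ n₂ → List (Str n₂)
    outs ι = tails (α₁ ι) ++ tails (α₀ ι)

    -- All outputs that can be pending. The empty string heads the list, so that index 0 is a state
    -- with nothing pending even if there are no instructions.
    sufs : List (Str n₂)
    sufs = [] ∷ concatMap outs δ

    suf : ∀ {ι β} → ι ∈ δ → β ∈ outs ι → β ∈ sufs
    suf ι∈ m = there (Mem.∈-concatMap⁺ outs (lose ι∈ m))

    sufs-tail : ∀ {a β} → (a ∷ β) ∈ sufs → β ∈ sufs
    sufs-tail (there m) with find (Mem.∈-concatMap⁻ outs {δ} m)
    ... | ι , ι∈ , m' with Mem.∈-++⁻ (tails (α₁ ι)) m'
    ... | inj₁ t = suf ι∈ (Mem.∈-++⁺ˡ (tails-tail _ t))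
    ... | inj₂ t = suf ι∈ (Mem.∈-++⁺ʳ (tails (α₁ ι)) (tails-tail _ t))

    Π : Set
    Π = Fin (length sufs)
    pend : Π → Str n₂
    pend = lookup sufs

    code : ∀ {β} → β ∈ sufs → ∃[ π ] pend π ≡ β
    code m = Any.index m , ≡sym (AnyP.lookup-index m)

    Fires : Fin nq → TSym n₁ → Move → Fin nq → Π → Instr nq n₁ n₂ → Set
    Fires q τ m q' π' ι = p ι ≡ q ×
      ((τ ≡ σ ι × q' ≡ q₁ ι × m ≡ ε₁ ι × pend π' ≡ α₁ ι) ⊎ (¬ τ ≡ σ ι × q' ≡ q₀ ι × m ≡ ε₀ ι × pend π' ≡ α₀ ι))

    -- Pending letters are emitted one by one with the head at rest; an instruction fires only when
    -- nothing is pending, and its output becomes the new pending string.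
    Trans′ : Str n₂ → Fin nq → TSym n₁ → Maybe (Fin n₂) → Move → Fin nq → Π → Set
    Trans′ [] q τ o m q' π' = o ≡ nothing × Any (Fires q τ m q' π') δ
    Trans′ (a ∷ β) q τ o m q' π' = o ≡ just a × m ≡ stay × q' ≡ q × pend π' ≡ β

    trans′? : ∀ β q τ o m q' π' → Dec (Trans′ β q τ o m q' π')
    trans′? [] q τ o m q' π' = (o ≟ᵒ nothing) ×-dec Any.any? (λ ι → (p ι Fin.≟ q) ×-dec
      (((τ ≟ˢ σ ι) ×-dec (q' Fin.≟ q₁ ι) ×-dec (m ≟ᵐ ε₁ ι) ×-dec (pend π' ≟ʷ α₁ ι)) ⊎-dec
       (¬? (τ ≟ˢ σ ι) ×-dec (q' Fin.≟ q₀ ι) ×-dec (m ≟ᵐ ε₀ ι) ×-dec (pend π' ≟ʷ α₀ ι)))) δ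
    trans′? (a ∷ β) q τ o m q' π' = (o ≟ᵒ just a) ×-dec (m ≟ᵐ stay) ×-dec (q' Fin.≟ q) ×-dec (pend π' ≟ʷ β)

  gsmM : Mach n₁ n₂
  gsmM = record
    { State = Fin nq × Π ; K = nq * length sufs ; index = ↔-sym Fin.*↔×
    ; Tr = λ (q , π) τ o m (q' , π') → Trans′ (pend π) q τ o m q' π'
    ; Tr? = λ (q , π) τ o m (q' , π') → trans′? (pend π) q τ o m q' π'
    ; Init = λ (q , π) → q ≡ qin × pend π ≡ [] ; Final = λ (q , π) → q ≡ qf × pend π ≡ []
    ; Init? = λ (q , π) → (q Fin.≟ qin) ×-dec (pend π ≟ʷ []) ; Final? = λ (q , π) → (q Fin.≟ qf) ×-dec (pend π ≟ʷ []) }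

  module _ {w : Str n₁} where
    private
      flush : ∀ {q j τ} β π → β ∈ sufs → pend π ≡ β → tapeAt w j ≡ just τ →
              ∃[ π' ] (pend π' ≡ [] × (∀ {z r k} → MRun gsmM w (q , π') j z r k → MRun gsmM w (q , π) j (β ++ z) r k))
      flush [] π m e on = π , e , id
      flush (a ∷ β) π m e on =
        let π₁ , e₁ = code (sufs-tail m)
            π' , e' , ext = flush β π₁ (sufs-tail m) e₁ on
        in π' , e' , λ R → go {o = just a} on (subst (λ β → Trans′ β _ _ _ stay _ π₁) (≡sym e)
            (refl , refl , refl , e₁)) refl on (ext R)

      run← : ∀ {q i z r k} → Run M w q i z r k → ∀ π → pend π ≡ [] →
             ∃[ π' ] (pend π' ≡ [] × MRun gsmM w (q , π) i z (r , π') k)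
      run← done π e = π , e , done
      run← (step-eq ι ι∈ sc mv on ▸ R) π e =
        let m = suf ι∈ (Mem.∈-++⁺ˡ (tails-refl (α₁ ι)))
            π₁ , e₁ = code m
            π₂ , e₂ , ext = flush (α₁ ι) π₁ m e₁ on
            π' , e' , R' = run← R π₂ e₂
        in π' , e' , go {o = nothing} sc (subst (λ β → Trans′ β _ _ _ _ _ π₁) (≡sym e)
             (refl , lose ι∈ (refl , inj₁ (refl , refl , refl , e₁)))) mv on (ext R')
      run← (step-neq ι ι∈ sc neq mv on ▸ R) π e =
        let m = suf ι∈ (Mem.∈-++⁺ʳ (tails (α₁ ι)) (tails-refl (α₀ ι)))
            π₁ , e₁ = code m
            π₂ , e₂ , ext = flush (α₀ ι) π₁ m e₁ on
            π' , e' , R' = run← R π₂ e₂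
        in π' , e' , go {o = nothing} sc (subst (λ β → Trans′ β _ _ _ _ _ π₁) (≡sym e)
             (refl , lose ι∈ (refl , inj₂ (neq , refl , refl , e₁)))) mv on (ext R')

      run→ : ∀ {q π i z r π' k} → MRun gsmM w (q , π) i z (r , π') k → pend π' ≡ [] →
             ∃[ z' ] (z ≡ pend π ++ z' × Run M w q i z' r k)
      run→ done e = [] , trans (≡sym e) (≡sym (List.++-identityʳ _)) , done
      run→ {q} {π} (go {τ = τ} {o = o} {m} {q' , π₁} sc t mv on R) e with pend π | t | run→ R e
      ... | a ∷ β | refl , refl , refl , eq | z' , eq' , R' with refl ← mv = z' , cong (a ∷_)
          (trans eq' (cong (_++ z') eq)) , R'
      ... | [] | refl , fires | z' , eq' , R' with find fires
      ... | ι , ι∈ , refl , inj₁ (refl , refl , refl , eq) =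
            _ , refl , subst (λ z → Run M w (p ι) _ z _ _) (≡sym (trans eq' (cong (_++ z') eq)))
                (step-eq ι ι∈ sc mv on ▸ R')
      ... | ι , ι∈ , refl , inj₂ (neq , refl , refl , eq) =
            _ , refl , subst (λ z → Run M w (p ι) _ z _ _) (≡sym (trans eq' (cong (_++ z') eq)))
                (step-neq ι ι∈ sc neq mv on ▸ R')

    gsm→ : ∀ {z} → Realizes M w z → MRel gsmM w z
    gsm→ (k , R) = let π' , e , R' = run← R zero refl in (qin , zero) , (qf , π') , k , (refl , refl) , R' , refl , e

    gsm← : ∀ {z} → MRel gsmM w z → Realizes M w z
    gsm← ((q , π) , (r , π') , k , (refl , e) , R , refl , e') = let z' , eq , R' = run→ R e' in
      k , subst (λ z → Run M w qin 0 z qf k) (≡sym (trans eq (cong (_++ z') e))) R'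

-- Uniformizing the factors independently could lose inputs: the value chosen for `M` may lie
-- outside the domain of the rest although another value lies inside. The domain of `T₂` is regular,
-- so `M` can be restricted to outputs in it beforehand, and then every choice can be continued.
chain-unif : ∀ {k n₁ n₂} (c : Chain k n₁ n₂) → ∃[ T ] Unif T ⟦ c ⟧ᶜ
chain-unif (one M) = _ ,
    (λ w d → let z , I , r = proj₁ U w d in z , I , gsm← M r) , (λ w z r → proj₂ U w z (gsm→ M r))
  where
  U = Unif-mach (gsmM M)
chain-unif (cons M c) = compT T₁ T₂ ,
    (λ w d → let d₁ , d₂ = dom-comp T₁ T₂ {egr w} d
                 v , I , r = proj₁ U₁ w d₁
                 z , J , s = proj₁ U₂ v (d₂ {egr v} I)
             in z , Img-comp T₁ T₂ I J , v , gsm← M (proj₁ (prod→ (gsmM M) A r)) , s) ,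
    -- The chosen intermediate string `v'` may differ from `v`, but the product guarantees that it
    -- satisfies the domain formula of `T₂`.
    (λ w z (v , r , s) → let r' = prod← (gsmM M) A (gsm→ M r) (sem→accepting (gsmM M) A rec v (proj₂ U₂ v z s))
                             v' , I , t = proj₁ U₁ w (proj₂ U₁ w v r')
                         in comp-dom T₁ T₂ {egr w} {egr v'} I
                             (accepting→sem (gsmM M) A rec v' (proj₂ (prod→ (gsmM M) A t))))
  where
  T₂ = proj₁ (chain-unif c)
  U₂ = proj₂ (chain-unif c)
  A = proj₁ (büchi (MSOT.φdom T₂))
  rec = proj₂ (büchi (MSOT.φdom T₂))
  T₁ = compT (machT (prodM (gsmM M) A)) uniT
  U₁ = Unif-mach (prodM (gsmM M) A)

Unif-≐ : ∀ {n₁ n₂} {T : MSOT 1 n₁ 1 n₂} {m m' : Trans n₁ n₂} → m ≐ m' → Unif T m' → Unif T m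
Unif-≐ e (f , g) = (λ w d → let z , I , x = f w d in z , I , proj₂ (e w z) x) , (λ w z x → g w z (proj₁ (e w z) x))

NGSM→MSOe : ∀ {n₁ n₂} (m : Trans n₁ n₂) → (∃[ k ] (1 ≤ k × InNGSMPow k m)) × Functional m → InMSOe m
NGSM→MSOe m ((k , _ , c , e) , fun) = Unif→InMSOe (proj₁ (chain-unif c)) fun (Unif-≐ e (proj₂ (chain-unif c)))

-- Machines with positive tests as 2gsm's

outOf : ∀ {n} → Fin (suc n) → Maybe (Fin n)
outOf zero = nothing
outOf (suc a) = just a

outIx : ∀ {n} → Maybe (Fin n) → Fin (suc n)
outIx nothing = zero
outIx (just a) = suc a

outOf-Ix : ∀ {n} (o : Maybe (Fin n)) → outOf (outIx o) ≡ o
outOf-Ix nothing = refl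
outOf-Ix (just a) = refl

module _ {n₁ n₂ : ℕ} (M : Mach n₁ n₂) where
  open Mach M
  private
    st : Fin K → State
    st = Inverse.from index
    ix : State → Fin K
    ix = Inverse.to index
    st-ix : ∀ q → st (ix q) ≡ q
    st-ix = Inverse.strictlyInverseʳ index

    pattern begin = zero
    pattern final = suc zero
    pattern dead = suc (suc zero)
    pattern state k = suc (suc (suc k))

    word : Maybe (Fin n₂) → Str n₂
    word o = emit o []

    word-++ : ∀ o z → word o ++ z ≡ emit o z
    word-++ nothing z = refl
    word-++ (just a) z = refl

    Entry : Set
    Entry = Fin K × Fin (2 + n₁) × Fin (suc n₂) × Fin 3 × Fin K

    entries : List Entry
    entries = cartesianProduct (allFin K) (cartesianProduct (allFin (2 + n₁))
                (cartesianProduct (allFin (suc n₂)) (cartesianProduct (allFin 3) (allFin K))))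

    ∈-entries : ∀ e → e ∈ entries
    ∈-entries (k , τ , o , m , k') = Mem.∈-cartesianProduct⁺ (Mem.∈-allFin k) (Mem.∈-cartesianProduct⁺ (Mem.∈-allFin τ)
      (Mem.∈-cartesianProduct⁺ (Mem.∈-allFin o) (Mem.∈-cartesianProduct⁺ (Mem.∈-allFin m) (Mem.∈-allFin k'))))

    Enabled : Entry → Set
    Enabled (k , τ , o , m , k') = Tr (st k) (symOf τ) (outOf o) (moveOf m) (st k')

    enabled? : ∀ e → Dec (Enabled e)
    enabled? (k , τ , o , m , k') = Tr? (st k) (symOf τ) (outOf o) (moveOf m) (st k')

    -- An instruction of a 2gsm applies to every scanned symbol. A positive test is simulated by
    -- sending all other symbols to `dead`, which no instruction leaves. Acceptance must be possible
    -- on any symbol, hence the equal branches of `finalI`.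
    beginI finalI : Fin K → Instr (3 + K) n₁ n₂
    beginI k = record { p = begin ; σ = lend ; q₁ = state k ; α₁ = [] ; ε₁ = stay ; q₀ = dead ; α₀ = [] ; ε₀ = stay }
    finalI k = record { p = state k ; σ = lend ; q₁ = final ; α₁ = [] ; ε₁ = stay ; q₀ = final ; α₀ = [] ; ε₀ = stay }

    transI : Entry → Instr (3 + K) n₁ n₂
    transI (k , τ , o , m , k') = record
      { p = state k ; σ = symOf τ ; q₁ = state k' ; α₁ = word (outOf o) ; ε₁ = moveOf m ; q₀ = dead ; α₀ = [] ; ε₀ = stay }

    instrs : List (Instr (3 + K) n₁ n₂)
    instrs = map beginI (filter (Init? ∘ st) (allFin K)) ++
             map finalI (filter (Final? ∘ st) (allFin K)) ++ map transI (filter enabled? entries)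

    data Kind : Instr (3 + K) n₁ n₂ → Set where
      begins : ∀ k → Init (st k) → Kind (beginI k)
      finals : ∀ k → Final (st k) → Kind (finalI k)
      moves : ∀ e → Enabled e → Kind (transI e)

    kind : ∀ {ι} → ι ∈ instrs → Kind ι
    kind ι∈ with Mem.∈-++⁻ (map beginI (filter (Init? ∘ st) (allFin K))) ι∈
    ... | inj₁ m with Mem.∈-map⁻ beginI m
    ... | k , k∈ , refl = begins k (proj₂ (Mem.∈-filter⁻ (Init? ∘ st) {xs = allFin K} k∈))
    kind ι∈ | inj₂ m with Mem.∈-++⁻ (map finalI (filter (Final? ∘ st) (allFin K))) m
    ... | inj₁ m' with Mem.∈-map⁻ finalI m'
    ... | k , k∈ , refl = finals k (proj₂ (Mem.∈-filter⁻ (Final? ∘ st) {xs = allFin K} k∈))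
    kind ι∈ | inj₂ m | inj₂ m' with Mem.∈-map⁻ transI m'
    ... | e , e∈ , refl = moves e (proj₂ (Mem.∈-filter⁻ enabled? {xs = entries} e∈))

    begin∈ : ∀ k → Init (st k) → beginI k ∈ instrs
    begin∈ k i = Mem.∈-++⁺ˡ (Mem.∈-map⁺ beginI (Mem.∈-filter⁺ (Init? ∘ st) (Mem.∈-allFin k) i))

    final∈ : ∀ k → Final (st k) → finalI k ∈ instrs
    final∈ k f = Mem.∈-++⁺ʳ (map beginI (filter (Init? ∘ st) (allFin K)))
      (Mem.∈-++⁺ˡ (Mem.∈-map⁺ finalI (Mem.∈-filter⁺ (Final? ∘ st) (Mem.∈-allFin k) f)))

    trans∈ : ∀ e → Enabled e → transI e ∈ instrs
    trans∈ e t = Mem.∈-++⁺ʳ (map beginI (filter (Init? ∘ st) (allFin K)))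
      (Mem.∈-++⁺ʳ (map finalI (filter (Final? ∘ st) (allFin K)))
          (Mem.∈-map⁺ transI (Mem.∈-filter⁺ enabled? (∈-entries e) t)))

    not-final : ∀ {ι} → Kind ι → ¬ Instr.p ι ≡ final
    not-final (begins k _) ()
    not-final (finals k _) ()
    not-final (moves e _) ()

    not-dead : ∀ {ι} → Kind ι → ¬ Instr.p ι ≡ dead
    not-dead (begins k _) ()
    not-dead (finals k _) ()
    not-dead (moves e _) ()

  machGSM : TwoGSM n₁ n₂
  machGSM = record { nq = 3 + K ; δ = instrs ; qin = begin ; qf = final ; p≢qf = All.tabulate (not-final ∘ kind) }

  module _ {w : Str n₁} where
    private
      stuck : ∀ {q i z r k} → Run machGSM w q i z r k → q ≡ dead → ¬ r ≡ final
      stuck done refl ()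
      stuck (step-eq ι ι∈ _ _ _ ▸ R) e _ = not-dead (kind ι∈) e
      stuck (step-neq ι ι∈ _ _ _ _ ▸ R) e _ = not-dead (kind ι∈) e

      finished : ∀ {q i z r k} → Run machGSM w q i z r k → q ≡ final → z ≡ []
      finished done e = refl
      finished (step-eq ι ι∈ _ _ _ ▸ R) e = ⊥-elim (not-final (kind ι∈) e)
      finished (step-neq ι ι∈ _ _ _ _ ▸ R) e = ⊥-elim (not-final (kind ι∈) e)

      run→ : ∀ {q i z r k x} → Run machGSM w q i z r k → q ≡ state x → r ≡ final →
             ∃[ s ] ∃[ j ] (MRun M w (st x) i z s j × Final s)
      run→ done refl ()
      run→ (step-eq ι ι∈ sc mv on ▸ R) e f with kind ι∈ | e
      ... | finals k fin | refl with refl ← finished R refl = st k , _ , done , fin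
      ... | moves (k , τ , o , m , k') t | refl =
        let s , j , R' , fin = run→ R refl f in
        s , j , subst (λ z → MRun M w (st k) _ z s j) (≡sym (word-++ (outOf o) _)) (go sc t mv on R') , fin
      run→ (step-neq ι ι∈ sc n mv on ▸ R) e f with kind ι∈ | e
      ... | finals k fin | refl with refl ← finished R refl = st k , _ , done , fin
      ... | moves _ _ | refl = ⊥-elim (stuck R refl f)

      run← : ∀ {p i z s j} → MRun M w p i z s j → Final s → ∃[ τ ] tapeAt w i ≡ just τ → ∀ k → st k ≡ p →
             ∃[ j' ] Run machGSM w (state k) i z final j'
      run← done f (τ , on) k refl with τ ≟ˢ lend
      ... | yes refl = _ , step-eq (finalI k) (final∈ k f) on refl on ▸ done
      ... | no n = _ , step-neq (finalI k) (final∈ k f) on n refl on ▸ done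
      run← (go {i = i} {τ} {o} {m} {q} {z = z} sc t mv on R) f _ k refl =
        let e = k , symIx τ , outIx o , moveIx m , ix q
            j' , R' = run← R f (_ , on) (ix q) (st-ix q)
        in j' , subst (λ z → Run machGSM w (state k) i z final j')
            (trans (cong (λ o → word o ++ z) (outOf-Ix o)) (word-++ o z))
             (step-eq (transI e) (trans∈ e (enabled-ix t)) (trans sc (cong just (≡sym (symOf-Ix τ))))
               (trans (cong (λ m → move m i) (moveOf-Ix m)) mv) on ▸ R')
        where
        enabled-ix : Tr (st k) τ o m q → Tr (st k) (symOf (symIx τ)) (outOf (outIx o)) (moveOf (moveIx m)) (st (ix q))
        enabled-ix t rewrite symOf-Ix τ | outOf-Ix o | moveOf-Ix m | st-ix q = t

    machGSM→ : ∀ {z} → Realizes machGSM w z → MRel M w z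
    machGSM→ (k , R) = begins→ R refl refl refl
      where
      begins→ : ∀ {q i z r k} → Run machGSM w q i z r k → q ≡ begin → i ≡ 0 → r ≡ final → MRel M w z
      begins→ done refl _ ()
      begins→ (step-eq ι ι∈ sc mv on ▸ R) e refl f with kind ι∈ | e
      ... | begins k ini | _ with refl ← mv = let s , j , R' , fin = run→ R refl f in st k , s , j , ini , R' , fin
      begins→ (step-neq ι ι∈ sc n mv on ▸ R) e i f with kind ι∈ | e
      ... | begins k ini | _ = ⊥-elim (stuck R refl f)

    machGSM← : ∀ {z} → MRel M w z → Realizes machGSM w z
    machGSM← (p , r , k , ini , R , fin) =
      let j , R' = run← R fin (lend , refl) (ix p) (st-ix p)
      in j , step-eq (beginI (ix p)) (begin∈ (ix p) (subst Init (≡sym (st-ix p)) ini)) refl refl refl ▸ R'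

dec↔ : ∀ {A : Set} {K} → A ↔ Fin K → (x y : A) → Dec (x ≡ y)
dec↔ i x y = map′ (λ e → trans (≡sym (Inverse.strictlyInverseʳ i x))
                       (trans (cong (Inverse.from i) e) (Inverse.strictlyInverseʳ i y)))
               (cong (Inverse.to i)) (Inverse.to i x Fin.≟ Inverse.to i y)

any↔ : ∀ {A : Set} {K} → A ↔ Fin K → {P : A → Set} → (∀ x → Dec (P x)) → Dec (∃ P)
any↔ i {P} P? = map′ (λ (k , p) → Inverse.from i k , p)
  (λ (x , p) → Inverse.to i x , subst P (≡sym (Inverse.strictlyInverseʳ i x)) p) (Fin.any? (P? ∘ Inverse.from i))

nth-map : ∀ {A B : Set} (f : A → B) l k {a} → nth l k ≡ just a → nth (map f l) k ≡ just (f a)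
nth-map f (a ∷ l) zero refl = refl
nth-map f (a ∷ l) (suc k) e = nth-map f l k e

map-nth : ∀ {A B : Set} (f : A → B) l k {b} → nth (map f l) k ≡ just b → ∃[ a ] (nth l k ≡ just a × b ≡ f a)
map-nth f (a ∷ l) zero refl = a , refl , refl
map-nth f (a ∷ l) (suc k) e = map-nth f l k e

letters : ∀ {n} → Str n → List (Fin (suc n))
letters [] = zero ∷ []
letters (a ∷ w) = suc a ∷ letters w

length-letters : ∀ {n} (w : Str n) → length (letters w) ≡ suc (length w)
length-letters [] = refl
length-letters (a ∷ w) = cong suc (length-letters w)

-- The set variables select the question: set `r` is the singleton of the first marked node and all
-- other sets are empty. A single automaton thus answers all `R` queries.
mark : ∀ {R} → Fin R → Bool → Bool → Bits 2 R
mark r x y = x ∷ᵛ (y ∷ᵛ []ᵛ) , tabulate (λ r' → x ∧ (r' == r))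

unmarked target : ∀ {R} → Bits 2 R
unmarked = false ∷ᵛ (false ∷ᵛ []ᵛ) , tabulate (λ _ → false)
target = false ∷ᵛ (true ∷ᵛ []ᵛ) , tabulate (λ _ → false)

-- From MSO transductions to two-way machines

-- Every node of the word is annotated with its letter, the state in which the automaton reaches it,
-- and the set of states from which the automaton accepts what follows it (all positions unmarked).
module Annotation {n R : ℕ} (A : Aut n 2 R) where
  open Aut A

  δ∅ : Q → Fin (suc n) → Q
  δ∅ q ℓ = δ q ℓ unmarked

  Ann : Set
  Ann = Fin (suc n) × Q × Vec Bool K

  nA : ℕ
  nA = suc n * (K * 2 ^ K)

  ann↔ : Ann ↔ Fin nA
  ann↔ = ↔-sym Fin.*↔× ↔-∘ (↔-id _ ×.×-↔ (↔-sym Fin.*↔× ↔-∘ (index ×.×-↔ vec↔ K)))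

  enc : Ann → Fin nA
  enc = Inverse.to ann↔

  dec : Fin nA → Ann
  dec = Inverse.from ann↔

  dec-enc : ∀ e → dec (enc e) ≡ e
  dec-enc = Inverse.strictlyInverseʳ ann↔

  accSet : Vec Bool K
  accSet = mkSet acc

  pred : Fin (suc n) → Vec Bool K → Vec Bool K
  pred ℓ S = mkSet (λ q → mem S (δ∅ q ℓ))

  suffixSet : List (Fin (suc n)) → Vec Bool K
  suffixSet [] = accSet
  suffixSet (ℓ ∷ l) = pred ℓ (suffixSet l)

  annot : Q → List (Fin (suc n)) → List Ann
  annot q [] = []
  annot q (ℓ ∷ l) = (ℓ , q , suffixSet l) ∷ annot (δ∅ q ℓ) l

  annotW : Str n → Str nA
  annotW w = map enc (annot q₀ (letters w))

  private
    St : Set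
    St = Fin 1 ⊎ ((Q × Vec Bool K) ⊎ Fin 1)
    pattern begin = inj₁ zero
    pattern run′ q S = inj₂ (inj₁ (q , S))
    pattern end = inj₂ (inj₂ zero)

    st↔ : St ↔ Fin (1 + (K * 2 ^ K + 1))
    st↔ = ↔-sym Fin.+↔⊎ ↔-∘ (↔-id _ ⊎.⊎-↔ (↔-sym Fin.+↔⊎ ↔-∘ ((↔-sym Fin.*↔× ↔-∘ (index ×.×-↔ vec↔ K)) ⊎.⊎-↔ ↔-id _)))

    -- The forward state is computed, the suffix set is guessed. `S` is a claim about the suffix at
    -- the head; each step guesses the claim for the next position and checks the two against each
    -- other by `pred`, and the right end marker settles the last one. Nondeterminism replaces a
    -- pass from right to left, yet the annotation is unique.
    Tr₁ : St → TSym n → Maybe (Fin nA) → Move → St → Set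
    Tr₁ begin lend o m q = o ≡ nothing × m ≡ right × ∃[ S ] q ≡ run′ q₀ S
    Tr₁ begin rend o m q = ⊥
    Tr₁ begin (sym a) o m q = ⊥
    Tr₁ (run′ p S) lend o m q = ⊥
    -- The right end marker stands for the last node of the word graph, so the output is one letter
    -- longer than the input.
    Tr₁ (run′ p S) rend o m q = o ≡ just (enc (zero , p , accSet)) × m ≡ stay × q ≡ end × S ≡ pred zero accSet
    Tr₁ (run′ p S) (sym a) o m q = m ≡ right ×
      ∃[ S' ] (o ≡ just (enc (suc a , p , S')) × q ≡ run′ (δ∅ p (suc a)) S' × S ≡ pred (suc a) S')
    Tr₁ end τ o m q = ⊥

    Tr₁? : ∀ p τ o m q → Dec (Tr₁ p τ o m q)
    Tr₁? begin lend o m q = (o ≟ᵒ nothing) ×-dec (m ≟ᵐ right) ×-dec any↔ (vec↔ K) (λ S → dec↔ st↔ q (run′ q₀ S))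
    Tr₁? begin rend o m q = no λ ()
    Tr₁? begin (sym a) o m q = no λ ()
    Tr₁? (run′ p S) lend o m q = no λ ()
    Tr₁? (run′ p S) rend o m q = (o ≟ᵒ _) ×-dec (m ≟ᵐ stay) ×-dec dec↔ st↔ q end ×-dec dec↔ (vec↔ K) S _
    Tr₁? (run′ p S) (sym a) o m q = (m ≟ᵐ right) ×-dec any↔ (vec↔ K) λ S' →
      (o ≟ᵒ _) ×-dec dec↔ st↔ q _ ×-dec dec↔ (vec↔ K) S _
    Tr₁? end τ o m q = no λ ()

  annotM : Mach n nA
  annotM = record { State = St ; K = _ ; index = st↔ ; Tr = Tr₁ ; Tr? = Tr₁? ; Init = _≡ begin ; Final = _≡ end
                  ; Init? = λ p → dec↔ st↔ p begin ; Final? = λ p → dec↔ st↔ p end }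

  module _ {w : Str n} where
    private
      Suffix : Str n → ℕ → Set
      Suffix u i = ∀ k → tapeAt w (k + i) ≡ tapeSym u k

      Suffix-suc : ∀ {a u i} → Suffix (a ∷ u) i → Suffix u (suc i)
      Suffix-suc {i = i} h k = trans (cong (tapeAt w) (ℕ.+-suc k i)) (h (suc k))

      run← : ∀ u i q → Suffix u i →
             ∃[ j ] MRun annotM w (run′ q (suffixSet (letters u))) i (map enc (annot q (letters u))) end j
      run← [] i q h = i , go {o = just _} (h 0) (refl , refl , refl , refl) refl (h 0) done
      run← (a ∷ u) i q h =
        let j , R = run← u (suc i) (δ∅ q (suc a)) (Suffix-suc h)
            τ , on = tapeSym-total u zero
        in j , go {o = just _} (h 0) (refl , suffixSet (letters u) , refl , refl , refl) refl (trans (Suffix-suc h 0) on) R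

      run→ : ∀ {q S i v j} u → Suffix u i → MRun annotM w (run′ q S) i v end j →
             v ≡ map enc (annot q (letters u)) × S ≡ suffixSet (letters u)
      run→ [] h (go sc t mv on R) with Maybe.just-injective (trans (≡sym sc) (h 0))
      run→ [] h (go sc (refl , refl , refl , refl) mv on R) | refl with R
      ... | done = refl , refl
      run→ (a ∷ u) h (go sc t mv on R) with Maybe.just-injective (trans (≡sym sc) (h 0))
      run→ (a ∷ u) h (go sc (refl , S' , refl , refl , refl) refl on R) | refl =
        let e , e' = run→ u (Suffix-suc h) R in
        cong₂ (λ S v → enc (suc a , _ , S) ∷ v) e' e , cong (pred (suc a)) e'

    annotM→ : ∀ {v} → MRel annotM w v → v ≡ annotW w
    annotM→ (p , r , k , refl , go {τ = lend} sc (refl , refl , S , refl) refl on R , refl) =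
      proj₁ (run→ w (λ k → trans (cong (tapeAt w) (ℕ.+-comm k 1)) (tapeAt≡ w k)) R)

    annotM← : MRel annotM w (annotW w)
    annotM← =
      let h = λ k → trans (cong (tapeAt w) (ℕ.+-comm k 1)) (tapeAt≡ w k)
          j , R = run← w 1 q₀ h
          τ , on = tapeSym-total w zero
      in begin , end , j , refl , go {o = nothing} {j = 1} refl (refl , refl , _ , refl) refl (trans (h 0) on) R , refl

  -- β is indexed by absolute positions, and l starts at position k.
  accFrom : List (Fin (suc n)) → ℕ → (ℕ → Bits 2 R) → Q → Bool
  accFrom [] k β q = acc q
  accFrom (ℓ ∷ l) k β q = accFrom l (suc k) β (δ q ℓ (β k))

  accFrom-unmarked : ∀ l {k β} q → (∀ j → k ≤ j → β j ≡ unmarked) → accFrom l k β q ≡ mem (suffixSet l) q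
  accFrom-unmarked [] q h = ≡sym (mem-mkSet acc q)
  accFrom-unmarked (ℓ ∷ l) {k} {β} q h =
    trans (accFrom-unmarked l (δ q ℓ (β k)) (λ j l → h j (ℕ.<⇒≤ l)))
      (trans (cong (λ b → mem (suffixSet l) (δ q ℓ b)) (h k ℕ.≤-refl))
          (≡sym (mem-mkSet (λ q → mem (suffixSet l) (δ∅ q ℓ)) q)))

  drop′ : ℕ → List (Fin (suc n)) → List (Fin (suc n))
  drop′ zero l = l
  drop′ (suc k) [] = []
  drop′ (suc k) (ℓ ∷ l) = drop′ k l

  annot-drop : ∀ q l k {ℓ p S} → nth (annot q l) k ≡ just (ℓ , p , S) → drop′ k l ≡ ℓ ∷ drop′ (suc k) l ×
               S ≡ suffixSet (drop′ (suc k) l)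
  annot-drop q (ℓ ∷ l) zero refl = refl , refl
  annot-drop q (ℓ ∷ l) (suc k) e = annot-drop (δ∅ q ℓ) l k e

  annot-state : ∀ q l k i {ℓ p S β} → nth (annot q l) k ≡ just (ℓ , p , S) → (∀ j → i ≤ j → j < k + i → β j ≡ unmarked) →
                accFrom l i β q ≡ accFrom (drop′ k l) (k + i) β p
  annot-state q (ℓ ∷ l) zero i refl h = refl
  annot-state q (ℓ ∷ l) (suc k) i {ℓ'} {p} {S} {β} e h =
    trans (cong (λ b → accFrom l (suc i) β (δ q ℓ b)) (h i ℕ.≤-refl (s≤s (ℕ.m≤n+m i k))))
      (trans (annot-state (δ∅ q ℓ) l k (suc i) e (λ j i≤ j< → h j (ℕ.<⇒≤ i≤) (ℕ.≤-trans j< (ℕ.≤-reflexive (ℕ.+-suc k i)))))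
        (cong (λ m → accFrom (drop′ k l) m β p) (ℕ.+-suc k i)))

  annot-total : ∀ q l {k} → k < length l → ∃[ e ] nth (annot q l) k ≡ just e
  annot-total q (ℓ ∷ l) {zero} _ = _ , refl
  annot-total q (ℓ ∷ l) {suc k} (s≤s l<) = annot-total (δ∅ q ℓ) l l<

  annot-bound : ∀ q l {k e} → nth (annot q l) k ≡ just e → k < length l
  annot-bound q (ℓ ∷ l) {zero} _ = s≤s z≤n
  annot-bound q (ℓ ∷ l) {suc k} e = s≤s (annot-bound (δ∅ q ℓ) l e)

  module Marked (w : Str n) where
    ls = letters w

    node : ℕ → Ann → Set
    node k e = nth (annot q₀ ls) k ≡ just e

    marks : Fin R → ℕ → ℕ → ℕ → Bits 2 R
    marks r x y j = mark r (j ≡ᵇ x) (j ≡ᵇ y)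

    Sat : Fin R → ℕ → ℕ → Set
    Sat r x y = accFrom ls 0 (marks r x y) q₀ ≡ true

    private
      ≡ᵇ-refl : ∀ k → (k ≡ᵇ k) ≡ true
      ≡ᵇ-refl k = ≡ᵇ-intro {k} refl

      ≢→≡ᵇ : ∀ {j k} → j ≢ k → (j ≡ᵇ k) ≡ false
      ≢→≡ᵇ {j} {k} n with j ≡ᵇ k in e
      ... | false = refl
      ... | true = ⊥-elim (n (≡ᵇ-true e))

      marks≡ : ∀ r x y j {b c} → (j ≡ᵇ x) ≡ b → (j ≡ᵇ y) ≡ c → marks r x y j ≡ mark r b c
      marks≡ r x y j refl refl = refl

      clear : ∀ r x y {j} → j ≢ x → j ≢ y → marks r x y j ≡ unmarked
      clear r x y {j} n n' = marks≡ r x y j (≢→≡ᵇ n) (≢→≡ᵇ n')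

    rest : ℕ → (ℕ → Bits 2 R) → Q → Bool
    rest k β q = accFrom (drop′ k ls) k β q

    rest-step : ∀ {k ℓ p S} β q → node k (ℓ , p , S) → rest k β q ≡ rest (suc k) β (δ q ℓ (β k))
    rest-step {k} β q e = cong (λ l → accFrom l k β q) (proj₁ (annot-drop q₀ ls k e))

    rest-mem : ∀ {k ℓ p S} β q → node k (ℓ , p , S) → (∀ j → suc k ≤ j → β j ≡ unmarked) → rest (suc k) β q ≡ mem S q
    rest-mem {k} β q e h = trans (accFrom-unmarked (drop′ (suc k) ls) q h)
        (cong (λ S → mem S q) (≡sym (proj₂ (annot-drop q₀ ls k e))))

    rest-state : ∀ {k ℓ p S} β → node k (ℓ , p , S) → (∀ j → j < k → β j ≡ unmarked) → accFrom ls 0 β q₀ ≡ rest k β p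
    rest-state {k} β e h = trans (annot-state q₀ ls k 0 e (λ j _ l → h j (ℕ.≤-trans l (ℕ.≤-reflexive (ℕ.+-identityʳ k)))))
      (cong (λ m → accFrom (drop′ k ls) m β _) (ℕ.+-identityʳ k))

    module _ (r : Fin R) (x y : ℕ) where
      private
        β = marks r x y

      -- The annotated state accounts for all that precedes the node and the annotated set for all
      -- that follows; only one transition depends on the marks. With two marked nodes the stretch
      -- between them has to be crossed as well, in one direction or the other.
      sat-same : ∀ {ℓ p S} → x ≡ y → node x (ℓ , p , S) → accFrom ls 0 β q₀ ≡ mem S (δ p ℓ (mark r true true))
      sat-same {ℓ} {p} {S} refl e =
        trans (rest-state β e (λ j l → clear r x y (ℕ.<⇒≢ l) (ℕ.<⇒≢ l)))
          (trans (rest-step β p e) (trans (rest-mem β _ e (λ j l → clear r x y (ℕ.>⇒≢ l) (ℕ.>⇒≢ l)))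
            (cong (λ b → mem S (δ p ℓ b)) (marks≡ r x x x (≡ᵇ-refl x) (≡ᵇ-refl x)))))

      right-start : ∀ {ℓ p S} → x < y → node x (ℓ , p , S) → accFrom ls 0 β q₀ ≡ rest (suc x) β (δ p ℓ (mark r true false))
      right-start {ℓ} {p} l e =
        trans (rest-state β e (λ j l' → clear r x y (ℕ.<⇒≢ l') (ℕ.<⇒≢ (ℕ.<-trans l' l))))
          (trans (rest-step β p e) (cong (λ b → rest (suc x) β (δ p ℓ b)) (marks≡ r x y x (≡ᵇ-refl x) (≢→≡ᵇ (ℕ.<⇒≢ l)))))

      between : ∀ {k ℓ p S} q → k ≢ x → k ≢ y → node k (ℓ , p , S) → rest k β q ≡ rest (suc k) β (δ∅ q ℓ)
      between {k} {ℓ} q n n' e = trans (rest-step β q e) (cong (λ b → rest (suc k) β (δ q ℓ b)) (clear r x y n n'))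

      right-end : ∀ {ℓ p S} q → x < y → node y (ℓ , p , S) → rest y β q ≡ mem S (δ q ℓ target)
      right-end {ℓ} {p} {S} q l e =
        trans (rest-step β q e) (trans (rest-mem β _ e (λ j l' → clear r x y (ℕ.>⇒≢ (ℕ.<-trans l l')) (ℕ.>⇒≢ l')))
          (cong (λ b → mem S (δ q ℓ b)) (marks≡ r x y y (≢→≡ᵇ (ℕ.>⇒≢ l)) (≡ᵇ-refl y))))

      left-start : ∀ {ℓ p S} q → y < x → node x (ℓ , p , S) → rest x β q ≡ mem S (δ q ℓ (mark r true false))
      left-start {ℓ} {p} {S} q l e =
        trans (rest-step β q e) (trans (rest-mem β _ e (λ j l' → clear r x y (ℕ.>⇒≢ l') (ℕ.>⇒≢ (ℕ.<-trans l l'))))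
          (cong (λ b → mem S (δ q ℓ b)) (marks≡ r x y x (≡ᵇ-refl x) (≢→≡ᵇ (ℕ.>⇒≢ l)))))

      left-end : ∀ {ℓ p S} → y < x → node y (ℓ , p , S) → accFrom ls 0 β q₀ ≡ rest (suc y) β (δ p ℓ target)
      left-end {ℓ} {p} l e =
        trans (rest-state β e (λ j l' → clear r x y (ℕ.<⇒≢ (ℕ.<-trans l' l)) (ℕ.<⇒≢ l')))
          (trans (rest-step β p e) (cong (λ b → rest (suc y) β (δ p ℓ b)) (marks≡ r x y y (≢→≡ᵇ (ℕ.<⇒≢ l)) (≡ᵇ-refl y))))

-- The walker M moves along the edges of an image graph, given by predicates on marked positions: the
-- query edgeQ c γ c' marked at (x , y) asks for an edge labelled γ from copy c of x to copy c' of y.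
-- Going right to y it carries the state of the automaton; going left it guesses the run backwards and
-- compares it at y with the annotated state.
module Walker {n₁ n₂ R : ℕ} (A : Aut n₁ 2 R) (nc : ℕ) (startQ finalQ : Fin nc → Fin R)
              (edgeQ : Fin nc → Fin n₂ → Fin nc → Fin R) where
  open Aut A
  open Annotation A

  private
    Goto : Set
    Goto = Q × (Fin n₂ × Fin nc)

    St : Set
    St = Fin 1 ⊎ (Fin nc ⊎ (Goto ⊎ (Goto ⊎ Fin 1)))
    pattern seek = inj₁ zero
    pattern stand c = inj₂ (inj₁ c)
    pattern goRight s γ c = inj₂ (inj₂ (inj₁ (s , γ , c)))
    pattern goLeft s γ c = inj₂ (inj₂ (inj₂ (inj₁ (s , γ , c))))
    pattern end = inj₂ (inj₂ (inj₂ (inj₂ zero)))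

    goto↔ : Goto ↔ Fin (K * (n₂ * nc))
    goto↔ = ↔-sym Fin.*↔× ↔-∘ (index ×.×-↔ ↔-sym Fin.*↔×)

    _⊎↔_ : ∀ {A B : Set} {m k} → A ↔ Fin m → B ↔ Fin k → (A ⊎ B) ↔ Fin (m + k)
    i ⊎↔ j = ↔-sym Fin.+↔⊎ ↔-∘ (i ⊎.⊎-↔ j)

    st↔ : St ↔ Fin (1 + (nc + (K * (n₂ * nc) + (K * (n₂ * nc) + 1))))
    st↔ = ↔-id _ ⊎↔ (↔-id _ ⊎↔ (goto↔ ⊎↔ (goto↔ ⊎↔ ↔-id _)))

    at-both at-source : Ann → Fin R → Q → Bool
    at-both (ℓ , _ , S) r p = mem S (δ p ℓ (mark r true true))
    at-source (ℓ , _ , S) r s = mem S (δ s ℓ (mark r true false))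

    -- The letter and the target copy are guessed on departure, but the letter is emitted only on
    -- arrival.
    Act : St → Ann → Maybe (Fin n₂) → Move → St → Set
    Act seek e@(ℓ , p , S) o m q =
      (o ≡ nothing × m ≡ right × q ≡ seek) ⊎
      (o ≡ nothing × m ≡ stay × ∃[ c ] (q ≡ stand c × at-both e (startQ c) p ≡ true))
    Act (stand c) e@(ℓ , p , S) o m q =
      (o ≡ nothing × m ≡ stay × q ≡ end × at-both e (finalQ c) p ≡ true) ⊎
      ∃[ γ ] ∃[ c' ]
        ((o ≡ just γ × m ≡ stay × q ≡ stand c' × at-both e (edgeQ c γ c') p ≡ true) ⊎
         (o ≡ nothing × m ≡ right × q ≡ goRight (δ p ℓ (mark (edgeQ c γ c') true false)) γ c') ⊎
         -- `s` guesses the state in which the automaton reaches the source after having met the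
         -- target mark further left.
         (o ≡ nothing × m ≡ left × ∃[ s ] (q ≡ goLeft s γ c' × at-source e (edgeQ c γ c') s ≡ true)))
    Act (goRight s γ c') (ℓ , p , S) o m q =
      (o ≡ nothing × m ≡ right × q ≡ goRight (δ∅ s ℓ) γ c') ⊎
      (o ≡ just γ × m ≡ stay × q ≡ stand c' × mem S (δ s ℓ target) ≡ true)
    Act (goLeft s γ c') (ℓ , p , S) o m q =
      (o ≡ nothing × m ≡ left × ∃[ s' ] (q ≡ goLeft s' γ c' × δ∅ s' ℓ ≡ s)) ⊎
      -- In `goLeft s` the state `s` is the one after the scanned node, so at the target it must be
      -- the transition from the annotated state.
      (o ≡ just γ × m ≡ stay × q ≡ stand c' × δ p ℓ target ≡ s)
    Act end e o m q = ⊥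

    Act? : ∀ p e o m q → Dec (Act p e o m q)
    Act? seek e o m q =
      ((o ≟ᵒ nothing) ×-dec (m ≟ᵐ right) ×-dec dec↔ st↔ q seek) ⊎-dec
      ((o ≟ᵒ nothing) ×-dec (m ≟ᵐ stay) ×-dec Fin.any? λ c → dec↔ st↔ q (stand c) ×-dec (_ Bool.≟ true))
    Act? (stand c) e@(ℓ , p , S) o m q =
      ((o ≟ᵒ nothing) ×-dec (m ≟ᵐ stay) ×-dec dec↔ st↔ q end ×-dec (_ Bool.≟ true)) ⊎-dec
      (Fin.any? λ γ → Fin.any? λ c' →
        ((o ≟ᵒ just γ) ×-dec (m ≟ᵐ stay) ×-dec dec↔ st↔ q (stand c') ×-dec (_ Bool.≟ true)) ⊎-dec
        ((o ≟ᵒ nothing) ×-dec (m ≟ᵐ right) ×-dec dec↔ st↔ q _) ⊎-dec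
        ((o ≟ᵒ nothing) ×-dec (m ≟ᵐ left) ×-dec any↔ index λ s → dec↔ st↔ q (goLeft s γ c') ×-dec (_ Bool.≟ true)))
    Act? (goRight s γ c') (ℓ , p , S) o m q =
      ((o ≟ᵒ nothing) ×-dec (m ≟ᵐ right) ×-dec dec↔ st↔ q (goRight (δ∅ s ℓ) γ c')) ⊎-dec
      ((o ≟ᵒ just γ) ×-dec (m ≟ᵐ stay) ×-dec dec↔ st↔ q (stand c') ×-dec (_ Bool.≟ true))
    Act? (goLeft s γ c') (ℓ , p , S) o m q =
      ((o ≟ᵒ nothing) ×-dec (m ≟ᵐ left) ×-dec any↔ index λ s' → dec↔ st↔ q (goLeft s' γ c') ×-dec dec↔ index _ s) ⊎-dec
      ((o ≟ᵒ just γ) ×-dec (m ≟ᵐ stay) ×-dec dec↔ st↔ q (stand c') ×-dec dec↔ index _ s)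
    Act? end e o m q = no λ ()

    Tr₂ : St → TSym nA → Maybe (Fin n₂) → Move → St → Set
    Tr₂ p lend o m q = p ≡ seek × o ≡ nothing × m ≡ right × q ≡ seek
    Tr₂ p rend o m q = ⊥
    Tr₂ p (sym t) o m q = Act p (dec t) o m q

    Tr₂? : ∀ p τ o m q → Dec (Tr₂ p τ o m q)
    Tr₂? p lend o m q = dec↔ st↔ p seek ×-dec (o ≟ᵒ nothing) ×-dec (m ≟ᵐ right) ×-dec dec↔ st↔ q seek
    Tr₂? p rend o m q = no λ ()
    Tr₂? p (sym t) o m q = Act? p (dec t) o m q

  walkM : Mach nA n₂
  walkM = record { State = St ; K = _ ; index = st↔ ; Tr = Tr₂ ; Tr? = Tr₂? ; Init = _≡ seek ; Final = _≡ end
                 ; Init? = λ p → dec↔ st↔ p seek ; Final? = λ p → dec↔ st↔ p end }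

  module _ (w : Str n₁) where
    open Marked w
    private
      N = length ls
      v = annotW w

      tape→ : ∀ i τ → tapeAt v i ≡ just τ → (i ≡ 0 × τ ≡ lend) ⊎ τ ≡ rend ⊎
              ∃[ k ] ∃[ e ] (i ≡ suc k × τ ≡ sym (enc e) × node k e)
      tape→ zero _ refl = inj₁ (refl , refl)
      tape→ (suc k) lend h = ⊥-elim (tapeSym-lend v k (trans (≡sym (tapeAt≡ v k)) h))
      tape→ (suc k) rend h = inj₂ (inj₁ refl)
      tape→ (suc k) (sym t) h = let e , nd , eq = map-nth enc (annot q₀ ls) k
                                      (tapeSym-letter v k (trans (≡sym (tapeAt≡ v k)) h))
                                in inj₂ (inj₂ (k , e , refl , cong sym eq , nd))

      tape← : ∀ {k e} → node k e → tapeAt v (suc k) ≡ just (sym (enc e))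
      tape← {k} nd = trans (tapeAt≡ v k) (letter-tapeSym v k (nth-map enc (annot q₀ ls) k nd))

      at-node : ∀ p e o m q → Act p e o m q → Tr₂ p (sym (enc e)) o m q
      at-node p e o m q = subst (λ e → Act p e o m q) (≡sym (dec-enc e))

      node-at : ∀ {k} → k < N → ∃[ e ] node k e
      node-at = annot-total q₀ ls

      bound : ∀ {k e} → node k e → k < N
      bound = annot-bound q₀ ls

    data Trip : ℕ → Fin nc → Str n₂ → Set where
      stop : ∀ {x c} → Sat (finalQ c) x x → Trip x c []
      _∷_  : ∀ {x c γ c' y z} → y < N × Sat (edgeQ c γ c') x y → Trip y c' z → Trip x c (γ ∷ z)

    private
      at-end-only : ∀ {i z j} → MRun walkM v end i z end j → z ≡ []
      at-end-only done = refl
      at-end-only (go {i = i} {τ} sc t mv on R) with tape→ i τ sc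
      ... | inj₁ (refl , refl) with () ← proj₁ t
      ... | inj₂ (inj₁ refl) with () ← t
      ... | inj₂ (inj₂ (k , e , refl , refl , nd)) with () ← t

      from-node : ∀ p e o m q → Tr₂ p (sym (enc e)) o m q → Act p e o m q
      from-node p e o m q = subst (λ e → Act p e o m q) (dec-enc e)

      Arrival : Fin R → ℕ → Fin n₂ → Fin nc → Str n₂ → Set
      Arrival r x γ c' z = ∃[ z' ] ∃[ y ] (z ≡ γ ∷ z' × (y < N × Sat r x y) × Trip y c' z')

      arrive : ∀ {x c γ c' z} → Arrival (edgeQ c γ c') x γ c' z → Trip x c z
      arrive (z' , y , refl , s , t) = s ∷ t

    mutual
      stand→ : ∀ {c x z j} → MRun walkM v (stand c) (suc x) z end j → Trip x c z
      stand→ {c} (go {i = i} {τ} {o} {m} {q} sc t mv on R) with tape→ i τ sc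
      ... | inj₁ (() , _)
      ... | inj₂ (inj₁ refl) with () ← t
      ... | inj₂ (inj₂ (x , e , refl , refl , nd)) with from-node (stand c) e o m q t
      ... | inj₁ (refl , refl , refl , a) with refl ← at-end-only R = stop (trans (sat-same _ x x refl nd) a)
      ... | inj₂ (γ , c' , inj₁ (refl , refl , refl , a)) with refl ← mv =
        (bound nd , trans (sat-same _ x x refl nd) a) ∷ stand→ R
      ... | inj₂ (γ , c' , inj₂ (inj₁ (refl , refl , refl))) with refl ← mv =
        arrive (right→ x ℕ.≤-refl (λ y l → right-start _ x y l nd) R)
      ... | inj₂ (γ , c' , inj₂ (inj₂ (refl , refl , s , refl , a))) with refl ← mv =
        arrive (left→ x (λ { k refl → ℕ.≤-refl , λ y l → trans (left-start _ x y s (s≤s l) nd) a }) R)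

      -- The target is unknown until the machine stops, so the invariant covers all targets not yet
      -- passed.
      right→ : ∀ {r s γ c' k z j} x → x < k → (∀ y → k ≤ y → accFrom ls 0 (marks r x y) q₀ ≡ rest k (marks r x y) s) →
               MRun walkM v (goRight s γ c') (suc k) z end j → Arrival r x γ c' z
      right→ {r} {s} {γ} {c'} x l inv (go {i = i} {τ} {o} {m} {q} sc t mv on R) with tape→ i τ sc
      ... | inj₁ (() , _)
      ... | inj₂ (inj₁ refl) with () ← t
      ... | inj₂ (inj₂ (k , e , refl , refl , nd)) with from-node (goRight s γ c') e o m q t
      ... | inj₁ (refl , refl , refl) with refl ← mv =
        right→ x (ℕ.m<n⇒m<1+n l) (λ y l' → trans (inv y (ℕ.<⇒≤ l')) (between r x y s (ℕ.>⇒≢ l) (ℕ.<⇒≢ l') nd)) R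
      ... | inj₂ (refl , refl , refl , a) with refl ← mv =
        _ , k , refl , (bound nd , trans (inv k ℕ.≤-refl) (trans (right-end r x k s l nd) a)) , stand→ R

      -- The head may run onto the left end marker, where the machine is stuck. The invariant is
      -- therefore conditional on `i ≡ suc k`; it says that the guess leads to acceptance for every
      -- target still ahead.
      left→ : ∀ {r s γ c' i z j} x → (∀ k → i ≡ suc k → k < x × (∀ y → y ≤ k → rest (suc k) (marks r x y) s ≡ true)) →
              MRun walkM v (goLeft s γ c') i z end j → Arrival r x γ c' z
      left→ {r} {s} {γ} {c'} x inv (go {i = i} {τ} {o} {m} {q} sc t mv on R) with tape→ i τ sc
      ... | inj₁ (refl , refl) with () ← proj₁ t
      ... | inj₂ (inj₁ refl) with () ← t
      ... | inj₂ (inj₂ (k , e , refl , refl , nd)) with from-node (goLeft s γ c') e o m q t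
      ... | inj₁ (refl , refl , s' , refl , refl) with refl ← mv =
        left→ x (λ { k' refl → let l , h = inv k refl in ℕ.<-trans (ℕ.n<1+n k') l ,
                    λ y l' → trans (between r x y s' (ℕ.<⇒≢ l) (ℕ.>⇒≢ (s≤s l')) nd) (h y (ℕ.m≤n⇒m≤1+n l')) }) R
      ... | inj₂ (refl , refl , refl , refl) with refl ← mv =
        let l , h = inv k refl in
        _ , k , refl , (bound nd , trans (left-end r x k l nd) (h k ℕ.≤-refl)) , stand→ R

    Accepted : Str n₂ → Set
    Accepted z = ∃[ x ] ∃[ c ] (x < N × Sat (startQ c) x x × Trip x c z)

    private
      seek→ : ∀ {i z j} → MRun walkM v seek i z end j → Accepted z
      seek→ (go {i = i} {τ} {o} {m} {q} sc t mv on R) with tape→ i τ sc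
      ... | inj₁ (refl , refl) with (_ , refl , refl , refl) ← t = seek→ R
      ... | inj₂ (inj₁ refl) with () ← t
      ... | inj₂ (inj₂ (x , e , refl , refl , nd)) with from-node seek e o m q t
      ... | inj₁ (refl , refl , refl) = seek→ R
      ... | inj₂ (refl , refl , c , refl , a) with refl ← mv =
        x , c , bound nd , trans (sat-same _ x x refl nd) a , stand→ R

      Reaches : St → ℕ → Str n₂ → Set
      Reaches p i z = ∃[ j ] MRun walkM v p i z end j

      step : ∀ p q o m {k k' e e' z} → node k e → Act p e o m q → move m (suc k) ≡ just (suc k') → node k' e' →
             Reaches q (suc k') z → Reaches p (suc k) (emit o z)
      step p q o m {e = e} nd a mv nd' (j , R) = j , go {o = o} {m} (tape← nd) (at-node p e o m q a) mv (tape← nd') R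

      stay-step : ∀ p q o {x e z} → node x e → Act p e o stay q → Reaches q (suc x) z → Reaches p (suc x) (emit o z)
      stay-step p q o nd a = step p q o stay nd a refl nd

      right← : ∀ {r x y γ c' z} s → Sat r x y → y < N → Reaches (stand c') (suc y) z → ∀ d k → d + k ≡ y → x < k →
               accFrom ls 0 (marks r x y) q₀ ≡ rest k (marks r x y) s → Reaches (goRight s γ c') (suc k) (γ ∷ z)
      right← {r} {x} {y} {γ} {c'} s sat y< R zero k refl l inv =
        let e , nd = node-at y< in
        stay-step (goRight s γ c') (stand c') (just γ) nd (inj₂
            (refl , refl , refl , trans (≡sym (trans inv (right-end r x y s l nd))) sat)) R
      right← {r} {x} {y} {γ} {c'} s sat y< R (suc d) k refl l inv =
        let e , nd = node-at (ℕ.≤-<-trans (ℕ.m≤n+m k (suc d)) y<)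
            e' , nd' = node-at (ℕ.≤-<-trans (s≤s (ℕ.m≤n+m k d)) y<)
        in step (goRight s γ c') (goRight (δ∅ s (proj₁ e)) γ c') nothing right nd (inj₁ (refl , refl , refl)) refl nd'
             (right← {r} {x} {y} _ sat y< R d (suc k) (ℕ.+-suc d k) (ℕ.m<n⇒m<1+n l)
               (trans inv (between r x y s (ℕ.>⇒≢ l) (ℕ.<⇒≢ (s≤s (ℕ.m≤n+m k d))) nd)))

      -- The right guesses are the states of the true run from the target towards the source. The
      -- recursion thus starts at the target and prepends moves on the source side.
      left← : ∀ {r x y γ c' z} → x < N → Reaches (stand c') (suc y) z → ∀ d k → d + y ≡ k → k < x →
              ∃[ s ] (accFrom ls 0 (marks r x y) q₀ ≡ rest (suc k) (marks r x y) s ×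
                      Reaches (goLeft s γ c') (suc k) (γ ∷ z))
      left← {r} {x} {y} {γ} {c'} x< R zero k refl l =
        let e , nd = node-at (ℕ.<-trans l x<) in
        δ (proj₁ (proj₂ e)) (proj₁ e) target , left-end r x y l nd , stay-step (goLeft _ γ c') (stand c') (just γ) nd
            (inj₂ (refl , refl , refl , refl)) R
      left← {r} {x} {y} {γ} {c'} x< R (suc d) (suc k) refl l =
        let s' , inv , R' = left← {r} {x} {y} x< R d k refl (ℕ.<-trans (ℕ.n<1+n k) l)
            e , nd = node-at (ℕ.<-trans l x<)
            e' , nd' = node-at (ℕ.<-trans (ℕ.<-trans (ℕ.n<1+n k) l) x<)
            s = δ∅ s' (proj₁ e)
        in s , trans inv (between r x y s' (ℕ.<⇒≢ l) (ℕ.>⇒≢ (s≤s (ℕ.m≤n+m y d))) nd) ,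
           step (goLeft s γ c') (goLeft s' γ c') nothing left nd (inj₁ (refl , refl , s' , refl , refl)) refl nd' R'

      stand← : ∀ {x c z} → Trip x c z → x < N → Reaches (stand c) (suc x) z
      stand← {x} {c} (stop s) x< = let e , nd = node-at x< in
        stay-step (stand c) end nothing nd (inj₁ (refl , refl , refl , trans (≡sym (sat-same _ x x refl nd)) s)) (_ , done)
      stand← {x} {c} (_∷_ {γ = γ} {c'} {y} {z} (y< , s) t) x< with ℕ.<-cmp x y
      ... | tri≈ _ refl _ = let e , nd = node-at x< in
            stay-step (stand c) (stand c') (just γ) nd (inj₂ (γ , c' , inj₁
                (refl , refl , refl , trans (≡sym (sat-same _ x x refl nd)) s)))
              (stand← t y<)
      ... | tri< l _ _ =
            let e , nd = node-at x<
                e' , nd' = node-at (ℕ.≤-<-trans l y<)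
                s' = δ (proj₁ (proj₂ e)) (proj₁ e) (mark (edgeQ c γ c') true false)
            in step (stand c) (goRight s' γ c') nothing right nd (inj₂ (γ , c' , inj₂ (inj₁ (refl , refl , refl)))) refl nd'
                 (right← {edgeQ c γ c'} {x} {y} s' s y< (stand← t y<) (y ∸ suc x) (suc x) (ℕ.m∸n+n≡m l) ℕ.≤-refl
                   (right-start _ x y l nd))
      stand← {suc k} {c} (_∷_ {γ = γ} {c'} {y} {z} (y< , s) t) x< | tri> _ _ (s≤s l) =
            let e , nd = node-at x<
                e' , nd' = node-at (ℕ.<-trans (ℕ.n<1+n k) x<)
                s' , inv , R = left← {edgeQ c γ c'} {suc k} {y} x< (stand← t y<) (k ∸ y) k (ℕ.m∸n+n≡m l) ℕ.≤-refl
            in step (stand c) (goLeft s' γ c') nothing left nd (inj₂ (γ , c' , inj₂ (inj₂ (refl , refl , s' , refl ,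
                 trans (≡sym (trans inv (left-start _ (suc k) y s' (s≤s l) nd))) s)))) refl nd' R

      seek← : ∀ {x c z} → x < N → Sat (startQ c) x x → Reaches (stand c) (suc x) z → ∀ d k → d + k ≡ x →
              Reaches seek (suc k) z
      seek← {x} {c} x< s R zero k refl = let e , nd = node-at x< in
        stay-step seek (stand c) nothing nd (inj₂ (refl , refl , c , refl , trans (≡sym (sat-same _ x x refl nd)) s)) R
      seek← {x} x< s R (suc d) k refl =
        let e , nd = node-at (ℕ.≤-<-trans (ℕ.m≤n+m k (suc d)) x<)
            e' , nd' = node-at (ℕ.≤-<-trans (s≤s (ℕ.m≤n+m k d)) x<)
        in step seek seek nothing right nd (inj₁ (refl , refl , refl)) refl nd' (seek← x< s R d (suc k) (ℕ.+-suc d k))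

    walkM→ : ∀ {z} → MRel walkM v z → Accepted z
    walkM→ (p , r , k , refl , R , refl) = seek→ R

    walkM← : ∀ {z} → Accepted z → MRel walkM v z
    walkM← (x , c , x< , s , t) =
      let j , R = seek← x< s (stand← t x<) x 0 (ℕ.+-identityʳ x)
          e , nd = node-at (ℕ.≤-<-trans z≤n x<)
      in seek , end , j , refl , go {τ = lend} {o = nothing} refl (refl , refl , refl , refl) refl (tape← nd) R , refl

==-toℕ : ∀ {n} (x k : Fin n) → (x == k) ≡ (toℕ k ≡ᵇ toℕ x)
==-toℕ zero zero = refl
==-toℕ zero (suc k) = refl
==-toℕ (suc x) zero = refl
==-toℕ (suc x) (suc k) = ==-toℕ x k

drop-nth : ∀ {A : Set} (l : List A) k {a} → nth l k ≡ just a → drop k l ≡ a ∷ drop (suc k) l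
drop-nth (a ∷ l) zero refl = refl
drop-nth (a ∷ l) (suc k) e = drop-nth l k e

drop-length : ∀ {A : Set} (l : List A) → drop (length l) l ≡ []
drop-length [] = refl
drop-length (a ∷ l) = drop-length l

-- MSO definable string transductions: functionality and the walk along the output

module _ {n₁ n₂ : ℕ} (m : Trans n₁ n₂) (T : MSOT 1 n₁ 1 n₂)
  (H : ∀ (g : Graph 1 n₁) (h : Graph 1 n₂) →
      ((∃[ w ] ∃[ z ] (m w z × g ≅ egr w × h ≅ egr z)) → Output T g h) ×
      (Output T g h → ∃[ w ] ∃[ z ] (m w z × g ≅ egr w × h ≅ egr z))) where
  open MSOT T
  private
    image-of : ∀ {w z} → m w z → Img T (egr w) (egr z)
    image-of {w} {z} r = Output→Img T (egr w) {egr z} (proj₁ (H (egr w) (egr z))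
        (w , z , r , ≅-refl {g = egr w} , ≅-refl {g = egr z}))

    -- `H` applies to all pairs of graphs, in particular to the concrete image, and injectivity of
    -- `egr` brings the resulting input back to `w`.
    in-domain : ∀ {w} → sem (egr w) φdom e0 e0 → ∃[ z ] m w z
    in-domain {w} d = let w' , z , r , i , _ = proj₂ (H (egr w) (image T (egr w)))
                            (Img→Output T (egr w) (Img-image T (egr w) d))
                      in z , subst (λ w → m w z) (≡sym (egr-inj {w = w} {w'} i)) r

  MSOe-functional : Functional m
  MSOe-functional w z₁ z₂ r₁ r₂ =
    egr-inj {w = z₁} {z₂} (Img-unique T (egr w) {egr z₁} {egr z₂} (image-of r₁) (image-of r₂))

  private
    -- The walker asks whether copy c of a node begins the output, whether it ends the output, and
    -- whether an edge with a given letter joins two copies.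
    Query : Set
    Query = Fin nc ⊎ (Fin nc ⊎ (Fin nc × (Fin n₂ × Fin nc)))

    R : ℕ
    R = nc + (nc + nc * (n₂ * nc))

    query↔ : Query ↔ Fin R
    query↔ = ↔-sym Fin.+↔⊎ ↔-∘ (↔-id _ ⊎.⊎-↔ (↔-sym Fin.+↔⊎ ↔-∘
        (↔-id _ ⊎.⊎-↔ (↔-sym Fin.*↔× ↔-∘ (↔-id _ ×.×-↔ ↔-sym Fin.*↔×)))))

    -- Beginning and end are properties of the output graph, expressed on the input by backward
    -- translation. The domain formula is tested here, once per walk.
    startF endF : Fin nc → Form 1 n₁ 1 0
    startF c = andF (ren e0 e0 φdom) (andF (φnode c zero) (back T {1} {0} (firstF zero) (e1 c)))
    endF c = back T {1} {0} (lastF zero) (e1 c)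

    -- The target is tested to be an output node; for the source this happened when the walk arrived
    -- there, or at its start.
    arcF : Fin nc → Fin n₂ → Fin nc → Form 1 n₁ 2 0
    arcF c γ c' = andF (ren (λ _ → suc zero) e0 (φnode c' zero)) (φedge c c' γ)

    queryF : Query → Form 1 n₁ 2 0
    queryF (inj₁ c) = ren (λ _ → zero) e0 (startF c)
    queryF (inj₂ (inj₁ c)) = ren (λ _ → zero) e0 (endF c)
    queryF (inj₂ (inj₂ (c , γ , c'))) = arcF c γ c'

    -- Under the marking for query r only the set with index r contains the first marked node, so
    -- the disjunction of all queries reduces to this one.
    selF : Fin R → Form 1 n₁ 2 R
    selF r = andF (memF zero r) (ren id e0 (queryF (Inverse.from query↔ r)))

    queriesF : Form 1 n₁ 2 R
    queriesF = bigOr selF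

    A : Aut n₁ 2 R
    A = proj₁ (büchi queriesF)

    rec : Recognizes A queriesF
    rec = proj₂ (büchi queriesF)

    open Aut A using (acc; run; q₀)
    open Annotation A
    open Walker A nc (λ c → Inverse.to query↔ (inj₁ c)) (λ c → Inverse.to query↔ (inj₂ (inj₁ c)))
                     (λ c γ c' → Inverse.to query↔ (inj₂ (inj₂ (c , γ , c'))))

    run-accFrom : ∀ w {β β'} i q → (∀ k → β k ≡ β' (toℕ k + i)) → acc (run w β q) ≡ accFrom (letters w) i β' q
    run-accFrom [] i q h = cong (λ b → acc (Aut.δ A q zero b)) (h zero)
    run-accFrom (a ∷ w) {β} {β'} i q h =
      trans (run-accFrom w {β ∘ suc} {β'} (suc i) _ (λ k → trans (h (suc k)) (cong β' (≡sym (ℕ.+-suc (toℕ k) i)))))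
        (cong (λ b → accFrom (letters w) (suc i) β' (Aut.δ A q (suc a) b)) (h zero))

    module _ (w : Str n₁) where
      open Marked w using (ls; marks; Sat)
      V = Fin (suc (length w))
      g = egr w

      ren₀ : ∀ (φ : Form 1 n₁ 0 0) {X} → (sem g (ren e0 e0 φ) (e1 X) e0 → sem g φ e0 e0) ×
          (sem g φ e0 e0 → sem g (ren e0 e0 φ) (e1 X) e0)
      ren₀ φ = sem-ren g φ (λ ()) (λ ())

      ren₁ : ∀ (φ : Form 1 n₁ 1 0) {X} → (sem g (ren (λ _ → zero) e0 φ) (e2 X X) e0 → sem g φ (e1 X) e0) ×
                                         (sem g φ (e1 X) e0 → sem g (ren (λ _ → zero) e0 φ) (e2 X X) e0)
      ren₁ φ = sem-ren g φ (λ { zero → refl }) (λ ())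

      ren₂ : ∀ (φ : Form 1 n₁ 1 0) {X Y} → (sem g (ren (λ _ → suc zero) e0 φ) (e2 X Y) e0 → sem g φ (e1 Y) e0) ×
                                           (sem g φ (e1 Y) e0 → sem g (ren (λ _ → suc zero) e0 φ) (e2 X Y) e0)
      ren₂ φ = sem-ren g φ (λ { zero → refl }) (λ ())

      select : Fin R → V → Fin R → V → Bool
      select r X r' u = (toℕ u ≡ᵇ toℕ X) ∧ (r' == r)

      Sat≡ : ∀ r (X Y : V) → accFrom ls 0 (marks r (toℕ X) (toℕ Y)) q₀ ≡ sat g queriesF (e2 X Y) (select r X)
      Sat≡ r X Y = trans (≡sym (run-accFrom w 0 q₀ λ k → trans
          (cong₂ (λ b c → b ∷ᵛ (c ∷ᵛ []ᵛ) , tabulate (λ r' → (toℕ k ≡ᵇ toℕ X) ∧ (r' == r))) (==-toℕ X k) (==-toℕ Y k))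
          (cong (marks r (toℕ X) (toℕ Y)) (≡sym (ℕ.+-identityʳ (toℕ k)))))) (rec w (e2 X Y) (select r X))

      Sat→sem : ∀ s (X Y : V) → Sat (Inverse.to query↔ s) (toℕ X) (toℕ Y) → sem g (queryF s) (e2 X Y) e0
      Sat→sem s X Y h =
        let r = Inverse.to query↔ s
            r' , mb , t = bigOr-elim {g = g} {e2 X Y} {select r X} selF
                            (sem-sound {g = g} queriesF {e2 X Y} {select r X} (trans (≡sym (Sat≡ r X Y)) h))
            eq = ==-true r' r (proj₂ (∧-true {toℕ X ≡ᵇ toℕ X} mb))
        in subst (λ s → sem g (queryF s) (e2 X Y) e0) (trans (cong (Inverse.from query↔) eq)
            (Inverse.strictlyInverseʳ query↔ s))
             (proj₁ (sem-ren g (queryF (Inverse.from query↔ r')) (λ _ → refl) (λ ())) t)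

      sem→Sat : ∀ s (X Y : V) → sem g (queryF s) (e2 X Y) e0 → Sat (Inverse.to query↔ s) (toℕ X) (toℕ Y)
      sem→Sat s X Y h =
        let r = Inverse.to query↔ s in
        trans (Sat≡ r X Y) (sem-complete {g = g} queriesF {e2 X Y} {select r X}
            (bigOr-intro {g = g} {e2 X Y} {select r X} selF r
          (∧-intro (≡ᵇ-intro {toℕ X} refl) (==-refl r) ,
           proj₂ (sem-ren g (queryF (Inverse.from query↔ r)) (λ _ → refl) (λ ()))
             (subst (λ s → sem g (queryF s) (e2 X Y) e0) (≡sym (Inverse.strictlyInverseʳ query↔ s)) h))))

      node-of : ∀ {x} → x < length ls → ∃[ X ] toℕ {suc (length w)} X ≡ x
      node-of l = fromℕ< (ℕ.≤-trans l (ℕ.≤-reflexive (length-letters w))) , Fin.toℕ-fromℕ< _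

      toℕ<ls : ∀ (X : V) → toℕ X < length ls
      toℕ<ls X = ℕ.≤-trans (Fin.toℕ<n X) (ℕ.≤-reflexive (≡sym (length-letters w)))

      module _ {z₀ : Str n₂} (I : Img T g (egr z₀)) where
        open Img I

        back₁ : ∀ (φ : Form 1 n₂ 1 0) {v X c} → f v ≡ (X , c) →
                (sem (egr z₀) φ (e1 v) e0 → sem g (back T φ (e1 c)) (e1 X) e0) ×
                    (sem g (back T φ (e1 c)) (e1 X) e0 → sem (egr z₀) φ (e1 v) e0)
        back₁ φ e = back-sem T I φ (λ { zero → e }) (λ ())

        start→ : ∀ {X c} → Sat (Inverse.to query↔ (inj₁ c)) (toℕ X) (toℕ X) → f zero ≡ (X , c)
        start→ {X} {c} s =
          let _ , nd , b = proj₁ (ren₁ (startF c)) (Sat→sem (inj₁ c) X X s)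
              v , e = surj X c nd
              v≡ = first-elim z₀ {x = zero} {e1 v} {e0} (proj₂ (back₁ (firstF zero) e) b)
          in subst (λ v → f v ≡ (X , c)) v≡ e

        -- Each arc of the trip is an edge of `egr z₀`, hence leads to the next position and carries
        -- the letter there, and the stop query holds only at the last position. So the trip spells
        -- the rest of `z₀`.
        trip→ : ∀ {x c z} → Trip w x c z → ∀ v X → toℕ X ≡ x → f v ≡ (X , c) → z ≡ drop (toℕ v) z₀
        trip→ {c = c} (stop s) v X refl e =
          let b = proj₁ (ren₁ (endF c)) (Sat→sem (inj₂ (inj₁ c)) X X s)
              l = tapeSym-rend z₀ (toℕ v) (last-elim z₀ {x = zero} {e1 v} {e0} (proj₂ (back₁ (lastF zero) e) b))
          in ≡sym (trans (cong (λ k → drop k z₀) l) (drop-length z₀))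
        trip→ {c = c} (_∷_ {γ = γ} {c'} {y} {z} (y< , s) t) v X refl e =
          let Y , Y≡ = node-of y<
              nd , a = Sat→sem (inj₂ (inj₂ (c , γ , c'))) X Y (subst (Sat _ (toℕ X)) (≡sym Y≡) s)
              v' , e' = surj Y c' (proj₁ (ren₂ (φnode c' zero)) nd)
              p , q = edge-egr z₀ {v} {γ} {v'} (edge← (arc e e' a))
          in trans (cong (γ ∷_) (trans (trip→ t v' Y Y≡ e') (cong (λ k → drop k z₀) p))) (≡sym (drop-nth z₀ (toℕ v) q))
          where
          arc : ∀ {p q : V × Fin nc} → p ≡ (X , c) → ∀ {Y c'} → q ≡ (Y , c') → sem g (φedge c c' γ) (e2 X Y) e0 →
                sem g (φedge (proj₂ p) (proj₂ q) γ) (e2 (proj₁ p) (proj₁ q)) e0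
          arc refl refl a = a

        trip← : ∀ d v → d + toℕ v ≡ length z₀ → Trip w (toℕ (proj₁ (f v))) (proj₂ (f v)) (drop (toℕ v) z₀)
        trip← zero v eq = let X , c = f v in
          subst (Trip w (toℕ X) c) (≡sym (trans (cong (λ k → drop k z₀) eq) (drop-length z₀)))
            (stop (sem→Sat (inj₂ (inj₁ c)) X X (proj₂ (ren₁ (endF c))
              (proj₁ (back₁ (lastF zero) refl) (last-intro z₀ {x = zero} {e1 v} {e0}
                  (trans (cong (tapeSym z₀) eq) (rend-tapeSym z₀)))))))
        trip← (suc d) v eq =
          let X , c = f v
              l = ℕ.≤-trans (s≤s (ℕ.m≤n+m (toℕ v) d)) (ℕ.≤-reflexive eq)
              γ , q = nth-< z₀ l
              v' = suc (fromℕ< l)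
              v'≡ = cong suc (Fin.toℕ-fromℕ< l)
              Y , c' = f v'
              t = trip← d v' (trans (cong (d +_) v'≡) (trans (ℕ.+-suc d (toℕ v)) eq))
          in subst (Trip w (toℕ X) c) (≡sym (trans (drop-nth z₀ (toℕ v) q) (cong (λ k → γ ∷ drop k z₀) (≡sym v'≡))))
               ((toℕ<ls Y , sem→Sat (inj₂ (inj₂ (c , γ , c'))) X Y
                  (proj₂ (ren₂ (φnode c' zero)) (node v') ,
                   edge→ (egr-edge z₀ {v} {γ} {v'} v'≡ q))) ∷ t)

        start← : let X , c = f zero in Sat (Inverse.to query↔ (inj₁ c)) (toℕ X) (toℕ X)
        start← = let X , c = f zero in
          sem→Sat (inj₁ c) X X (proj₂ (ren₁ (startF c))
            (proj₂ (ren₀ φdom) dom , node zero ,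
             proj₁ (back₁ (firstF zero) refl) (first-intro z₀ {x = zero} {e1 zero} {e0} refl)))

      accepted→ : ∀ {z} → Accepted w z → m w z
      accepted→ {z} (x , c , x< , s , t) =
        let X , X≡ = node-of x<
            s' = subst (λ x → Sat _ x x) (≡sym X≡) s
            d , _ = proj₁ (ren₁ (startF c)) (Sat→sem (inj₁ c) X X s')
            z₀ , r = in-domain (proj₁ (ren₀ φdom) d)
            I = image-of r
        in subst (m w) (≡sym (trip→ {z₀} I t zero X X≡ (start→ {z₀} I s'))) r

      accepted← : ∀ {z} → m w z → Accepted w z
      accepted← {z} r = let I = image-of r ; X , c = Img.f I zero in
        toℕ X , c , toℕ<ls X , start← {z} I , trip← {z} I (length z) zero (ℕ.+-identityʳ _)

  -- The intermediate string of the composition can only be the annotation of the input, so the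
  -- second machine is analysed on that string alone.
  MSOe→NGSM : InNGSMPow 2 m
  MSOe→NGSM = cons (machGSM annotM) (one (machGSM walkM)) , λ w z →
    (λ r → annotW w , machGSM← annotM (annotM← {w}) , machGSM← walkM (walkM← w (accepted← w r))) ,
    (λ (v , a , b) → accepted→ w (walkM→ w (subst (λ v → MRel walkM v z) (annotM→ (machGSM→ annotM a)) (machGSM→ walkM b))))

theorem6p11 : ∀ {n₁ n₂ : ℕ} (m : Trans n₁ n₂) →
    InMSOe m ⇔ ((∃[ k ] (1 ≤ k × InNGSMPow k m)) × Functional m)
theorem6p11 m = mk⇔ (λ (T , H) → (2 , s≤s z≤n , MSOe→NGSM m T H) , MSOe-functional m T H) (NGSM→MSOe m)
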